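{- Let $\mathcal{M}$ be a set of machine types whose cost rates are integer powers of $8$, and let $\mathcal{J}$ be a set of jobs. Let $ALG_{offline}(\mathcal{J})$ be the cost of the schedule produced by the algorithm $ALG_{offline}$, and let $\mathrm{OPT}_{BSHM}(\mathcal{J})$ be the optimal cost of Busy-time Scheduling on Heterogeneous Machines (BSHM) for $\mathcal{J}$. Then $$ALG_{offline}(\mathcal{J})\le 180\cdot \mathrm{OPT}_{BSHM}(\mathcal{J}).$$ Consequently, there is a universal constant $C$ and a polynomial-time offline algorithm that, for every set of machine types (with arbitrary positive cost rates) and every set of jobs, produces a feasible BSHM schedule of cost at most $C$ times the optimal cost; i.e. offline BSHM admits an $O(1)$-approximation algorithm.
   Context: BSHM. Machine types are indexed by $\mathcal{M}=\{1,\dots,|\mathcal{M}|\}$; type $z$ has capacity $g_z>0$ and cost rate $r_z>0$ per unit time, and unlimitedly many machines of each type are available. Without loss of generality (dropping dominated types) $g_1<\dots<g_{|\mathcal{M}|}$ and $r_1<\dots<r_{|\mathcal{M}|}$. The input also contains a finite set $\mathcal{J}$ of jobs; job $J$ has a size $s(J)\in(0,g_{|\mathcal{M}|}]$ and an active interval $I(J)=[I(J)^-,I(J)^+)$ of positive length. A schedule assigns each job to one machine, on which it runs throughout $I(J)$; at every time the total size of the jobs active on a machine must not exceed its capacity. A machine of type $z$ costs $r_z$ times the total length of time during which at least one of its jobs is active. The cost of a schedule is the total cost of all machines; $\mathrm{OPT}_{BSHM}(\mathcal{J})$ is the minimum cost. Cost-per-capacity graph. $p(i)=\min\{j>i: r_j/g_j<r_i/g_i\}$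 (the parent of $i$) if it exists; $f(i)=\{z:p(z)=i\}$ (children); $P(i)=\{i,p(i),p(p(i)),\dots\}$; $A_i=\{z: i\in P(z)\}$. Notation. $m(J)$ is the type with $s(J)\in(g_{m(J)-1},g_{m(J)}]$, where $g_0=0$. For a set of jobs $\mathcal{X}$: $S(\mathcal{X})=\sum_{J\in\mathcal{X}}s(J)$, $\mathrm{span}(\mathcal{X})=\bigcup_{J\in\mathcal{X}}I(J)$, $\mathcal{X}(t)=\{J\in\mathcal{X}:t\in I(J)\}$, $S(\mathcal{X},t)=S(\mathcal{X}(t))$. $R_z=\{J\in\mathcal{J}: m(J)\in A_z\}$. Algorithm $ALG_{offline}$. For $z=|\mathcal{M}|,|\mathcal{M}|-1,\dots,1$: let $\mathcal{R}_z=R_z\setminus\bigcup_{i>z}K_i$ and $\mathcal{R}^h_z=\{J\in\mathcal{R}_z:m(J)=z\}$; for $x\in f(z)$ and each time $t$ let $F_{x,t}=\{J\in\mathcal{R}_z(t):m(J)\in A_x\}$; let $c_{z,t}=\sum_{x\in f(z)}\lceil S(F_{x,t})/g_x\rceil\, r_x$ and $\mathcal{T}_z=\mathrm{span}(\mathcal{R}^h_z)\cup\{t:c_{z,t}\ge \frac13 r_z\}$; set $K_z=\mathcal{R}^h_z\cup\{J\in\mathcal{R}_z\setminus\mathcal{R}^h_z: I(J)\subseteq\mathcal{T}_z\}$. The jobs of $K_z$ are then scheduled on type-$z$ machines by the dual coloring algorithm of Ren and Tang (2016), a known polynomial-time algorithm for identical machines; the property of it that is taken as known is that, for any set $K$ of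 jobs with sizes at most $g$, it produces a feasible schedule on machines of capacity $g$ in which at every time $t$ at most $4\lceil S(K,t)/g\rceil$ machines are busy.
   Formalization: In the polynomial-time claim all sizes, capacities, cost rates and times are rational numbers, encoded in binary; the bound 180 is proved over any Archimedean ordered field with decidable order, which includes the reals given excluded middle. -}

module Defs where

open import Algebra.Bundles using (CommutativeRing)
open import Algebra.Structures using (IsCommutativeRing)
import Algebra.Properties.CommutativeMonoid.Sum as Summation
import Algebra.Properties.Monoid.Mult as Multiple
import Algebra.Properties.Semiring.Exp as Power
open import Data.Fin as Fin using (Fin; zero; suc; toℕ; inject₁; opposite; fromℕ<)
import Data.Fin.Properties as Fin
open import Data.Fin.Subset using (Subset; _∈_; _∉_; _∩_; _∪_; _─_; ⊥; Nonempty)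
open import Data.Fin.Subset.Properties
  using (_∈?_; nonempty?; x∈p∪q⁻; x∈p∪q⁺; x∈p∩q⁺; x∈p∩q⁻; ∉⊥; x∈p∧x∉q⇒x∈p─q; p─q⊆p)
open import Data.Integer as ℤ using (ℤ; +_; -[1+_])
import Data.Integer.Properties as ℤ
open import Data.List as List
  using (List; []; _∷_; _++_; filter; head; allFin; deduplicate; length; zip; drop)
open import Data.List.Membership.Propositional using () renaming (_∈_ to _∈ₗ_)
import Data.List.Membership.DecPropositional as DecMembership
open import Data.List.Membership.Propositional.Properties using (∈-++⁺ˡ; ∈-++⁺ʳ; ∈-tabulate⁺)
open import Data.List.Relation.Unary.All as All using (All; []; _∷_)
import Data.List.Relation.Unary.All.Properties as All
open import Data.List.Relation.Unary.Any as Any using (here; there)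
import Data.List.Sort as Sort
open import Data.Maybe as Maybe using (Maybe; just; maybe′)
import Data.Maybe.Properties as Maybe
open import Data.Nat as ℕ using (ℕ; zero; suc)
open import Data.Nat.Logarithm using (⌊log₂_⌋)
import Data.Nat.Properties as ℕ
open import Data.Product using (∃; _×_; _,_; proj₁; proj₂)
import Data.Product.Properties as Product
open import Data.Rational as ℚ using (ℚ; ↥_; ↧_; 0ℚ; 1ℚ)
import Data.Rational.Properties as ℚ
open import Data.Rational.Unnormalised as ℚᵘ using (mkℚᵘ; *≤*)
import Data.Rational.Unnormalised.Properties as ℚᵘ
open import Data.Sum using (_⊎_; inj₁; inj₂)
open import Data.Vec as Vec using (tabulate)
open import Data.Vec.Properties using (lookup∘tabulate; []=⇒lookup; lookup⇒[]=; tabulate-cong)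
open import Data.Bool using (if_then_else_)
open import Function using (_∘_; id; _⇔_; mk⇔)
open import Relation.Binary.Bundles using (DecTotalOrder)
import Relation.Binary.Construct.NonStrictToStrict as ToStrict
open import Relation.Binary.PropositionalEquality
open import Relation.Binary.Structures using (IsDecTotalOrder)
open import Relation.Nullary using (¬_; Dec; yes; no; contradiction)
open import Relation.Nullary.Decidable
  using (_×-dec_; _⊎-dec_; does; map′; dec-true; does-⇔)
open import Relation.Unary using (Decidable)

-- Sizes, capacities, rates and times live in an arbitrary Archimedean
-- ordered field with decidable order.  Classically ℝ is one; ℚ is the
-- one used for polynomial time, where inputs must have finite encodings.

record OrderedField : Set₁ where
  infix  8 _⁻¹ _^ᶻ_
  infixl 7 _*_ _/_
  infixl 6 _+_
  infix  4 _≤_ _<?_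
  field
    Carrier           : Set
    _+_ _*_           : Carrier → Carrier → Carrier
    -_                : Carrier → Carrier
    0# 1#             : Carrier
    _⁻¹               : Carrier → Carrier          -- unspecified at 0#
    _≤_               : Carrier → Carrier → Set
    isCommutativeRing : IsCommutativeRing _≡_ _+_ _*_ -_ 0# 1#
    isDecTotalOrder   : IsDecTotalOrder _≡_ _≤_
    0≢1               : 0# ≢ 1#
    ⁻¹-inverseʳ       : ∀ x → x ≢ 0# → x * x ⁻¹ ≡ 1#
    +-monoʳ-≤         : ∀ x {y z} → y ≤ z → x + y ≤ x + z
    *-nonNeg          : ∀ {x y} → 0# ≤ x → 0# ≤ y → 0# ≤ x * y

  commutativeRing : CommutativeRing _ _
  commutativeRing = record { isCommutativeRing = isCommutativeRing }

  open CommutativeRing commutativeRing public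
    using (+-monoid; +-commutativeMonoid; semiring; _-_)

  open Multiple +-monoid public using () renaming (_×_ to _·_)

  fromℕ : ℕ → Carrier
  fromℕ n = n · 1#

  field
    archimedean : ∀ x → ∃ λ n → x ≤ fromℕ n

  decTotalOrder : DecTotalOrder _ _ _
  decTotalOrder = record { isDecTotalOrder = isDecTotalOrder }

  open IsDecTotalOrder isDecTotalOrder public using (_≟_; _≤?_; total)
    renaming (refl to ≤-refl; trans to ≤-trans; antisym to ≤-antisym)
  open ToStrict _≡_ _≤_ public using (_<_)

  _<?_ : ∀ x y → Dec (x < y)
  _<?_ = ToStrict.<-decidable _≡_ _≤_ _≟_ _≤?_

  open Summation +-commutativeMonoid public using (sum)
  open Power semiring public using (_^_)
  open Sort decTotalOrder public using (sort)

  _/_ : Carrier → Carrier → Carrier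
  x / y = x * y ⁻¹

  _^ᶻ_ : Carrier → ℤ → Carrier
  x ^ᶻ (+ n)    = x ^ n
  x ^ᶻ -[1+ n ] = (x ^ suc n) ⁻¹

  sumᴸ : List Carrier → Carrier
  sumᴸ = List.foldr _+_ 0#

  -- the first of k, k + 1, …, k + fuel that is at least x, if any
  leastFrom : (fuel k : ℕ) → Carrier → ℕ
  leastFrom zero       k x = k
  leastFrom (suc fuel) k x = if does (x ≤? fromℕ k) then k else leastFrom fuel (suc k) x

  -- The least natural number that is at least x: the ceiling of x for the
  -- nonnegative arguments that occur here.
  ⌈_⌉ : Carrier → ℕ
  ⌈ x ⌉ = leastFrom (proj₁ (archimedean x)) 0 x

inverseℚ : ℚ → ℚ
inverseℚ q with q ℚ.≟ 0ℚ
... | yes _   = 0ℚ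
... | no  q≢0 = ℚ.1/_ q {{ℚ.≢-nonZero q≢0}}

inverseℚ-inverseʳ : ∀ q → q ≢ 0ℚ → q ℚ.* inverseℚ q ≡ 1ℚ
inverseℚ-inverseʳ q q≢0 with q ℚ.≟ 0ℚ
... | yes q≡0 = contradiction q≡0 q≢0
... | no  q≢  = ℚ.*-inverseʳ q {{ℚ.≢-nonZero q≢}}

+-monoidℚ = CommutativeRing.+-monoid ℚ.+-*-commutativeRing
open Multiple +-monoidℚ using () renaming (_×_ to _·_)

toℚᵘ-· : ∀ n → ℚ.toℚᵘ (n · 1ℚ) ℚᵘ.≃ mkℚᵘ (+ n) 0
toℚᵘ-· zero    = ℚᵘ.≃-refl
toℚᵘ-· (suc n) = ℚᵘ.≃-trans (ℚ.toℚᵘ-homo-+ 1ℚ (n · 1ℚ))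
  (ℚᵘ.≃-trans (ℚᵘ.+-congʳ (ℚ.toℚᵘ 1ℚ) (toℚᵘ-· n))
    (ℚᵘ.≃-reflexive (cong (λ k → mkℚᵘ (+ 1 ℤ.+ k) 0) (ℤ.*-identityʳ (+ n)))))

archimedeanℚ : ∀ q → ∃ λ n → q ℚ.≤ n · 1ℚ
archimedeanℚ q = ℤ.∣ ↥ q ∣ , ℚ.toℚᵘ-cancel-≤
  (ℚᵘ.≤-respʳ-≃ (ℚᵘ.≃-sym (toℚᵘ-· ℤ.∣ ↥ q ∣)) (bound q))
  where
  bound : ∀ p → ℚ.toℚᵘ p ℚᵘ.≤ mkℚᵘ (+ ℤ.∣ ↥ p ∣) 0
  bound (ℚ.mkℚ (+ n) d _) = *≤* (subst₂ ℤ._≤_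
    (sym (ℤ.*-identityʳ (+ n))) (ℤ.pos-* n (suc d))
    (ℤ.+≤+ (ℕ.m≤m*n n (suc d))))
  bound (ℚ.mkℚ -[1+ n ] d _) = *≤* ℤ.-≤+

ℚ-orderedField : OrderedField
ℚ-orderedField = record
  { Carrier           = ℚ
  ; _+_               = ℚ._+_
  ; _*_               = ℚ._*_
  ; -_                = ℚ.-_
  ; 0#                = 0ℚ
  ; 1#                = 1ℚ
  ; _⁻¹               = inverseℚ
  ; _≤_               = ℚ._≤_
  ; isCommutativeRing = ℚ.+-*-isCommutativeRing
  ; isDecTotalOrder   = ℚ.≤-isDecTotalOrder
  ; 0≢1               = λ ()
  ; ⁻¹-inverseʳ       = inverseℚ-inverseʳ
  ; +-monoʳ-≤         = ℚ.+-monoʳ-≤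
  ; *-nonNeg          = λ {x} {y} 0≤x 0≤y → ℚ.nonNegative⁻¹ (x ℚ.* y)
      {{ℚ.nonNeg*nonNeg⇒nonNeg x {{ℚ.nonNegative 0≤x}} y {{ℚ.nonNegative 0≤y}}}}
  ; archimedean       = archimedeanℚ
  }


opaque

  ⟪_⟫ : ∀ {n} {P : Fin n → Set} → Decidable P → Subset n
  ⟪ P? ⟫ = tabulate (does ∘ P?)

  ∈⟪⟫⁺ : ∀ {n} {P : Fin n → Set} (P? : Decidable P) → ∀ {i} → P i → i ∈ ⟪ P? ⟫
  ∈⟪⟫⁺ P? {i} p = lookup⇒[]= i _
    (trans (lookup∘tabulate (does ∘ P?) i) (dec-true (P? i) p))

  ∈⟪⟫⁻ : ∀ {n} {P : Fin n → Set} (P? : Decidable P) → ∀ {i} → i ∈ ⟪ P? ⟫ → P i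
  ∈⟪⟫⁻ P? {i} i∈
    with P? i | trans (sym (lookup∘tabulate (does ∘ P?) i)) ([]=⇒lookup i∈)
  ... | yes p | _  = p
  ... | no  _ | ()

  ⟪⟫-cong : ∀ {n} {P Q : Fin n → Set} (P? : Decidable P) (Q? : Decidable Q) →
            (∀ i → P i ⇔ Q i) → ⟪ P? ⟫ ≡ ⟪ Q? ⟫
  ⟪⟫-cong P? Q? P⇔Q = tabulate-cong λ i → does-⇔ (P⇔Q i) (P? i) (Q? i)

module BSHM (𝔽 : OrderedField) where

  open OrderedField 𝔽

  ∑[_] : ∀ {n} → Subset n → (Fin n → Carrier) → Carrier
  ∑[ X ] f = sum (λ i → if does (i ∈? X) then f i else 0#)

  record Jobs (n : ℕ) : Set where
    field
      s I⁻ I⁺     : Fin n → Carrier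
      s-positive  : ∀ J → 0# < s J
      I-positive  : ∀ J → I⁻ J < I⁺ J

  module OnJobs {n} (𝒥 : Jobs n) where

    open Jobs 𝒥 public

    _∈I_ : Carrier → Fin n → Set
    t ∈I J = I⁻ J ≤ t × t < I⁺ J

    _∈I?_ : ∀ t J → Dec (t ∈I J)
    t ∈I? J = (I⁻ J ≤? t) ×-dec (t <? I⁺ J)

    active : Carrier → Subset n
    active t = ⟪ (λ J → t ∈I? J) ⟫

    _at_ : Subset n → Carrier → Subset n
    X at t = X ∩ active t

    S : Subset n → Carrier
    S X = ∑[ X ] s

    span : Subset n → Carrier → Set
    span X t = Nonempty (X at t)

    span? : ∀ X t → Dec (span X t)
    span? X t = nonempty? (X at t)

    endpoints : List Carrier
    endpoints = List.tabulate I⁻ ++ List.tabulate I⁺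

    -- The half-open intervals between consecutive endpoints of jobs.  No
    -- job starts or ends strictly inside one of them.
    cells : List (Carrier × Carrier)
    cells = zip (sort endpoints) (drop 1 (sort endpoints))

    -- The total length of span(X), which is the disjoint union of the
    -- cells whose left end it contains.
    ∥_∥ : Subset n → Carrier
    ∥ X ∥ = sumᴸ (List.map (λ (a , b) → if does (span? X a) then b - a else 0#) cells)

  record DualColouringInput : Set where
    field
      {n}        : ℕ
      jobs       : Jobs n
      K          : Subset n
      g          : Carrier
      g-positive : 0# < g
      K-fits     : ∀ {J} → J ∈ K → Jobs.s jobs J ≤ g

  -- c J is the index of the machine, among identical machines of capacity
  -- g, that runs job J of K; its value on jobs outside K is irrelevant.
  record IsDualColouring (ι : DualColouringInput)
                         (c : Fin (DualColouringInput.n ι) → ℕ) : Set where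
    open DualColouringInput ι
    open OnJobs jobs

    busyMachines : Carrier → List ℕ
    busyMachines t =
      deduplicate ℕ._≟_ (List.map c (filter (λ J → J ∈? (K at t)) (allFin n)))

    field
      feasible : ∀ t i → S ((K ∩ ⟪ (λ J → c J ℕ.≟ i) ⟫) at t) ≤ g
      busy     : ∀ t → length (busyMachines t) ℕ.≤ 4 ℕ.* ⌈ S (K at t) / g ⌉

  record DualColouring : Set where
    field
      colour          : (ι : DualColouringInput) → Fin (DualColouringInput.n ι) → ℕ
      isDualColouring : ∀ ι → IsDualColouring ι (colour ι)

  record Instance : Set where
    field
      top        : ℕ

    -- The machine types 1, …, |ℳ| are numbered from 0 to top.
    Type : Set
    Type = Fin (suc top)

    field
      g r        : Type → Carrier
      g-positive : ∀ z → 0# < g z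
      r-positive : ∀ z → 0# < r z
      g-mono-<   : ∀ {y z} → y Fin.< z → g y < g z
      r-mono-<   : ∀ {y z} → y Fin.< z → r y < r z
      {n}        : ℕ
      jobs       : Jobs n
      fits       : ∀ J → Jobs.s jobs J ≤ g (Fin.fromℕ top)

  PowersOf8 : Instance → Set
  PowersOf8 𝓘 = ∀ z → ∃ λ e → r z ≡ fromℕ 8 ^ᶻ e
    where open Instance 𝓘

  module Scheduling (𝓘 : Instance) where

    open Instance 𝓘 public
    open OnJobs jobs public

    Machine : Set
    Machine = Type × ℕ

    _≟ᴹ_ : (μ ν : Machine) → Dec (μ ≡ ν)
    _≟ᴹ_ = Product.≡-dec Fin._≟_ ℕ._≟_

    Schedule : Set
    Schedule = Fin n → Machine

    jobsOn : Schedule → Machine → Subset n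
    jobsOn σ μ = ⟪ (λ J → σ J ≟ᴹ μ) ⟫

    Feasible : Schedule → Set
    Feasible σ = ∀ t μ → S (jobsOn σ μ at t) ≤ g (proj₁ μ)

    usedMachines : Schedule → List Machine
    usedMachines σ = deduplicate _≟ᴹ_ (List.tabulate σ)

    cost : Schedule → Carrier
    cost σ = sumᴸ (List.map (λ μ → r (proj₁ μ) * ∥ jobsOn σ μ ∥) (usedMachines σ))

    IsOPT : Carrier → Set
    IsOPT v = (∃ λ σ → Feasible σ × cost σ ≡ v) × (∀ σ → Feasible σ → v ≤ cost σ)

    infix 4 _CostsAtMost_×OPT
    _CostsAtMost_×OPT : Schedule → ℕ → Set
    σ CostsAtMost C ×OPT = ∃ λ opt → IsOPT opt × cost σ ≤ fromℕ C * opt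

  module Offline (𝓘 : Instance) where

    open Scheduling 𝓘
    open DecMembership (Fin._≟_ {suc (Instance.top 𝓘)}) using () renaming (_∈?_ to _∈ₗ?_)

    previous : ∀ {k} → Carrier → (Fin (suc k) → Carrier) → Fin (suc k) → Carrier
    previous lo h zero    = lo
    previous lo h (suc z) = h (inject₁ z)

    -- (g_{z-1} , g_z], with 0 in place of g_{z-1} for the smallest type
    SizeClass : Type → Carrier → Set
    SizeClass z x = previous 0# g z < x × x ≤ g z

    ≰⇒> : ∀ {x y} → ¬ (x ≤ y) → y < x
    ≰⇒> = ToStrict.≰⇒> _≡_ _≤_ sym (λ { refl → ≤-refl }) total

    classify : ∀ k (h : Fin (suc k) → Carrier) lo {x} → lo < x → x ≤ h (Fin.fromℕ k) →
               ∃ λ z → previous lo h z < x × x ≤ h z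
    classify zero    h lo lo<x x≤ = zero , lo<x , x≤
    classify (suc k) h lo {x} lo<x x≤ with x ≤? h zero
    ... | yes x≤h₀ = zero , lo<x , x≤h₀
    ... | no  x≰h₀ with classify k (h ∘ suc) (h zero) (≰⇒> x≰h₀) x≤
    ...   | zero  , p = suc zero , p
    ...   | suc z , p = suc (suc z) , p

    typeOf : ∀ J → ∃ λ z → SizeClass z (s J)
    typeOf J = classify top g 0# (s-positive J) (fits J)

    m : Fin n → Type
    m J = proj₁ (typeOf J)

    -- allFin lists the types in increasing order.
    p : Type → Maybe Type
    p i = head (filter (λ j → (i Fin.<? j) ×-dec (r j / g j <? r i / g i)) (allFin _))

    f : Type → Subset (suc top)
    f i = ⟪ (λ z → Maybe.≡-dec Fin._≟_ (p z) (just i)) ⟫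

    path : ℕ → Type → List Type
    path zero       i = []
    path (suc fuel) i = i ∷ maybe′ (path fuel) [] (p i)

    -- As p i exceeds i, a path has at most suc top vertices.
    P : Type → List Type
    P = path (suc top)

    A : Type → Subset (suc top)
    A i = ⟪ (λ z → i ∈ₗ? P z) ⟫

    R : Type → Subset n
    R z = ⟪ (λ J → m J ∈? A z) ⟫

    -- One iteration of the loop; T is the union of the sets K_i, i > z.
    module Iteration (z : Type) (T : Subset n) where

      𝓡 : Subset n
      𝓡 = R z ─ T

      𝓡ʰ : Subset n
      𝓡ʰ = 𝓡 ∩ ⟪ (λ J → m J Fin.≟ z) ⟫

      F : Type → Carrier → Subset n
      F x t = (𝓡 at t) ∩ ⟪ (λ J → m J ∈? A x) ⟫

      c : Carrier → Carrier
      c t = ∑[ f z ] (λ x → fromℕ ⌈ S (F x t) / g x ⌉ * r x)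

      𝓣 : Carrier → Set
      𝓣 t = span 𝓡ʰ t ⊎ r z / fromℕ 3 ≤ c t

      𝓣? : Decidable 𝓣
      𝓣? t = span? 𝓡ʰ t ⊎-dec (r z / fromℕ 3 ≤? c t)

      I⊆𝓣 : Fin n → Set
      I⊆𝓣 J = ∀ t → t ∈I J → 𝓣 t

      <-≤-trans : ∀ {x y z} → x < y → y ≤ z → x < z
      <-≤-trans = ToStrict.<-≤-trans _≡_ _≤_ sym ≤-trans ≤-antisym (λ { refl → id })

      ≤-<-trans : ∀ {x y z} → x ≤ y → y < z → x < z
      ≤-<-trans = ToStrict.≤-<-trans _≡_ _≤_ ≤-trans ≤-antisym (λ { refl → id })

      <-irrefl : ∀ {x} → ¬ (x < x)
      <-irrefl = ToStrict.<-irrefl _≡_ _≤_ refl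

      𝓣-active : ∀ {t u} → active t ≡ active u → 𝓣 u → 𝓣 t
      𝓣-active eq = subst 𝓣ₐ (sym eq)
        where
        𝓣ₐ : Subset n → Set
        𝓣ₐ a = Nonempty (𝓡ʰ ∩ a) ⊎ r z / fromℕ 3 ≤
          ∑[ f z ] (λ x → fromℕ ⌈ S ((𝓡 ∩ a) ∩ ⟪ (λ J → m J ∈? A x) ⟫) / g x ⌉ * r x)

      LastBefore : List Carrier → Carrier → Carrier → Set
      LastBefore es t e = e ≤ t × All (λ d → d ≤ t → d ≤ e) es

      lastBefore : ∀ es t e₀ → e₀ ≤ t →
                   ∃ λ e → e₀ ≤ e × (e ≡ e₀ ⊎ e ∈ₗ es) × LastBefore es t e
      lastBefore [] t e₀ e₀≤t = e₀ , ≤-refl , inj₁ refl , e₀≤t , []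
      lastBefore (d ∷ es) t e₀ e₀≤t with lastBefore es t e₀ e₀≤t
      ... | e , e₀≤e , e∈ , e≤t , last with d ≤? t | total d e
      ...   | no  d≰t | _        = e , e₀≤e , weaken e∈ , e≤t , (λ d≤t → contradiction d≤t d≰t) ∷ last
        where
        weaken : e ≡ e₀ ⊎ e ∈ₗ es → e ≡ e₀ ⊎ e ∈ₗ d ∷ es
        weaken (inj₁ eq) = inj₁ eq
        weaken (inj₂ i)  = inj₂ (there i)
      ...   | yes d≤t | inj₁ d≤e = e , e₀≤e , weaken e∈ , e≤t , (λ _ → d≤e) ∷ last
        where
        weaken : e ≡ e₀ ⊎ e ∈ₗ es → e ≡ e₀ ⊎ e ∈ₗ d ∷ es
        weaken (inj₁ eq) = inj₁ eq
        weaken (inj₂ i)  = inj₂ (there i)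
      ...   | yes d≤t | inj₂ e≤d = d , ≤-trans e₀≤e e≤d , inj₂ (here refl) , d≤t
                                 , (λ _ → ≤-refl) ∷ All.map (λ h x≤t → ≤-trans (h x≤t) e≤d) last

      same-active : ∀ {t e} → LastBefore endpoints t e → active t ≡ active e
      same-active {t} {e} (e≤t , last) =
        ⟪⟫-cong (λ J → t ∈I? J) (λ J → e ∈I? J) (λ J → mk⇔ (to J) (from J))
        where
        to : ∀ J → t ∈I J → e ∈I J
        to J (a≤t , t<b) = All.lookup last (∈-++⁺ˡ (∈-tabulate⁺ {f = I⁻} J)) a≤t , ≤-<-trans e≤t t<b

        from : ∀ J → e ∈I J → t ∈I J
        from J (a≤e , e<b) = ≤-trans a≤e e≤t , ≰⇒> λ b≤t →
          <-irrefl (<-≤-trans e<b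
            (All.lookup last (∈-++⁺ʳ (List.tabulate I⁻) (∈-tabulate⁺ {f = I⁺} J)) b≤t))

      I⊆𝓣? : Decidable I⊆𝓣
      I⊆𝓣? J = map′ extend restrict
        (All.all? (λ e → implies? (e ∈I? J) (𝓣? e)) endpoints)
        where
        implies? : ∀ {X Y : Set} → Dec X → Dec Y → Dec (X → Y)
        implies? (no ¬x) _       = yes λ x → contradiction x ¬x
        implies? (yes x) (yes y) = yes λ _ → y
        implies? (yes x) (no ¬y) = no λ h → ¬y (h x)

        restrict : I⊆𝓣 J → All (λ e → e ∈I J → 𝓣 e) endpoints
        restrict h = All.tabulate λ {e} _ → h e

        extend : All (λ e → e ∈I J → 𝓣 e) endpoints → I⊆𝓣 J
        extend h t (a≤t , t<b) = transport (lastBefore endpoints t (I⁻ J) a≤t)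
          where
          member : ∀ {e} → e ≡ I⁻ J ⊎ e ∈ₗ endpoints → e ∈ₗ endpoints
          member (inj₁ refl) = ∈-++⁺ˡ (∈-tabulate⁺ {f = I⁻} J)
          member (inj₂ i)    = i

          transport : (∃ λ e → I⁻ J ≤ e × (e ≡ I⁻ J ⊎ e ∈ₗ endpoints) × LastBefore endpoints t e) →
                      𝓣 t
          transport (e , a≤e , e∈ , last) = 𝓣-active (same-active last)
            (All.lookup h (member e∈) (a≤e , ≤-<-trans (proj₁ last) t<b))

      selected : Subset n
      selected = 𝓡ʰ ∪ ((𝓡 ─ 𝓡ʰ) ∩ ⟪ I⊆𝓣? ⟫)

    -- The union of K_i over the d largest types i
    taken : ∀ d → .(d ℕ.≤ suc top) → Subset n
    taken zero    _  = ⊥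
    taken (suc d) d< =
      taken d (ℕ.<⇒≤ d<) ∪ Iteration.selected (opposite (fromℕ< d<)) (taken d (ℕ.<⇒≤ d<))

    -- toℕ (opposite z) is the number of types larger than z.
    K : Type → Subset n
    K z = Iteration.selected z (taken (toℕ (opposite z)) (ℕ.<⇒≤ (Fin.toℕ<n (opposite z))))

    taken-cong : ∀ {d e} .{p : d ℕ.≤ suc top} .{q : e ℕ.≤ suc top} →
                 d ≡ e → taken d p ≡ taken e q
    taken-cong refl = refl

    ∈taken⇒∈K : ∀ d .(d≤ : d ℕ.≤ suc top) {J} → J ∈ taken d d≤ → ∃ λ z → J ∈ K z
    ∈taken⇒∈K zero    _  {J} J∈ = contradiction J∈ ∉⊥
    ∈taken⇒∈K (suc d) d< {J} J∈ =
      case (x∈p∪q⁻ (taken d (ℕ.<⇒≤ d<)) (Iteration.selected z (taken d (ℕ.<⇒≤ d<))) J∈)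
      where
      z : Type
      z = opposite (fromℕ< d<)

      d≡ : d ≡ toℕ (opposite z)
      d≡ = sym (trans (cong toℕ (Fin.opposite-involutive (fromℕ< d<))) (Fin.toℕ-fromℕ< d<))

      selected≡K : Iteration.selected z (taken d (ℕ.<⇒≤ d<)) ≡ K z
      selected≡K = cong (Iteration.selected z) (taken-cong d≡)

      case : J ∈ taken d (ℕ.<⇒≤ d<) ⊎ J ∈ Iteration.selected z (taken d (ℕ.<⇒≤ d<)) →
             ∃ λ z → J ∈ K z
      case (inj₁ J∈d) = ∈taken⇒∈K d (ℕ.<⇒≤ d<) J∈d
      case (inj₂ J∈s) = z , subst (J ∈_) selected≡K J∈s

    z∈Az : ∀ z → z ∈ A z
    z∈Az z = ∈⟪⟫⁺ (λ y → z ∈ₗ? P y) (here refl)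

    J∈R[m] : ∀ J → J ∈ R (m J)
    J∈R[m] J = ∈⟪⟫⁺ (λ J′ → m J′ ∈? A (m J)) (z∈Az (m J))

    covered : ∀ J → ∃ λ z → J ∈ K z
    covered J = case (J ∈? T)
      where
      d = toℕ (opposite (m J))

      T : Subset n
      T = taken d (ℕ.<⇒≤ (Fin.toℕ<n (opposite (m J))))

      open Iteration (m J) T using (𝓡; 𝓡ʰ; I⊆𝓣?)

      J∈𝓡ʰ : J ∉ T → J ∈ 𝓡ʰ
      J∈𝓡ʰ J∉ = x∈p∩q⁺ {p = 𝓡} {q = ⟪ (λ J′ → m J′ Fin.≟ m J) ⟫}
        ( x∈p∧x∉q⇒x∈p─q {p = R (m J)} (J∈R[m] J) J∉
        , ∈⟪⟫⁺ (λ J′ → m J′ Fin.≟ m J) refl )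

      case : Dec (J ∈ T) → ∃ λ z → J ∈ K z
      case (yes J∈) = ∈taken⇒∈K d _ J∈
      case (no  J∉) =
        m J , x∈p∪q⁺ {p = 𝓡ʰ} {q = (𝓡 ─ 𝓡ʰ) ∩ ⟪ I⊆𝓣? ⟫} (inj₁ (J∈𝓡ʰ J∉))

    machineType : Fin n → Type
    machineType J = proj₁ (covered J)

    head-satisfies : ∀ {Q : Type → Set} {zs j} → All Q zs → head zs ≡ just j → Q j
    head-satisfies (q ∷ _) refl = q

    p-increases : ∀ i {j} → p i ≡ just j → i Fin.< j
    p-increases i eq = proj₁ (head-satisfies {Q = λ j → i Fin.< j × r j / g j < r i / g i}
      (All.all-filter (λ j → (i Fin.<? j) ×-dec (r j / g j <? r i / g i)) (allFin _)) eq)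

    path-≥ : ∀ fuel i {z} → z ∈ₗ path fuel i → i Fin.≤ z
    path-≥ (suc fuel) i (here refl) = ℕ.≤-refl
    path-≥ (suc fuel) i (there z∈) with p i in eq
    ... | just j = ℕ.≤-trans (ℕ.<⇒≤ (p-increases i eq)) (path-≥ fuel j z∈)

    R-fits : ∀ z {J} → J ∈ R z → s J ≤ g z
    R-fits z {J} J∈ = ≤-trans (proj₂ (proj₂ (typeOf J))) (g-mono-≤ (m J) z m≤z)
      where
      m≤z : m J Fin.≤ z
      m≤z = path-≥ (suc top) (m J) (∈⟪⟫⁻ (λ y → z ∈ₗ? P y) (∈⟪⟫⁻ (λ J → m J ∈? A z) J∈))

      g-mono-≤ : ∀ y z → y Fin.≤ z → g y ≤ g z
      g-mono-≤ y z y≤z with y Fin.≟ z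
      ... | yes refl = ≤-refl
      ... | no  y≢z  = proj₁ (g-mono-< (Fin.≤∧≢⇒< y≤z y≢z))

    K⊆R : ∀ z {J} → J ∈ K z → J ∈ R z
    K⊆R z {J} J∈ = case (x∈p∪q⁻ 𝓡ʰ ((𝓡 ─ 𝓡ʰ) ∩ ⟪ I⊆𝓣? ⟫) J∈)
      where
      T = taken (toℕ (opposite z)) (ℕ.<⇒≤ (Fin.toℕ<n (opposite z)))
      open Iteration z T using (𝓡; 𝓡ʰ; I⊆𝓣?)

      𝓡⊆R : J ∈ 𝓡 → J ∈ R z
      𝓡⊆R = p─q⊆p (R z) T

      case : J ∈ 𝓡ʰ ⊎ J ∈ (𝓡 ─ 𝓡ʰ) ∩ ⟪ I⊆𝓣? ⟫ → J ∈ R z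
      case (inj₁ J∈ʰ) = 𝓡⊆R (proj₁ (x∈p∩q⁻ 𝓡 ⟪ (λ J → m J Fin.≟ z) ⟫ J∈ʰ))
      case (inj₂ J∈ᵗ) = 𝓡⊆R (p─q⊆p 𝓡 𝓡ʰ (proj₁ (x∈p∩q⁻ (𝓡 ─ 𝓡ʰ) ⟪ I⊆𝓣? ⟫ J∈ᵗ)))

    input : Type → DualColouringInput
    input z = record
      { jobs = jobs ; K = K z ; g = g z ; g-positive = g-positive z ; K-fits = λ J∈ → R-fits z (K⊆R z J∈) }

    ALG-offline : DualColouring → Schedule
    ALG-offline dc J = machineType J , DualColouring.colour dc (input (machineType J)) J

-- The machine model is a while-language over pairs and integers with a
-- logarithmic cost measure: each step is charged the full size, in bits,
-- of the value it works on, and fork, cond and while also for keeping a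
-- copy of it.  Up to a polynomial this is Turing machine time.

data Val : Set where
  int  : ℤ → Val
  pair : Val → Val → Val

size : Val → ℕ
size (int i)    = suc ⌊log₂ ℤ.∣ i ∣ ⌋
size (pair x y) = suc (size x ℕ.+ size y)

data Prim : Set where
  copy fst snd isPair add neg mul quot leq : Prim

truth : ∀ {X : Set} → Dec X → Val
truth d = int (if does d then + 1 else + 0)

-- Ill-formed arguments give int 0.
apply : Prim → Val → Val
apply copy   x                        = x
apply fst    (pair x y)               = x
apply snd    (pair x y)               = y
apply isPair (pair x y)               = int (+ 1)
apply add    (pair (int i) (int j))   = int (i ℤ.+ j)
apply neg    (int i)                  = int (ℤ.- i)
apply mul    (pair (int i) (int j))   = int (i ℤ.* j)
apply quot   (pair (int i) (int j)) with j ℤ.≟ + 0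
... | yes _   = int (+ 0)
... | no  j≢0 = int (ℤ._/_ i j {{ℤ.≢-nonZero j≢0}})
apply leq    (pair (int i) (int j))   = truth (i ℤ.≤? j)
apply _      _                        = int (+ 0)

infixr 5 _⨾_

data Prog : Set where
  prim     : Prim → Prog
  const    : ℤ → Prog
  _⨾_ fork : Prog → Prog → Prog
  cond     : (test then else : Prog) → Prog
  while    : (test body : Prog) → Prog

False True : Val → Set
False v = v ≡ int (+ 0)
True  v = v ≢ int (+ 0)

infix 4 _⊢_⇓_cost_

-- p ⊢ x ⇓ y cost k: on input x, the program p halts with output y after
-- a computation of cost k.
data _⊢_⇓_cost_ : Prog → Val → Val → ℕ → Set where

  prim   : ∀ {f x} → prim f ⊢ x ⇓ apply f x cost size x

  const  : ∀ {i x} → const i ⊢ x ⇓ int i cost size x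

  seq    : ∀ {p q x y z k l} →
           p ⊢ x ⇓ y cost k → q ⊢ y ⇓ z cost l →
           p ⨾ q ⊢ x ⇓ z cost k ℕ.+ l

  fork   : ∀ {p q x y z k l} →
           p ⊢ x ⇓ y cost k → q ⊢ x ⇓ z cost l →
           fork p q ⊢ x ⇓ pair y z cost size x ℕ.+ k ℕ.+ l

  ifTrue : ∀ {b p q x v y k l} →
           b ⊢ x ⇓ v cost k → True v → p ⊢ x ⇓ y cost l →
           cond b p q ⊢ x ⇓ y cost size x ℕ.+ k ℕ.+ l

  ifFalse : ∀ {b p q x v y k l} →
           b ⊢ x ⇓ v cost k → False v → q ⊢ x ⇓ y cost l →
           cond b p q ⊢ x ⇓ y cost size x ℕ.+ k ℕ.+ l

  stop   : ∀ {b p x v k} →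
           b ⊢ x ⇓ v cost k → False v →
           while b p ⊢ x ⇓ x cost size x ℕ.+ k

  loop   : ∀ {b p x v y z k l j} →
           b ⊢ x ⇓ v cost k → True v → p ⊢ x ⇓ y cost l →
           while b p ⊢ y ⇓ z cost j →
           while b p ⊢ x ⇓ z cost size x ℕ.+ k ℕ.+ l ℕ.+ j

-- On every input x : X, presented as encode x, the program halts with an
-- output v such that Output x v, within time polynomial in the input size.
-- As sizes are positive, a monomial bound is general enough.
PolynomialTime : Prog → {X : Set} → (X → Val) → (X → Val → Set) → Set
PolynomialTime p {X} encode Output =
  ∃ λ a → ∃ λ b → ∀ x → ∃ λ v → ∃ λ k →
    p ⊢ encode x ⇓ v cost k × k ℕ.≤ a ℕ.* size (encode x) ℕ.^ b × Output x v

encodeℕ : ℕ → Val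
encodeℕ n = int (+ n)

encodeℚ : ℚ → Val
encodeℚ q = pair (int (↥ q)) (int (↧ q))

encodeList : List Val → Val
encodeList = List.foldr pair (int (+ 0))

encodeFamily : ∀ {n} → (Fin n → Val) → Val
encodeFamily = encodeList ∘ List.tabulate

module BSHMℚ = BSHM ℚ-orderedField

encodeJobs : ∀ {n} → BSHMℚ.Jobs n → Val
encodeJobs 𝒥 = encodeFamily λ J →
  pair (encodeℚ (s J)) (pair (encodeℚ (I⁻ J)) (encodeℚ (I⁺ J)))
  where open BSHMℚ.Jobs 𝒥

encodeDualColouringInput : BSHMℚ.DualColouringInput → Val
encodeDualColouringInput ι =
  pair (encodeℚ g) (pair (encodeJobs jobs) (encodeFamily λ J → truth (J ∈? K)))
  where open BSHMℚ.DualColouringInput ι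

encodeInstance : BSHMℚ.Instance → Val
encodeInstance 𝓘 =
  pair (encodeFamily λ z → pair (encodeℚ (g z)) (encodeℚ (r z))) (encodeJobs jobs)
  where open BSHMℚ.Instance 𝓘

encodeSchedule : (𝓘 : BSHMℚ.Instance) → BSHMℚ.Scheduling.Schedule 𝓘 → Val
encodeSchedule 𝓘 σ = encodeFamily λ J →
  pair (encodeℕ (toℕ (proj₁ (σ J)))) (encodeℕ (proj₂ (σ J)))

PolynomialTimeDualColouring : BSHMℚ.DualColouring → Set
PolynomialTimeDualColouring dc = ∃ λ p →
  PolynomialTime p encodeDualColouringInput
    (λ ι v → v ≡ encodeFamily (λ J → encodeℕ (colour ι J)))
  where open BSHMℚ.DualColouring dc

IsApproximation : ℕ → (𝓘 : BSHMℚ.Instance) → Val → Set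
IsApproximation C 𝓘 v = ∃ λ σ →
  v ≡ encodeSchedule 𝓘 σ × Feasible σ × σ CostsAtMost C ×OPT
  where open BSHMℚ.Scheduling 𝓘

-- Both bounds hold pointwise in time.  Fix a time t and let L be the rate at
-- which some feasible schedule spends money at t.  Then L is at least r y for
-- every type y in use, and at least the sum of s(J) r y / g y over the active
-- jobs J, where y is the type that runs J.
--
-- If a job of K z is active, then the jobs that z could take would cost the
-- smaller types r z / 6 or more, so r z ≤ 6 L; as rates grow geometrically, the
-- rounding to whole machines costs at most 12 L in total.  Each job that z
-- passes over has a moment at which the jobs that z could take weigh at most
-- r z, hence at any time the jobs passed over by z weigh at most 2 r z: r z for
-- the moments before, r z for those after.  If the feasible schedule runs a job
-- of K z on a type y cheaper than z per unit of capacity, then some q ≤ y passed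
-- over that job, and such jobs cost at most Σ 2 r q ≤ 4 L, the sum being over
-- r q ≤ L.  All other jobs cost at most L.  The factor 4 of dual colouring makes
-- this 4 · 17 = 68.
--
-- For arbitrary rates, types are dropped until rates at least double, which
-- costs a factor 2, and the ceilings in c are omitted.  The program computing
-- this is put together from combinators that preserve polynomial time.

module Submission where

open import Defs
open import Data.Nat using (ℕ)
open import Data.Product using (∃; _×_)

open import Algebra.Bundles using (CommutativeRing)
import Algebra.Properties.Ring as RingProperties
import Algebra.Properties.Semiring.Mult as SemiringMult
import Algebra.Solver.Ring.NaturalCoefficients.Default as SemiringSolver
open import Data.Bool as Bool using (Bool; true; false; if_then_else_; _∧_; not)
open import Data.Empty using (⊥-elim)
open import Data.Fin as Fin
  using (Fin; zero; suc; toℕ; opposite; fromℕ<; combine; remQuot; finToFun; funToFin)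
import Data.Fin.Properties as Fin
open import Data.Fin.Subset using (Subset; _∈_; _∉_; _∩_; _∪_; _─_; inside; outside)
open import Data.Fin.Subset.Properties
  using (_∈?_; nonempty?; x∈p∩q⁺; x∈p∩q⁻; x∈p∪q⁻; x∈p∪q⁺; p─q⊆p; x∈p∧x∉q⇒x∈p─q; ∉⊥)
open import Data.List as List using (List; []; _∷_; _++_; length; map; filter; head; zip; drop; allFin)
import Data.List.Properties as List
open import Data.List.Membership.Propositional using () renaming (_∈_ to _∈ₗ_)
import Data.List.Membership.DecPropositional as DecMembership
open import Data.List.Membership.Propositional.Properties
  using (∈-allFin; ∈-tabulate⁺; ∈-tabulate⁻; ∈-deduplicate⁺; ∈-deduplicate⁻; ∈-filter⁺; ∈-map⁺; ∈-++⁺ˡ; ∈-++⁺ʳ; ∈-∃++)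
open import Data.List.Relation.Unary.All as All using (All; []; _∷_)
open import Data.List.Relation.Unary.AllPairs as AllPairs using (AllPairs; []; _∷_)
open import Data.List.Relation.Unary.AllPairs.Properties using (tabulate⁺-<)
open import Data.List.Relation.Unary.Any as Any using (here; there)
open import Data.List.Relation.Unary.Linked using (Linked; []; [-]; _∷_)
open import Data.List.Relation.Unary.Unique.Propositional using (Unique)
import Data.List.Relation.Unary.Unique.DecPropositional.Properties as Unique
open import Data.List.Relation.Unary.Unique.Propositional.Properties using (allFin⁺)
import Data.List.Sort as Sort
open import Data.Maybe as Maybe using (Maybe; just; nothing; maybe′; is-nothing; is-just)
import Data.Maybe.Properties as Maybe
open import Data.Nat as ℕ using (zero; suc)
import Data.Nat.Properties as ℕ
open import Data.Product using (Σ; Σ-syntax; _,_; proj₁; proj₂)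
open import Data.Sum using (_⊎_; inj₁; inj₂)
open import Data.Vec using (_∷_; here; there)
open import Function using (_∘_; id; flip; case_of_)
open import Relation.Binary.Bundles using (DecTotalOrder)
import Relation.Binary.Construct.NonStrictToStrict as ToStrict
open import Relation.Binary.Definitions using (tri<; tri≈; tri>)
open import Relation.Binary.PropositionalEquality
import Relation.Binary.Reasoning.PartialOrder as PartialOrderReasoning
open import Relation.Nullary using (¬_; Dec; yes; no; contradiction)
open import Relation.Nullary.Decidable
  using (does; _×-dec_; ¬?; map′; dec-true; dec-false; decidable-stable)
open import Relation.Unary using (Decidable)

-- The argument is kept apart from the algorithms. `TopDown` records what is asked of an algorithm,
-- and `AtTime` asks of the competing schedule only a type `τ J` for each job, with inequalities at
-- a single moment. Hence one analysis serves twice. For arbitrary rates the competitor's jobs are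
-- simply moved up to kept types, and no feasible schedule has to be rebuilt: rates and prices per
-- unit of capacity at most double, so 136 = 2 · 68.
--
-- The choice that makes this work is `weight`, the least cost of a job on the types below `z` that
-- it fits. A schedule confined to types below `z` spends at least the total weight, so a heavy load
-- forces spending. Conversely, the weight at `q` pays for a job that `q` passes over and that ends
-- up on a dearer type.
--
-- The optimum has to be constructed: machine indices are unbounded, so schedules are renamed into a
-- finite set, which is searched. For the programs the obstacle is the growth of intermediate
-- values: every fold carries a bound on its state, and fractions stay unreduced, so that no gcd has
-- to be programmed.

module OrderedFieldProperties (𝔽 : OrderedField) where

  open OrderedField 𝔽
  open CommutativeRing commutativeRing public
    using (+-identityˡ; +-identityʳ; +-assoc; +-comm; *-assoc; *-comm; *-identityˡ; *-identityʳ
          ; zeroˡ; zeroʳ; distribˡ; distribʳ; ring; -‿inverseʳ; -‿inverseˡ; commutativeSemiring)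
  open RingProperties ring public using (-‿distribʳ-*)
  open SemiringMult semiring public using (×1-homo-*; ×-homo-+)
  open SemiringSolver commutativeSemiring public using (solve; _:+_; _:*_; _:=_; con)
  module ≤-Reasoning = PartialOrderReasoning (DecTotalOrder.poset decTotalOrder)
  open ≤-Reasoning

  -- Arithmetic, ceilings and finite sums in an ordered field.

  <⇒≤ : ∀ {x y} → x < y → x ≤ y
  <⇒≤ = proj₁

  ≰⇒> : ∀ {x y} → ¬ x ≤ y → y < x
  ≰⇒> = ToStrict.≰⇒> _≡_ _≤_ sym (λ { refl → ≤-refl }) total

  ≰⇒≥ : ∀ {x y} → ¬ x ≤ y → y ≤ x
  ≰⇒≥ x≰y = <⇒≤ (≰⇒> x≰y)

  <⇒≱ : ∀ {x y} → x < y → ¬ y ≤ x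
  <⇒≱ (x≤y , x≢y) y≤x = x≢y (≤-antisym x≤y y≤x)

  ≤-reflexive : ∀ {x y} → x ≡ y → x ≤ y
  ≤-reflexive refl = ≤-refl

  ≤-<-trans : ∀ {x y z} → x ≤ y → y < z → x < z
  ≤-<-trans x≤y y<z = ≰⇒> λ z≤x → <⇒≱ y<z (≤-trans z≤x x≤y)

  <-≤-trans : ∀ {x y z} → x < y → y ≤ z → x < z
  <-≤-trans x<y y≤z = ≰⇒> λ z≤x → <⇒≱ x<y (≤-trans y≤z z≤x)

  <-trans : ∀ {x y z} → x < y → y < z → x < z
  <-trans x<y y<z = <-≤-trans x<y (<⇒≤ y<z)

  +-monoˡ-≤ : ∀ x {y z} → y ≤ z → y + x ≤ z + x
  +-monoˡ-≤ x {y} {z} y≤z = subst₂ _≤_ (+-comm x y) (+-comm x z) (+-monoʳ-≤ x y≤z)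

  +-mono-≤ : ∀ {w x y z} → w ≤ x → y ≤ z → w + y ≤ x + z
  +-mono-≤ {w} {x} {y} {z} w≤x y≤z = ≤-trans (+-monoˡ-≤ y w≤x) (+-monoʳ-≤ x y≤z)

  +-cancelˡ : ∀ x y → (- x) + (x + y) ≡ y
  +-cancelˡ x y = trans (sym (+-assoc (- x) x y))
    (trans (cong (_+ y) (-‿inverseˡ x)) (+-identityˡ y))

  +-cancelˡ-≤ : ∀ x {y z} → x + y ≤ x + z → y ≤ z
  +-cancelˡ-≤ x {y} {z} le = subst₂ _≤_ (+-cancelˡ x y) (+-cancelˡ x z) (+-monoʳ-≤ (- x) le)

  +-nonNeg : ∀ {x y} → 0# ≤ x → 0# ≤ y → 0# ≤ x + y
  +-nonNeg {x} {y} 0≤x 0≤y = subst (_≤ x + y) (+-identityˡ 0#) (+-mono-≤ 0≤x 0≤y)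

  x≤x+y : ∀ {x y} → 0# ≤ y → x ≤ x + y
  x≤x+y {x} {y} 0≤y = subst (_≤ x + y) (+-identityʳ x) (+-monoʳ-≤ x 0≤y)

  x≤y+x : ∀ {x y} → 0# ≤ y → x ≤ y + x
  x≤y+x {x} {y} 0≤y = subst (_≤ y + x) (+-identityˡ x) (+-monoˡ-≤ x 0≤y)

  x≤y⇒0≤y-x : ∀ {x y} → x ≤ y → 0# ≤ y - x
  x≤y⇒0≤y-x {x} {y} x≤y = subst (_≤ y - x) (-‿inverseʳ x) (+-monoˡ-≤ (- x) x≤y)

  x+[y-x] : ∀ x y → x + (y - x) ≡ y
  x+[y-x] x y = trans (cong (x +_) (+-comm y (- x)))
    (trans (sym (+-assoc x (- x) y)) (trans (cong (_+ y) (-‿inverseʳ x)) (+-identityˡ y)))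

  *-monoˡ-≤ : ∀ {x y z} → 0# ≤ x → y ≤ z → x * y ≤ x * z
  *-monoˡ-≤ {x} {y} {z} 0≤x y≤z = begin
    x * y               ≤⟨ x≤x+y (*-nonNeg 0≤x (x≤y⇒0≤y-x y≤z)) ⟩
    x * y + x * (z - y) ≡⟨ distribˡ x y (z - y) ⟨
    x * (y + (z - y))   ≡⟨ cong (x *_) (x+[y-x] y z) ⟩
    x * z               ∎

  *-monoʳ-≤ : ∀ {x y z} → 0# ≤ x → y ≤ z → y * x ≤ z * x
  *-monoʳ-≤ {x} {y} {z} 0≤x y≤z = subst₂ _≤_ (*-comm x y) (*-comm x z) (*-monoˡ-≤ 0≤x y≤z)

  -- Otherwise 0 ≤ -1 by totality, and 1 is the square of -1.
  0≤1 : 0# ≤ 1#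
  0≤1 with total 0# 1#
  ... | inj₁ 0≤1 = 0≤1
  ... | inj₂ 1≤0 = subst (0# ≤_) square (*-nonNeg 0≤-1 0≤-1)
    where
    0≤-1 : 0# ≤ - 1#
    0≤-1 = subst (0# ≤_) (+-identityˡ (- 1#)) (x≤y⇒0≤y-x 1≤0)

    square : (- 1#) * (- 1#) ≡ 1#
    square = trans (sym (-‿distribʳ-* (- 1#) 1#)) (trans (cong -_ (*-identityʳ (- 1#)))
      (RingProperties.-‿involutive ring 1#))

  fromℕ-nonNeg : ∀ n → 0# ≤ fromℕ n
  fromℕ-nonNeg zero    = ≤-refl
  fromℕ-nonNeg (suc n) = +-nonNeg 0≤1 (fromℕ-nonNeg n)

  fromℕ-mono : ∀ {m n} → m ℕ.≤ n → fromℕ m ≤ fromℕ n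
  fromℕ-mono {n = n} ℕ.z≤n = fromℕ-nonNeg n
  fromℕ-mono (ℕ.s≤s m≤n)   = +-monoʳ-≤ 1# (fromℕ-mono m≤n)

  fromℕ-* : ∀ m n → fromℕ (m ℕ.* n) ≡ fromℕ m * fromℕ n
  fromℕ-* m n = ×1-homo-* m n

  1*x : ∀ x → fromℕ 1 * x ≡ x
  1*x x = trans (cong (_* x) (+-identityʳ 1#)) (*-identityˡ x)

  suc*x : ∀ n x → fromℕ (suc n) * x ≡ x + fromℕ n * x
  suc*x n x = trans (distribʳ x 1# (fromℕ n)) (cong (_+ fromℕ n * x) (*-identityˡ x))

  fromℕ-*-assoc : ∀ m n x → fromℕ (m ℕ.* n) * x ≡ fromℕ m * (fromℕ n * x)
  fromℕ-*-assoc m n x = trans (cong (_* x) (fromℕ-* m n)) (*-assoc (fromℕ m) (fromℕ n) x)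

  fromℕ-+* : ∀ m n x → fromℕ (m ℕ.+ n) * x ≡ fromℕ m * x + fromℕ n * x
  fromℕ-+* m n x = trans (cong (_* x) (×-homo-+ 1# m n)) (distribʳ x (fromℕ m) (fromℕ n))

  2*x : ∀ x → fromℕ 2 * x ≡ x + x
  2*x x = trans (suc*x 1 x) (cong (x +_) (1*x x))

  n*-mono : ∀ n {x y} → x ≤ y → fromℕ n * x ≤ fromℕ n * y
  n*-mono n = *-monoˡ-≤ (fromℕ-nonNeg n)

  x≤suc*x : ∀ n {x} → 0# ≤ x → x ≤ fromℕ (suc n) * x
  x≤suc*x n {x} 0≤x = ≤-trans (x≤x+y (*-nonNeg (fromℕ-nonNeg n) 0≤x))
    (≤-reflexive (sym (suc*x n x)))

  n*-weaken : ∀ {m n x} → m ℕ.≤ n → 0# ≤ x → fromℕ m * x ≤ fromℕ n * x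
  n*-weaken m≤n 0≤x = *-monoʳ-≤ 0≤x (fromℕ-mono m≤n)

  pos⇒≢0 : ∀ {x} → 0# < x → x ≢ 0#
  pos⇒≢0 (_ , 0≢x) x≡0 = 0≢x (sym x≡0)

  *-cancelˡ-pos : ∀ {x y z} → 0# < x → x * y ≤ x * z → y ≤ z
  *-cancelˡ-pos {x} {y} {z} 0<x xy≤xz with y ≤? z
  ... | yes y≤z = y≤z
  ... | no  y≰z = ⊥-elim (proj₂ z<y (cancel (≤-antisym (*-monoˡ-≤ (<⇒≤ 0<x) (<⇒≤ z<y)) xy≤xz)))
    where
    z<y : z < y
    z<y = ≰⇒> y≰z

    inverse : ∀ w → x ⁻¹ * (x * w) ≡ w
    inverse w = trans (sym (*-assoc (x ⁻¹) x w)) (trans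
      (cong (_* w) (trans (*-comm (x ⁻¹) x) (⁻¹-inverseʳ x (pos⇒≢0 0<x)))) (*-identityˡ w))

    cancel : x * z ≡ x * y → z ≡ y
    cancel eq = trans (sym (inverse z)) (trans (cong (x ⁻¹ *_) eq) (inverse y))

  fromℕ-suc-pos : ∀ n → 0# < fromℕ (suc n)
  fromℕ-suc-pos n = <-≤-trans (0≤1 , 0≢1) (x≤x+y (fromℕ-nonNeg n))

  /-* : ∀ x {y} → 0# < y → (x / y) * y ≡ x
  /-* x {y} 0<y = trans (*-assoc x (y ⁻¹) y) (trans
    (cong (x *_) (trans (*-comm (y ⁻¹) y) (⁻¹-inverseʳ y (pos⇒≢0 0<y)))) (*-identityʳ x))

  ⁻¹-nonNeg : ∀ {x} → 0# < x → 0# ≤ x ⁻¹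
  ⁻¹-nonNeg {x} 0<x = *-cancelˡ-pos 0<x
    (subst₂ _≤_ (sym (zeroʳ x)) (sym (⁻¹-inverseʳ x (pos⇒≢0 0<x))) 0≤1)

  /-nonNeg : ∀ {x y} → 0# ≤ x → 0# < y → 0# ≤ x / y
  /-nonNeg 0≤x 0<y = *-nonNeg 0≤x (⁻¹-nonNeg 0<y)

  *≤⇒≤/ : ∀ {x y z} → 0# < y → z * y ≤ x → z ≤ x / y
  *≤⇒≤/ {x} {y} {z} 0<y le = *-cancelˡ-pos 0<y
    (subst₂ _≤_ (*-comm z y) (trans (sym (/-* x 0<y)) (*-comm (x / y) y)) le)

  -- Unless the search stops at its first candidate, the predecessor of the result was tested and
  -- found smaller than `x`.
  leastFrom-bound : ∀ fuel k x → leastFrom fuel k x ≡ k ⊎ fromℕ (leastFrom fuel k x) ≤ x + 1#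
  leastFrom-bound zero       k x = inj₁ refl
  leastFrom-bound (suc fuel) k x with x ≤? fromℕ k
  ... | yes _  = inj₁ refl
  ... | no x≰k with leastFrom-bound fuel (suc k) x
  ...   | inj₂ le = inj₂ le
  ...   | inj₁ eq rewrite eq = inj₂ (≤-trans (+-monoʳ-≤ 1# (≰⇒≥ x≰k)) (≤-reflexive (+-comm 1# x)))

  ⌈⌉≤ : ∀ {x} → 0# ≤ x → fromℕ ⌈ x ⌉ ≤ x + 1#
  ⌈⌉≤ {x} 0≤x with leastFrom-bound (proj₁ (archimedean x)) 0 x
  ... | inj₂ le = le
  ... | inj₁ eq rewrite eq = +-nonNeg 0≤x 0≤1

  leastFrom-≥ : ∀ fuel k x → x ≤ fromℕ (fuel ℕ.+ k) → x ≤ fromℕ (leastFrom fuel k x)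
  leastFrom-≥ zero       k x x≤ = x≤
  leastFrom-≥ (suc fuel) k x x≤ with x ≤? fromℕ k
  ... | yes x≤k = x≤k
  ... | no _    = leastFrom-≥ fuel (suc k) x (subst (λ j → x ≤ fromℕ j) (sym (ℕ.+-suc fuel k)) x≤)

  ≤⌈⌉ : ∀ x → x ≤ fromℕ ⌈ x ⌉
  ≤⌈⌉ x = leastFrom-≥ (proj₁ (archimedean x)) 0 x
    (subst (λ j → x ≤ fromℕ j) (sym (ℕ.+-identityʳ (proj₁ (archimedean x)))) (proj₂ (archimedean x)))

  -- The search starts at 0. Without this, `⌈⌉≤` would charge one machine to every type that has no
  -- active job.
  ⌈⌉-nonPos : ∀ {x} → x ≤ 0# → ⌈ x ⌉ ≡ 0
  ⌈⌉-nonPos {x} x≤0 with proj₁ (archimedean x)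
  ... | zero  = refl
  ... | suc _ with x ≤? 0#
  ...   | yes _   = refl
  ...   | no  x≰0 = contradiction x≤0 x≰0

  -- Unfolds to the conditional inside `∑[_]` and `∥_∥`, so that the summands there are instances of
  -- `when` by definition.
  when : ∀ {P : Set} → Dec P → Carrier → Carrier
  when d x = if does d then x else 0#

  private variable
    A B  : Set
    P Q  : Set
    x y  : Carrier

  when-yes : (d : Dec P) → P → when d x ≡ x
  when-yes (yes _) _ = refl
  when-yes (no ¬p) p = contradiction p ¬p

  when-no : (d : Dec P) → ¬ P → when d x ≡ 0#
  when-no (yes p) ¬p = contradiction p ¬p
  when-no (no _)  _  = refl

  when-≤ : (d : Dec P) → 0# ≤ y → (P → x ≤ y) → when d x ≤ y
  when-≤ (yes p) _   x≤y = x≤y p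
  when-≤ (no _)  0≤y _   = 0≤y

  when-mono : (d : Dec P) (e : Dec Q) → 0# ≤ y → (P → Q × x ≤ y) → when d x ≤ when e y
  when-mono (yes p) (yes _) _   h = proj₂ (h p)
  when-mono (yes p) (no ¬q) _   h = contradiction (proj₁ (h p)) ¬q
  when-mono (no _)  (yes _) 0≤y _ = 0≤y
  when-mono (no _)  (no _)  _   _ = ≤-refl

  when-nonNeg : (d : Dec P) → 0# ≤ x → 0# ≤ when d x
  when-nonNeg (yes _) 0≤x = 0≤x
  when-nonNeg (no _)  _   = ≤-refl

  *-when : (d : Dec P) → x * when d y ≡ when d (x * y)
  *-when         (yes _) = refl
  *-when {x = x} (no _)  = zeroʳ x

  Σᴸ : List A → (A → Carrier) → Carrier
  Σᴸ xs f = sumᴸ (map f xs)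

  Σ-mono : ∀ (xs : List A) {f g : A → Carrier} → (∀ a → f a ≤ g a) → Σᴸ xs f ≤ Σᴸ xs g
  Σ-mono []       f≤g = ≤-refl
  Σ-mono (a ∷ xs) f≤g = +-mono-≤ (f≤g a) (Σ-mono xs f≤g)

  Σ-mono-All : ∀ {xs : List A} {f g : A → Carrier} → All (λ a → f a ≤ g a) xs → Σᴸ xs f ≤ Σᴸ xs g
  Σ-mono-All []           = ≤-refl
  Σ-mono-All (f≤g ∷ f≤gs) = +-mono-≤ f≤g (Σ-mono-All f≤gs)

  Σ-cong : ∀ (xs : List A) {f g : A → Carrier} → (∀ a → f a ≡ g a) → Σᴸ xs f ≡ Σᴸ xs g
  Σ-cong []       f≡g = refl
  Σ-cong (a ∷ xs) f≡g = cong₂ _+_ (f≡g a) (Σ-cong xs f≡g)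

  Σ-0 : ∀ (xs : List A) {f : A → Carrier} → (∀ a → f a ≡ 0#) → Σᴸ xs f ≡ 0#
  Σ-0 []       f≡0 = refl
  Σ-0 (a ∷ xs) f≡0 = trans (cong₂ _+_ (f≡0 a) (Σ-0 xs f≡0)) (+-identityˡ 0#)

  Σ-nonNeg : ∀ (xs : List A) {f : A → Carrier} → (∀ a → 0# ≤ f a) → 0# ≤ Σᴸ xs f
  Σ-nonNeg xs {f} 0≤f = subst (_≤ Σᴸ xs f) (Σ-0 xs {λ _ → 0#} λ _ → refl) (Σ-mono xs 0≤f)

  Σ-+ : ∀ (xs : List A) (f g : A → Carrier) → Σᴸ xs (λ a → f a + g a) ≡ Σᴸ xs f + Σᴸ xs g
  Σ-+ []       f g = sym (+-identityˡ 0#)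
  Σ-+ (a ∷ xs) f g = trans (cong ((f a + g a) +_) (Σ-+ xs f g))
    (solve 4 (λ a b c d → (a :+ b) :+ (c :+ d) := (a :+ c) :+ (b :+ d)) refl
      (f a) (g a) (Σᴸ xs f) (Σᴸ xs g))

  Σ-* : ∀ (xs : List A) x (f : A → Carrier) → Σᴸ xs (λ a → x * f a) ≡ x * Σᴸ xs f
  Σ-* []       x f = sym (zeroʳ x)
  Σ-* (a ∷ xs) x f = trans (cong (x * f a +_) (Σ-* xs x f)) (sym (distribˡ x (f a) (Σᴸ xs f)))

  Σ-const : ∀ (xs : List A) x → Σᴸ xs (λ _ → x) ≡ fromℕ (length xs) * x
  Σ-const []       x = sym (zeroˡ x)
  Σ-const (_ ∷ xs) x = trans (cong (x +_) (Σ-const xs x)) (sym (suc*x (length xs) x))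

  Σ-swap : ∀ (xs : List A) (ys : List B) (f : A → B → Carrier) →
           Σᴸ xs (λ a → Σᴸ ys (f a)) ≡ Σᴸ ys (λ b → Σᴸ xs (λ a → f a b))
  Σ-swap []       ys f = sym (Σ-0 ys λ _ → refl)
  Σ-swap (a ∷ xs) ys f = trans (cong (Σᴸ ys (f a) +_) (Σ-swap xs ys f))
    (sym (Σ-+ ys (f a) (λ b → Σᴸ xs (λ a → f a b))))

  Σ-∈ : ∀ {xs : List A} {f : A → Carrier} → (∀ a → 0# ≤ f a) → ∀ {a} → a ∈ₗ xs → f a ≤ Σᴸ xs f
  Σ-∈ {xs = a ∷ xs} 0≤f (here refl) = x≤x+y (Σ-nonNeg xs 0≤f)
  Σ-∈ {xs = a ∷ xs} 0≤f (there a∈)  = ≤-trans (Σ-∈ 0≤f a∈) (x≤y+x (0≤f a))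

  -- This collapses double sums: once the order of summation is exchanged, the inner sum runs over
  -- the objects linked to a fixed one, and there is at most one of these.
  Σ-atMostOne : ∀ {P : A → Set} (P? : ∀ a → Dec (P a)) {xs} {f : A → Carrier} → Unique xs → 0# ≤ x →
                (∀ {a b} → a ∈ₗ xs → b ∈ₗ xs → P a → P b → a ≡ b) → (∀ {a} → a ∈ₗ xs → P a → f a ≤ x) →
                Σᴸ xs (λ a → when (P? a) (f a)) ≤ x
  Σ-atMostOne P? [] 0≤x _ _ = 0≤x
  Σ-atMostOne {x = x} P? {a ∷ xs} {f} (a∉ ∷ xs!) 0≤x one f≤x with P? a
  ... | no  _ = ≤-trans (≤-reflexive (+-identityˡ _))
    (Σ-atMostOne P? xs! 0≤x (λ b∈ c∈ → one (there b∈) (there c∈)) (f≤x ∘ there))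
  ... | yes p = begin
    f a + Σᴸ xs (λ a → when (P? a) (f a)) ≤⟨ +-monoʳ-≤ (f a) (Σ-mono-All zeros) ⟩
    f a + Σᴸ xs (λ _ → 0#)                ≡⟨ cong (f a +_) (Σ-0 xs λ _ → refl) ⟩
    f a + 0#                              ≡⟨ +-identityʳ (f a) ⟩
    f a                                   ≤⟨ f≤x (here refl) p ⟩
    x                                     ∎
    where
    zeros : All (λ b → when (P? b) (f b) ≤ 0#) xs
    zeros = All.tabulate λ {b} b∈ → when-≤ (P? b) ≤-refl λ q →
      contradiction (one (here refl) (there b∈) p q) (All.lookup a∉ b∈)

  Σ-atLeastOne : ∀ {P : A → Set} (P? : ∀ a → Dec (P a)) {xs} {f : A → Carrier} →
                 (∀ a → 0# ≤ f a) → ∀ {a} → a ∈ₗ xs → P a → x ≤ f a →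
                 x ≤ Σᴸ xs (λ a → when (P? a) (f a))
  Σ-atLeastOne P? 0≤f {a} a∈ p x≤ = ≤-trans (≤-trans x≤ (≤-reflexive (sym (when-yes (P? a) p))))
    (Σ-∈ (λ b → when-nonNeg (P? b) (0≤f b)) a∈)

  sum≡Σ : ∀ {n} (f : Fin n → Carrier) → sum f ≡ Σᴸ (allFin n) f
  sum≡Σ {zero}  f = refl
  sum≡Σ {suc n} f = cong (f zero +_) (trans (sum≡Σ (f ∘ suc))
    (cong sumᴸ (trans (List.map-tabulate id (f ∘ suc)) (sym (List.map-tabulate suc f)))))

  -- Going down from `M`, the terms shrink by a factor b + 1 at least, so their sum is at most M (1
  -- + 1/(b+1) + ...) = M (b+1)/b. The denominator is cleared. The cases b = 1 and b = 7 are used.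
  geometric : ∀ (r : A → Carrier) b {M} → (∀ z → 0# ≤ r z) → 0# ≤ M →
              ∀ {zs} → AllPairs (λ y z → fromℕ (suc b) * r y ≤ r z) zs →
              fromℕ b * Σᴸ zs (λ z → when (r z ≤? M) (r z)) ≤ fromℕ (suc b) * M
  geometric r b {M} 0≤r 0≤M growing = finish (go growing)
    where
    h = λ z → when (r z ≤? M) (r z)

    -- The terms up to M sum to (1 + 1/b) M at most, with room for r z / b,
    -- where z is the first of them.
    Bound : List _ → Set
    Bound zs = Σᴸ zs h ≡ 0# ⊎ ∃ λ z → z ∈ₗ zs × fromℕ b * Σᴸ zs h + r z ≤ fromℕ (suc b) * M

    go : ∀ {zs} → AllPairs (λ y z → fromℕ (suc b) * r y ≤ r z) zs → Bound zs
    go [] = inj₁ refl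
    go {z ∷ zs} (z≤ ∷ growing) with r z ≤? M | go growing
    ... | no  _   | inj₁ eq = inj₁ (trans (+-identityˡ _) eq)
    ... | no  _   | inj₂ (x , x∈ , le) = inj₂ (x , there x∈ ,
      subst (λ s → fromℕ b * s + r x ≤ fromℕ (suc b) * M) (sym (+-identityˡ (Σᴸ zs h))) le)
    ... | yes z≤M | inj₁ eq = inj₂ (z , here refl , (begin
      fromℕ b * (r z + Σᴸ zs h) + r z ≡⟨ cong (λ s → fromℕ b * (r z + s) + r z) eq ⟩
      fromℕ b * (r z + 0#) + r z      ≡⟨ cong (λ s → fromℕ b * s + r z) (+-identityʳ (r z)) ⟩
      fromℕ b * r z + r z             ≡⟨ +-comm _ _ ⟩
      r z + fromℕ b * r z             ≡⟨ suc*x b (r z) ⟨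
      fromℕ (suc b) * r z             ≤⟨ n*-mono (suc b) z≤M ⟩
      fromℕ (suc b) * M               ∎))
    ... | yes z≤M | inj₂ (x , x∈ , le) = inj₂ (z , here refl , (begin
      fromℕ b * (r z + Σᴸ zs h) + r z
        ≡⟨ solve 3 (λ n a s → n :* (a :+ s) :+ a := n :* s :+ (a :+ n :* a)) refl (fromℕ b) (r z) (Σᴸ zs h) ⟩
      fromℕ b * Σᴸ zs h + (r z + fromℕ b * r z) ≡⟨ cong (fromℕ b * Σᴸ zs h +_) (suc*x b (r z)) ⟨
      fromℕ b * Σᴸ zs h + fromℕ (suc b) * r z   ≤⟨ +-monoʳ-≤ _ (All.lookup z≤ x∈) ⟩
      fromℕ b * Σᴸ zs h + r x                   ≤⟨ le ⟩
      fromℕ (suc b) * M                         ∎))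

    finish : ∀ {zs} → Bound zs → fromℕ b * Σᴸ zs h ≤ fromℕ (suc b) * M
    finish (inj₁ eq) = ≤-trans (≤-reflexive (trans (cong (fromℕ b *_) eq) (zeroʳ (fromℕ b))))
      (*-nonNeg (fromℕ-nonNeg (suc b)) 0≤M)
    finish (inj₂ (x , _ , le)) = ≤-trans (x≤x+y (0≤r x)) le

  argmax : ∀ {n} {P : Fin n → Set} → Decidable P → (f : Fin n → Carrier) →
           (∀ i → ¬ P i) ⊎ ∃ λ i → P i × ∀ j → P j → f j ≤ f i
  argmax {zero}  P? f = inj₁ λ ()
  argmax {suc n} P? f with P? zero | argmax (P? ∘ suc) (f ∘ suc)
  ... | no ¬p | inj₁ none = inj₁ λ { zero → ¬p ; (suc i) → none i }
  ... | no ¬p | inj₂ (i , pi , max) =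
    inj₂ (suc i , pi , λ { zero p → contradiction p ¬p ; (suc j) → max j })
  ... | yes p | inj₁ none =
    inj₂ (zero , p , λ { zero _ → ≤-refl ; (suc j) pj → contradiction pj (none j) })
  ... | yes p | inj₂ (i , pi , max) with total (f zero) (f (suc i))
  ...   | inj₁ le = inj₂ (suc i , pi , λ { zero _ → le ; (suc j) → max j })
  ...   | inj₂ ge = inj₂ (zero , p , λ { zero _ → ≤-refl ; (suc j) pj → ≤-trans (max j pj) ge })

  argmin : ∀ {n} {P : Fin n → Set} → Decidable P → (f : Fin n → Carrier) →
           (∀ i → ¬ P i) ⊎ ∃ λ i → P i × ∀ j → P j → f i ≤ f j
  argmin {zero}  P? f = inj₁ λ ()
  argmin {suc n} P? f with P? zero | argmin (P? ∘ suc) (f ∘ suc)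
  ... | no ¬p | inj₁ none = inj₁ λ { zero → ¬p ; (suc i) → none i }
  ... | no ¬p | inj₂ (i , pi , min) =
    inj₂ (suc i , pi , λ { zero p → contradiction p ¬p ; (suc j) → min j })
  ... | yes p | inj₁ none =
    inj₂ (zero , p , λ { zero _ → ≤-refl ; (suc j) pj → contradiction pj (none j) })
  ... | yes p | inj₂ (i , pi , min) with total (f (suc i)) (f zero)
  ...   | inj₁ le = inj₂ (suc i , pi , λ { zero _ → le ; (suc j) → min j })
  ...   | inj₂ ge = inj₂ (zero , p , λ { zero _ → ≤-refl ; (suc j) pj → ≤-trans ge (min j pj) })

-- Cost as an integral of the spending rate, existence of an optimum, schedules from dual
-- colourings.

module SchedulingProperties (𝔽 : OrderedField) (𝓘 : BSHM.Instance 𝔽) where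

  open OrderedField 𝔽
  open OrderedFieldProperties 𝔽
  open BSHM 𝔽
  open Scheduling 𝓘
  open ≤-Reasoning

  ρ : Type → Carrier
  ρ z = r z / g z

  s-nonNeg : ∀ J → 0# ≤ s J
  s-nonNeg J = <⇒≤ (s-positive J)

  r-nonNeg : ∀ z → 0# ≤ r z
  r-nonNeg z = <⇒≤ (r-positive z)

  ρ-nonNeg : ∀ z → 0# ≤ ρ z
  ρ-nonNeg z = /-nonNeg (r-nonNeg z) (g-positive z)

  ρ*g : ∀ z → ρ z * g z ≡ r z
  ρ*g z = /-* (r z) (g-positive z)

  mono-≤ : ∀ (h : Type → Carrier) → (∀ {y z} → y Fin.< z → h y < h z) → ∀ {y z} → y Fin.≤ z → h y ≤ h z
  mono-≤ h mono {y} {z} y≤z with y Fin.≟ z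
  ... | yes refl = ≤-refl
  ... | no  y≢z  = <⇒≤ (mono (Fin.≤∧≢⇒< y≤z y≢z))

  ΣJ : (Fin n → Carrier) → Carrier
  ΣJ = Σᴸ (allFin n)

  ∈at⁺ : ∀ {X : Subset n} {t J} → J ∈ X → t ∈I J → J ∈ X at t
  ∈at⁺ {X} {t} J∈ t∈ = x∈p∩q⁺ (J∈ , ∈⟪⟫⁺ (λ J → t ∈I? J) t∈)

  ∈at⁻ : ∀ {X : Subset n} {t J} → J ∈ X at t → J ∈ X × t ∈I J
  ∈at⁻ {X} {t} J∈ = proj₁ (x∈p∩q⁻ X (active t) J∈) ,
    ∈⟪⟫⁻ (λ J → t ∈I? J) (proj₂ (x∈p∩q⁻ X (active t) J∈))

  ∈jobsOn⁺ : ∀ σ J → J ∈ jobsOn σ (σ J)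
  ∈jobsOn⁺ σ J = ∈⟪⟫⁺ (λ J′ → σ J′ ≟ᴹ σ J) refl

  ∈jobsOn⁻ : ∀ σ {J μ} → J ∈ jobsOn σ μ → σ J ≡ μ
  ∈jobsOn⁻ σ {μ = μ} = ∈⟪⟫⁻ (λ J → σ J ≟ᴹ μ)

  S≡ : ∀ X → S X ≡ ΣJ (λ J → when (J ∈? X) (s J))
  S≡ X = sum≡Σ (λ J → when (J ∈? X) (s J))

  S-mono : ∀ {X Y : Subset n} → (∀ {J} → J ∈ X → J ∈ Y) → S X ≤ S Y
  S-mono {X} {Y} X⊆Y = subst₂ _≤_ (sym (S≡ X)) (sym (S≡ Y)) (Σ-mono (allFin n) λ J →
    when-mono (J ∈? X) (J ∈? Y) (s-nonNeg J) λ J∈ → X⊆Y J∈ , ≤-refl)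

  S-nonNeg : ∀ X → 0# ≤ S X
  S-nonNeg X = subst (0# ≤_) (sym (S≡ X))
    (Σ-nonNeg (allFin n) λ J → when-nonNeg (J ∈? X) (s-nonNeg J))

  S-empty : ∀ {X} → (∀ J → J ∉ X) → S X ≡ 0#
  S-empty {X} empty = trans (S≡ X) (Σ-0 (allFin n) λ J → when-no (J ∈? X) (empty J))

  cells-ordered : All (λ (a , b) → a ≤ b) cells
  cells-ordered = go (Sort.sort-↗ decTotalOrder endpoints)
    where
    go : ∀ {xs} → Linked _≤_ xs → All (λ (a , b) → a ≤ b) (zip xs (drop 1 xs))
    go []         = []
    go [-]        = []
    go (a≤b ∷ xs) = a≤b ∷ go xs

  ∥∥-mono : ∀ {X Y} → (∀ {J} → J ∈ X → J ∈ Y) → ∥ X ∥ ≤ ∥ Y ∥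
  ∥∥-mono {X} {Y} X⊆Y = Σ-mono-All (All.map (λ {(a , b)} a≤b →
    when-mono (span? X a) (span? Y a) (x≤y⇒0≤y-x a≤b)
      λ (J , J∈) → (J , ∈at⁺ {Y} (X⊆Y (proj₁ (∈at⁻ {X} J∈))) (proj₂ (∈at⁻ {X} J∈))) , ≤-refl) cells-ordered)

  ∥∥-nonNeg : ∀ X → 0# ≤ ∥ X ∥
  ∥∥-nonNeg X = subst (_≤ ∥ X ∥) (Σ-0 cells λ _ → refl) (Σ-mono-All (All.map
    (λ {(a , b)} a≤b → when-nonNeg (span? X a) (x≤y⇒0≤y-x a≤b)) cells-ordered))

  -- The money spent per unit of time at `t`. The cost is its integral, which `cost≡` writes as a
  -- sum over cells sampled at their left ends, just as `∥_∥` does.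
  rate : Schedule → Carrier → Carrier
  rate σ t = Σᴸ (usedMachines σ) λ μ → when (span? (jobsOn σ μ) t) (r (proj₁ μ))

  cost≡ : ∀ σ → cost σ ≡ Σᴸ cells (λ (a , b) → (b - a) * rate σ a)
  cost≡ σ = begin-equality
    Σᴸ (usedMachines σ) (λ μ → r (proj₁ μ) * ∥ jobsOn σ μ ∥)
      ≡⟨ Σ-cong (usedMachines σ) (λ μ → trans (sym (Σ-* cells (r (proj₁ μ)) _))
           (Σ-cong cells λ (a , b) → exchange (span? (jobsOn σ μ) a))) ⟩
    Σᴸ (usedMachines σ) (λ μ → Σᴸ cells λ (a , b) → (b - a) * when (span? (jobsOn σ μ) a) (r (proj₁ μ)))
      ≡⟨ Σ-swap (usedMachines σ) cells _ ⟩
    Σᴸ cells (λ (a , b) → Σᴸ (usedMachines σ) λ μ → (b - a) * when (span? (jobsOn σ μ) a) (r (proj₁ μ)))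
      ≡⟨ Σ-cong cells (λ (a , b) → Σ-* (usedMachines σ) (b - a) _) ⟩
    Σᴸ cells (λ (a , b) → (b - a) * rate σ a) ∎
    where
    exchange : ∀ {P : Set} (d : Dec P) {x y} → x * when d y ≡ y * when d x
    exchange d {x} {y} = trans (*-when d) (trans (cong (when d) (*-comm x y)) (sym (*-when d)))

  cost-mono : ∀ C {σ σ′} → (∀ t → rate σ t ≤ fromℕ C * rate σ′ t) → cost σ ≤ fromℕ C * cost σ′
  cost-mono C {σ} {σ′} le = begin
    cost σ                                                   ≡⟨ cost≡ σ ⟩
    Σᴸ cells (λ (a , b) → (b - a) * rate σ a)
      ≤⟨ Σ-mono-All (All.map (λ {(a , b)} a≤b → *-monoˡ-≤ (x≤y⇒0≤y-x a≤b) (le a)) cells-ordered) ⟩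
    Σᴸ cells (λ (a , b) → (b - a) * (fromℕ C * rate σ′ a))
      ≡⟨ Σ-cong cells (λ (a , b) → solve 3 (λ x y z → x :* (y :* z) := y :* (x :* z)) refl
           (b - a) (fromℕ C) (rate σ′ a)) ⟩
    Σᴸ cells (λ (a , b) → fromℕ C * ((b - a) * rate σ′ a)) ≡⟨ Σ-* cells (fromℕ C) _ ⟩
    fromℕ C * Σᴸ cells (λ (a , b) → (b - a) * rate σ′ a)   ≡⟨ cong (fromℕ C *_) (cost≡ σ′) ⟨
    fromℕ C * cost σ′                                        ∎

  used⁺ : ∀ σ J → σ J ∈ₗ usedMachines σ
  used⁺ σ J = ∈-deduplicate⁺ _≟ᴹ_ (∈-tabulate⁺ J)

  used⁻ : ∀ σ {μ} → μ ∈ₗ usedMachines σ → ∃ λ J → σ J ≡ μ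
  used⁻ σ μ∈ with ∈-tabulate⁻ (∈-deduplicate⁻ _≟ᴹ_ (List.tabulate σ) μ∈)
  ... | J , eq = J , sym eq

  rate-nonNeg : ∀ σ t → 0# ≤ rate σ t
  rate-nonNeg σ t = Σ-nonNeg (usedMachines σ) λ μ → when-nonNeg (span? (jobsOn σ μ) t) (r-nonNeg (proj₁ μ))

  r≤rate : ∀ σ {t J} → t ∈I J → r (proj₁ (σ J)) ≤ rate σ t
  r≤rate σ {t} {J} t∈ = Σ-atLeastOne (λ μ → span? (jobsOn σ μ) t) (r-nonNeg ∘ proj₁)
    (used⁺ σ J) (J , ∈at⁺ {jobsOn σ (σ J)} (∈jobsOn⁺ σ J) t∈) ≤-refl

  -- A busy machine of type z carries at most `g z`, and `ρ z * g z` is `r z`. So the active jobs,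
  -- priced per unit of capacity of their own machines, cost no more than the machines themselves.
  load≤rate : ∀ {σ} → Feasible σ → ∀ t → ΣJ (λ J → when (t ∈I? J) (s J * ρ (proj₁ (σ J)))) ≤ rate σ t
  load≤rate {σ} feasible t = begin
    ΣJ (λ J → when (t ∈I? J) (s J * ρ (proj₁ (σ J))))
      ≤⟨ Σ-mono (allFin n) (λ J → when-≤ (t ∈I? J)
           (Σ-nonNeg (usedMachines σ) λ μ → *-nonNeg (ρ-nonNeg _) (when-nonNeg (J ∈? _) (s-nonNeg J)))
           λ t∈ → ≤-trans (on-own-machine J t∈) (Σ-∈ (λ μ → *-nonNeg (ρ-nonNeg _)
             (when-nonNeg (J ∈? (jobsOn σ μ at t)) (s-nonNeg J))) (used⁺ σ J))) ⟩
    ΣJ (λ J → Σᴸ (usedMachines σ) λ μ → ρ (proj₁ μ) * when (J ∈? (jobsOn σ μ at t)) (s J))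
      ≡⟨ Σ-swap (allFin n) (usedMachines σ) _ ⟩
    Σᴸ (usedMachines σ) (λ μ → ΣJ λ J → ρ (proj₁ μ) * when (J ∈? (jobsOn σ μ at t)) (s J))
      ≡⟨ Σ-cong (usedMachines σ) (λ μ → trans (Σ-* (allFin n) (ρ (proj₁ μ)) _)
           (cong (ρ (proj₁ μ) *_) (sym (S≡ (jobsOn σ μ at t))))) ⟩
    Σᴸ (usedMachines σ) (λ μ → ρ (proj₁ μ) * S (jobsOn σ μ at t))
      ≤⟨ Σ-mono (usedMachines σ) machine ⟩
    rate σ t ∎
    where
    on-own-machine : ∀ J → t ∈I J → s J * ρ (proj₁ (σ J)) ≤
                     ρ (proj₁ (σ J)) * when (J ∈? (jobsOn σ (σ J) at t)) (s J)
    on-own-machine J t∈ = ≤-reflexive (trans (*-comm (s J) _) (cong (ρ (proj₁ (σ J)) *_)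
      (sym (when-yes (J ∈? (jobsOn σ (σ J) at t)) (∈at⁺ {jobsOn σ (σ J)} (∈jobsOn⁺ σ J) t∈)))))

    machine : ∀ μ → ρ (proj₁ μ) * S (jobsOn σ μ at t) ≤ when (span? (jobsOn σ μ) t) (r (proj₁ μ))
    machine μ with span? (jobsOn σ μ) t
    ... | yes _     = ≤-trans (*-monoˡ-≤ (ρ-nonNeg _) (feasible t μ)) (≤-reflexive (ρ*g (proj₁ μ)))
    ... | no  empty = ≤-reflexive (trans (cong (ρ (proj₁ μ) *_) (S-empty λ J J∈ → empty (J , J∈))) (zeroʳ _))

  fits-on : ∀ {σ} → Feasible σ → ∀ J → s J ≤ g (proj₁ (σ J))
  fits-on {σ} feasible J = begin
    s J ≡⟨ when-yes (J ∈? X) (∈at⁺ {jobsOn σ (σ J)} (∈jobsOn⁺ σ J) (≤-refl , I-positive J)) ⟨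
    when (J ∈? X) (s J)               ≤⟨ Σ-∈ (λ J → when-nonNeg (J ∈? X) (s-nonNeg J)) (∈-allFin J) ⟩
    ΣJ (λ J → when (J ∈? X) (s J))    ≡⟨ S≡ X ⟨
    S X                               ≤⟨ feasible (I⁻ J) (σ J) ⟩
    g (proj₁ (σ J))                   ∎
    where X = jobsOn σ (σ J) at I⁻ J

  -- The load of a machine is largest when some job starts on it.
  FeasibleAtStarts : Schedule → Set
  FeasibleAtStarts σ = ∀ J → S (jobsOn σ (σ J) at I⁻ J) ≤ g (proj₁ (σ J))

  starts⇒feasible : ∀ σ → FeasibleAtStarts σ → Feasible σ
  starts⇒feasible σ starts t μ with argmax (λ J → J ∈? (jobsOn σ μ at t)) I⁻
  ... | inj₁ none = ≤-trans (≤-reflexive (S-empty none)) (<⇒≤ (g-positive _))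
  ... | inj₂ (J , J∈ , last) with ∈jobsOn⁻ σ (proj₁ (∈at⁻ {jobsOn σ μ} J∈))
  ...   | refl = ≤-trans (S-mono λ {J′} J′∈ → ∈at⁺ {jobsOn σ μ} (proj₁ (∈at⁻ {jobsOn σ μ} J′∈))
    (last J′ J′∈ , ≤-<-trans (proj₁ (proj₂ (∈at⁻ {jobsOn σ μ} J∈))) (proj₂ (proj₂ (∈at⁻ {jobsOn σ μ} J′∈)))))
    (starts J)

  -- `Feasible` quantifies over all times and infinitely many machines. Testing the start of each
  -- job turns it into a finite check, which the search for an optimum needs.
  feasible? : Decidable Feasible
  feasible? σ = map′ (starts⇒feasible σ) (λ feasible J → feasible (I⁻ J) (σ J))
    (Fin.all? λ J → S (jobsOn σ (σ J) at I⁻ J) ≤? g (proj₁ (σ J)))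

  -- A renaming of machines that preserves types and is injective on the machines in use. It lets
  -- any schedule be replaced by one from a finite set.
  record Renumbering (σ σ′ : Schedule) : Set where
    field
      type : ∀ J → proj₁ (σ′ J) ≡ proj₁ (σ J)
      to   : ∀ {J J′} → σ J ≡ σ J′ → σ′ J ≡ σ′ J′
      from : ∀ {J J′} → σ′ J ≡ σ′ J′ → σ J ≡ σ J′

    jobs⊆ : ∀ J {J′} → J′ ∈ jobsOn σ′ (σ′ J) → J′ ∈ jobsOn σ (σ J)
    jobs⊆ J J′∈ = ∈⟪⟫⁺ (λ J′ → σ J′ ≟ᴹ σ J) (from (∈jobsOn⁻ σ′ J′∈))

    feasible : Feasible σ → Feasible σ′
    feasible feas = starts⇒feasible σ′ λ J → begin
      S (jobsOn σ′ (σ′ J) at I⁻ J) ≤⟨ S-mono (λ J′∈ → let J′∈σ′ , a = ∈at⁻ {jobsOn σ′ (σ′ J)} J′∈ in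
                                      ∈at⁺ {jobsOn σ (σ J)} (jobs⊆ J J′∈σ′) a) ⟩
      S (jobsOn σ (σ J) at I⁻ J)   ≤⟨ feas (I⁻ J) (σ J) ⟩
      g (proj₁ (σ J))              ≡⟨ cong g (type J) ⟨
      g (proj₁ (σ′ J))             ∎

    linked? : ∀ μ′ μ → Dec (∃ λ J → σ′ J ≡ μ′ × σ J ≡ μ)
    linked? μ′ μ = Fin.any? λ J → (σ′ J ≟ᴹ μ′) ×-dec (σ J ≟ᴹ μ)

    cost-≤ : cost σ′ ≤ cost σ
    cost-≤ = begin
      cost σ′
        ≤⟨ Σ-mono-All {xs = usedMachines σ′} (All.tabulate λ {μ′} μ′∈ → own μ′ (used⁻ σ′ μ′∈)) ⟩
      Σᴸ (usedMachines σ′) (λ μ′ → Σᴸ (usedMachines σ) λ μ → when (linked? μ′ μ) (c σ μ))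
        ≡⟨ Σ-swap (usedMachines σ′) (usedMachines σ) _ ⟩
      Σᴸ (usedMachines σ) (λ μ → Σᴸ (usedMachines σ′) λ μ′ → when (linked? μ′ μ) (c σ μ))
        -- By `to`, only one renamed machine can be linked to a given original.
        ≤⟨ Σ-mono (usedMachines σ) (λ μ → Σ-atMostOne (λ μ′ → linked? μ′ μ)
             (Unique.deduplicate-! _≟ᴹ_ (List.tabulate σ′)) (c-nonNeg σ μ)
             (λ { _ _ (J , refl , refl) (J′ , refl , eq) → to (sym eq) }) (λ _ _ → ≤-refl)) ⟩
      cost σ ∎
      where
      c : Schedule → Machine → Carrier
      c σ μ = r (proj₁ μ) * ∥ jobsOn σ μ ∥

      c-nonNeg : ∀ σ μ → 0# ≤ c σ μ
      c-nonNeg σ μ = *-nonNeg (r-nonNeg (proj₁ μ)) (∥∥-nonNeg (jobsOn σ μ))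

      own : ∀ μ′ → (∃ λ J → σ′ J ≡ μ′) → c σ′ μ′ ≤ Σᴸ (usedMachines σ) (λ μ → when (linked? μ′ μ) (c σ μ))
      own _ (J , refl) = Σ-atLeastOne (linked? (σ′ J)) (c-nonNeg σ) (used⁺ σ J) (J , refl , refl)
        (subst (λ z → r z * ∥ jobsOn σ′ (σ′ J) ∥ ≤ c σ (σ J)) (sym (type J))
          (*-monoˡ-≤ (r-nonNeg _) (∥∥-mono (jobs⊆ J))))

  -- At most `n` machines are in use, so indices below `n` suffice, and the schedules with such
  -- indices can be enumerated.
  decode : Fin ((suc top ℕ.* n) ℕ.^ n) → Schedule
  decode k J = let z , i = remQuot {suc top} n (finToFun k J) in z , toℕ i

  module _ (σ : Schedule) where

    -- The given proof only excludes the negative answer; the job returned is the one found by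
    -- searching for `μ`. Hence all jobs on a machine get the same representative, whose number
    -- becomes the new machine index.
    firstOn : ∀ μ → (∃ λ J → σ J ≡ μ) → ∃ λ J → σ J ≡ μ
    firstOn μ p with Fin.any? (λ J → σ J ≟ᴹ μ)
    ... | yes q = q
    ... | no ¬q = contradiction p ¬q

    firstOn-irrelevant : ∀ {μ ν} p q → μ ≡ ν → proj₁ (firstOn μ p) ≡ proj₁ (firstOn ν q)
    firstOn-irrelevant {μ} p q refl with Fin.any? (λ J → σ J ≟ᴹ μ)
    ... | yes _ = refl
    ... | no ¬q = contradiction p ¬q

    first : Fin n → Fin n
    first J = proj₁ (firstOn (σ J) (J , refl))

    encode : Fin ((suc top ℕ.* n) ℕ.^ n)
    encode = funToFin λ J → combine (proj₁ (σ J)) (first J)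

    decode-encode : ∀ J → decode encode J ≡ (proj₁ (σ J) , toℕ (first J))
    decode-encode J = cong (λ (z , i) → z , toℕ i) (trans
      (cong (remQuot {suc top} n) (Fin.finToFun-funToFin {n} (λ J → combine (proj₁ (σ J)) (first J)) J))
      (Fin.remQuot-combine {suc top} {n} (proj₁ (σ J)) (first J)))

    renumbering : Renumbering σ (decode encode)
    renumbering = record
      { type = λ J → cong proj₁ (decode-encode J)
      ; to   = λ {J} {J′} eq → trans (decode-encode J) (trans
          (cong₂ _,_ (cong proj₁ eq) (cong toℕ (firstOn-irrelevant _ _ eq))) (sym (decode-encode J′)))
      ; from = λ {J} {J′} eq → trans (sym (first-same J)) (trans
          (cong σ (Fin.toℕ-injective (cong proj₂ (trans (sym (decode-encode J)) (trans eq (decode-encode J′))))))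
          (first-same J′))
      }
      where
      first-same : ∀ J → σ (first J) ≡ σ J
      first-same J = proj₂ (firstOn (σ J) (J , refl))

  -- The cheapest feasible schedule among the enumerated ones is optimal, because every feasible
  -- schedule has an enumerated renaming that is feasible and no dearer.
  optimum : ∃ Feasible → ∃ λ v → IsOPT v
  optimum (σ₀ , feas₀) with argmin (feasible? ∘ decode) (cost ∘ decode)
  ... | inj₁ none = contradiction (Renumbering.feasible (renumbering σ₀) feas₀) (none (encode σ₀))
  ... | inj₂ (k , feas , least) = cost (decode k) , (decode k , feas , refl) , λ σ feasσ →
    ≤-trans (least (encode σ) (Renumbering.feasible (renumbering σ) feasσ)) (Renumbering.cost-≤ (renumbering σ))

  approximates : ∀ C {σ} → Feasible σ → (∀ σ′ → Feasible σ′ → ∀ t → rate σ t ≤ fromℕ C * rate σ′ t) →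
                 σ CostsAtMost C ×OPT
  approximates C {σ} feas le with optimum (σ , feas)
  ... | opt , (σ* , feas* , refl) , least = opt , ((σ* , feas* , refl) , least) , cost-mono C (le σ* feas*)

  -- Schedules obtained by dual colouring of one job set per type.

  module Colouring (dc : DualColouring) (zs : List Type) (K : Type → Subset n)
                   (K-fits : ∀ z {J} → J ∈ K z → s J ≤ g z)
                   (τ : Fin n → Type) (τ∈ : ∀ J → τ J ∈ₗ zs) (∈K : ∀ J → J ∈ K (τ J)) where

    open DualColouring dc

    input : Type → DualColouringInput
    input z = record { jobs = jobs ; K = K z ; g = g z ; g-positive = g-positive z ; K-fits = K-fits z }

    schedule : Schedule
    schedule J = τ J , colour (input (τ J)) J

    schedule-feasible : Feasible schedule
    schedule-feasible t (z , i) = ≤-trans (S-mono λ {J} J∈ → included (∈at⁻ {jobsOn schedule (z , i)} J∈))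
      (IsDualColouring.feasible (isDualColouring (input z)) t i)
      where
      included : ∀ {J} → J ∈ jobsOn schedule (z , i) × t ∈I J →
                 J ∈ (K z ∩ ⟪ (λ J → colour (input z) J ℕ.≟ i) ⟫) at t
      included {J} (J∈ , t∈) with ∈jobsOn⁻ schedule J∈
      ... | refl = ∈at⁺ {K z ∩ ⟪ (λ J → colour (input z) J ℕ.≟ i) ⟫}
        (x∈p∩q⁺ (∈K J , ∈⟪⟫⁺ (λ J → colour (input z) J ℕ.≟ i) refl)) t∈

    machines : Type → Carrier → ℕ
    machines z t = ⌈ S (K z at t) / g z ⌉

    module _ (t : Carrier) where

      busy : Type → List ℕ
      busy z = IsDualColouring.busyMachines (isDualColouring (input z)) t

      -- A machine busy at `t` is a pair of a type `z` and a colour in `busy z`, and distinct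
      -- machines are distinct pairs. So the known bound on busy machines applies type by type.
      rate-schedule : rate schedule t ≤ fromℕ 4 * Σᴸ zs (λ z → fromℕ (machines z t) * r z)
      rate-schedule = begin
        rate schedule t
          ≤⟨ Σ-mono (usedMachines schedule) (λ μ → when-≤ (span? (jobsOn schedule μ) t)
               (Σ-nonNeg zs λ z → Σ-nonNeg (busy z) λ i → term-nonNeg μ z i) λ (J , J∈) → own (∈at⁻ {jobsOn schedule μ} J∈)) ⟩
        Σᴸ (usedMachines schedule) (λ μ → Σᴸ zs λ z → Σᴸ (busy z) λ i → term μ z i)
          ≡⟨ trans (Σ-swap (usedMachines schedule) zs _) (Σ-cong zs λ z → Σ-swap (usedMachines schedule) (busy z) _) ⟩
        Σᴸ zs (λ z → Σᴸ (busy z) λ i → Σᴸ (usedMachines schedule) λ μ → term μ z i)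
          ≤⟨ Σ-mono zs (λ z → Σ-mono (busy z) λ i → Σ-atMostOne (λ μ → (z , i) ≟ᴹ μ)
               (Unique.deduplicate-! _≟ᴹ_ (List.tabulate schedule)) (r-nonNeg z)
               (λ { _ _ refl refl → refl }) λ _ _ → ≤-refl) ⟩
        Σᴸ zs (λ z → Σᴸ (busy z) λ i → r z)
          ≡⟨ Σ-cong zs (λ z → Σ-const (busy z) (r z)) ⟩
        Σᴸ zs (λ z → fromℕ (length (busy z)) * r z)
          ≤⟨ Σ-mono zs (λ z → ≤-trans (n*-weaken (IsDualColouring.busy (isDualColouring (input z)) t) (r-nonNeg z))
               (≤-reflexive (fromℕ-*-assoc 4 (machines z t) (r z)))) ⟩
        Σᴸ zs (λ z → fromℕ 4 * (fromℕ (machines z t) * r z))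
          ≡⟨ Σ-* zs (fromℕ 4) _ ⟩
        fromℕ 4 * Σᴸ zs (λ z → fromℕ (machines z t) * r z) ∎
        where
        term : Machine → Type → ℕ → Carrier
        term μ z i = when ((z , i) ≟ᴹ μ) (r z)

        term-nonNeg : ∀ μ z i → 0# ≤ term μ z i
        term-nonNeg μ z i = when-nonNeg ((z , i) ≟ᴹ μ) (r-nonNeg z)

        own : ∀ {μ J} → J ∈ jobsOn schedule μ × t ∈I J → r (proj₁ μ) ≤ Σᴸ zs λ z → Σᴸ (busy z) λ i → term μ z i
        own {μ} {J} (J∈ , t∈) with ∈jobsOn⁻ schedule J∈
        ... | refl = ≤-trans
          (Σ-atLeastOne (λ i → (τ J , i) ≟ᴹ schedule J) (λ _ → r-nonNeg (τ J))
            (∈-deduplicate⁺ ℕ._≟_ (∈-map⁺ (colour (input (τ J)))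
              (∈-filter⁺ (λ J′ → J′ ∈? (K (τ J) at t)) (∈-allFin J) (∈at⁺ {K (τ J)} (∈K J) t∈)))) refl ≤-refl)
          (Σ-∈ {xs = zs} (λ z → Σ-nonNeg (busy z) (term-nonNeg μ z)) (τ∈ J))

-- Weights of jobs, and the charging argument common to both algorithms.

module Weights (𝔽 : OrderedField) (𝓘 : BSHM.Instance 𝔽) (zs : List (BSHM.Instance.Type 𝓘)) where

  open OrderedField 𝔽
  open OrderedFieldProperties 𝔽
  open BSHM 𝔽
  open Scheduling 𝓘
  open SchedulingProperties 𝔽 𝓘

  infixl 7 _⊓_
  _⊓_ : Carrier → Carrier → Carrier
  x ⊓ y = if does (x ≤? y) then x else y

  x⊓y≤x : ∀ x y → x ⊓ y ≤ x
  x⊓y≤x x y with x ≤? y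
  ... | yes _   = ≤-refl
  ... | no  x≰y = ≰⇒≥ x≰y

  x⊓y≤y : ∀ x y → x ⊓ y ≤ y
  x⊓y≤y x y with x ≤? y
  ... | yes x≤y = x≤y
  ... | no  _   = ≤-refl

  ⊓-glb : ∀ {x y z} → z ≤ x → z ≤ y → z ≤ x ⊓ y
  ⊓-glb {x} {y} z≤x z≤y with x ≤? y
  ... | yes _ = z≤x
  ... | no  _ = z≤y

  -- If zs consists of all types, then Eligible z J means J ∈ R z.
  Eligible : Type → Fin n → Set
  Eligible z J = s J ≤ g z × (∀ {y} → y ∈ₗ zs → y Fin.< z → s J ≤ g y → ρ z < ρ y)

  lower? : ∀ (z : Type) J (y : Type) → Dec (y Fin.< z × s J ≤ g y)
  lower? z J y = (y Fin.<? z) ×-dec (s J ≤? g y)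

  include : ∀ {P : Set} → Dec P → Carrier → Carrier → Carrier
  include d x y = if does d then x ⊓ y else y

  include≤ʳ : ∀ {P : Set} (d : Dec P) x y → include d x y ≤ y
  include≤ʳ (yes _) x y = x⊓y≤y x y
  include≤ʳ (no _)  x y = ≤-refl

  include≤ˡ : ∀ {P : Set} (d : Dec P) x y → P → include d x y ≤ x
  include≤ˡ (yes _) x y _ = x⊓y≤x x y
  include≤ˡ (no ¬p) x y p = contradiction p ¬p

  ≤include : ∀ {P : Set} (d : Dec P) {x y z} → (P → z ≤ x) → z ≤ y → z ≤ include d x y
  ≤include (yes p) z≤x z≤y = ⊓-glb (z≤x p) z≤y
  ≤include (no _)  _   z≤y = z≤y

  cheapest : Type → Fin n → List Type → Carrier
  cheapest z J = List.foldr (λ y → include (lower? z J y) (s J * ρ y)) (r z)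

  -- A job that fits no smaller type of zs weighs r z, so that it fills z alone.
  weight : Type → Fin n → Carrier
  weight z J = cheapest z J zs

  cheapest≤ : ∀ z J {ys y} → y ∈ₗ ys → y Fin.< z → s J ≤ g y → cheapest z J ys ≤ s J * ρ y
  cheapest≤ z J {y ∷ ys} (here refl) y<z fits = include≤ˡ (lower? z J y) _ _ (y<z , fits)
  cheapest≤ z J {x ∷ ys} (there y∈)  y<z fits =
    ≤-trans (include≤ʳ (lower? z J x) _ _) (cheapest≤ z J y∈ y<z fits)

  ≤cheapest : ∀ z J {ys x} → x ≤ r z → (∀ {y} → y ∈ₗ ys → y Fin.< z → s J ≤ g y → x ≤ s J * ρ y) →
              x ≤ cheapest z J ys
  ≤cheapest z J {[]}     x≤r _  = x≤r
  ≤cheapest z J {y ∷ ys} x≤r x≤ = ≤include (lower? z J y)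
    (λ (y<z , fits) → x≤ (here refl) y<z fits) (≤cheapest z J x≤r (x≤ ∘ there))

  weight-nonNeg : ∀ z J → 0# ≤ weight z J
  weight-nonNeg z J = ≤cheapest z J {zs} (r-nonNeg z) λ {y} _ _ _ → *-nonNeg (s-nonNeg J) (ρ-nonNeg y)

  load : (Type → Subset n) → Type → Carrier → Carrier
  load 𝓡 z t = ΣJ λ J → when (J ∈? (𝓡 z at t)) (weight z J)

  load-nonNeg : ∀ 𝓡 z t → 0# ≤ load 𝓡 z t
  load-nonNeg 𝓡 z t = Σ-nonNeg (allFin n) λ J → when-nonNeg (J ∈? (𝓡 z at t)) (weight-nonNeg z J)

  -- All that the analysis knows of an algorithm that treats types from the largest down: `𝓡 z` are
  -- the jobs that `z` could take, `K z` those that it takes. It takes jobs only where the load is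
  -- high, and each job that it declines has a moment of low load.
  record TopDown : Set where
    field
      K 𝓡  : Type → Subset n
      𝓡⁻   : ∀ {z J} → z ∈ₗ zs → J ∈ 𝓡 z → Eligible z J × (∀ {y} → y ∈ₗ zs → z Fin.< y → J ∉ K y)
      𝓡⁺   : ∀ {z J} → z ∈ₗ zs → Eligible z J → (∀ {y} → y ∈ₗ zs → z Fin.< y → J ∉ K y) → J ∈ 𝓡 z
      K⊆𝓡  : ∀ {z J} → z ∈ₗ zs → J ∈ K z → J ∈ 𝓡 z
      -- 1/6 ≤ 1/3 − 1/7: the threshold for c, less what the ceilings may add to c
      heavy : ∀ {z J t} → z ∈ₗ zs → J ∈ K z → t ∈I J → r z ≤ fromℕ 6 * load 𝓡 z t
      light : ∀ {z J} → z ∈ₗ zs → J ∈ 𝓡 z → J ∉ K z → ∃ λ u → u ∈I J × load 𝓡 z u ≤ r z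

  module Analysis (ascending : AllPairs Fin._<_ zs)
                  (doubling : AllPairs (λ y z → fromℕ 2 * r y ≤ r z) zs) (td : TopDown) where

    open TopDown td
    open ≤-Reasoning
    open DecMembership (Fin._≟_ {suc top}) using () renaming (_∈?_ to _∈ₗ?_)

    distinct : Unique zs
    distinct = AllPairs.map (λ y<z y≡z → Fin.<-irrefl y≡z y<z) ascending

    -- A job passed over by z is active at some time at which the load is at
    -- most r z.  The passed over jobs that are active at t and have such a
    -- time up to t are all active at the last of these times; likewise after t.
    module _ {z} (z∈ : z ∈ₗ zs) (t : Carrier) where

      Passed : Fin n → Set
      Passed J = J ∈ (𝓡 z at t) × J ∉ K z

      passed? : ∀ J → Dec (Passed J)
      passed? J = (J ∈? (𝓡 z at t)) ×-dec ¬? (J ∈? K z)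

      witness : ∀ J → ∃ λ u → Passed J → u ∈I J × load 𝓡 z u ≤ r z
      witness J with passed? J
      -- A dummy moment, so that `u` is total and can be passed to `argmax` and `argmin`.
      ... | no ¬p = 0# , λ p → contradiction p ¬p
      ... | yes (J∈ , J∉) with light z∈ (proj₁ (∈at⁻ {𝓡 z} J∈)) J∉
      ...   | u , p = u , λ _ → p

      u : Fin n → Carrier
      u J = proj₁ (witness J)

      activePassed : ∀ {J} → Passed J → t ∈I J
      activePassed (J∈ , _) = proj₂ (∈at⁻ {𝓡 z} J∈)

      -- If all the passed over jobs in question are active at one moment `u J`, their weight is
      -- part of the load there, and `u J` was chosen as a moment of load at most `r z`.
      side : ∀ {Q : Fin n → Set} (Q? : ∀ J → Dec (Q J)) →
             (∀ J → ¬ (Passed J × Q J)) ⊎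
             (∃ λ J → (Passed J × Q J) × ∀ J′ → Passed J′ × Q J′ → u J ∈I J′) →
             ΣJ (λ J → when (passed? J ×-dec Q? J) (weight z J)) ≤ r z
      side Q? (inj₁ none) = ≤-trans (≤-reflexive (Σ-0 (allFin n) λ J →
        when-no (passed? J ×-dec Q? J) (none J))) (r-nonNeg z)
      side Q? (inj₂ (J , (p , _) , common)) = ≤-trans
        (Σ-mono (allFin n) λ J′ → when-mono (passed? J′ ×-dec Q? J′) (J′ ∈? (𝓡 z at u J)) (weight-nonNeg z J′)
          λ q → ∈at⁺ {𝓡 z} (proj₁ (∈at⁻ {𝓡 z} (proj₁ (proj₁ q)))) (common J′ q) , ≤-refl)
        (proj₂ (proj₂ (witness J) p))

      before : ΣJ (λ J → when (passed? J ×-dec (u J ≤? t)) (weight z J)) ≤ r z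
      before with argmax (λ J → passed? J ×-dec (u J ≤? t)) u
      ... | inj₁ none = side (λ J → u J ≤? t) (inj₁ none)
      ... | inj₂ (J , q , last) = side (λ J → u J ≤? t) (inj₂ (J , q , λ J′ q′ →
        ≤-trans (proj₁ (proj₁ (proj₂ (witness J′) (proj₁ q′)))) (last J′ q′) ,
        ≤-<-trans (proj₂ q) (proj₂ (activePassed (proj₁ q′)))))

      after : ΣJ (λ J → when (passed? J ×-dec (t ≤? u J)) (weight z J)) ≤ r z
      after with argmin (λ J → passed? J ×-dec (t ≤? u J)) u
      ... | inj₁ none = side (λ J → t ≤? u J) (inj₁ none)
      ... | inj₂ (J , q , first) = side (λ J → t ≤? u J) (inj₂ (J , q , λ J′ q′ →
        ≤-trans (proj₁ (activePassed (proj₁ q′))) (proj₂ q) ,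
        ≤-<-trans (first J′ q′) (proj₂ (proj₁ (proj₂ (witness J′) (proj₁ q′))))))

      passed-weight : ΣJ (λ J → when (passed? J) (weight z J)) ≤ fromℕ 2 * r z
      passed-weight = begin
        ΣJ (λ J → when (passed? J) (weight z J))
          ≤⟨ Σ-mono (allFin n) split ⟩
        ΣJ (λ J → when (passed? J ×-dec (u J ≤? t)) (weight z J) + when (passed? J ×-dec (t ≤? u J)) (weight z J))
          ≡⟨ Σ-+ (allFin n) _ _ ⟩
        ΣJ (λ J → when (passed? J ×-dec (u J ≤? t)) (weight z J)) + ΣJ (λ J → when (passed? J ×-dec (t ≤? u J)) (weight z J))
          ≤⟨ +-mono-≤ before after ⟩
        r z + r z ≡⟨ 2*x (r z) ⟨
        fromℕ 2 * r z ∎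
        where
        split : ∀ J → when (passed? J) (weight z J) ≤
                when (passed? J ×-dec (u J ≤? t)) (weight z J) + when (passed? J ×-dec (t ≤? u J)) (weight z J)
        split J with total (u J) t
        ... | inj₁ u≤t = ≤-trans (when-mono (passed? J) (passed? J ×-dec (u J ≤? t)) (weight-nonNeg z J)
          λ p → (p , u≤t) , ≤-refl) (x≤x+y (when-nonNeg (passed? J ×-dec (t ≤? u J)) (weight-nonNeg z J)))
        ... | inj₂ t≤u = ≤-trans (when-mono (passed? J) (passed? J ×-dec (t ≤? u J)) (weight-nonNeg z J)
          λ p → (p , t≤u) , ≤-refl) (x≤y+x (when-nonNeg (passed? J ×-dec (u J ≤? t)) (weight-nonNeg z J)))

    -- `L` bounds the spending of the competitor and `τ` gives the types of its jobs. Both stay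
    -- abstract, so that they can also come from a schedule whose jobs have been moved to larger
    -- types.
    module AtTime (t L : Carrier) (0≤L : 0# ≤ L) (τ : Fin n → Type) (τ∈ : ∀ J → τ J ∈ₗ zs)
                  (τ-fits : ∀ J → s J ≤ g (τ J)) (τ-rate : ∀ J → t ∈I J → r (τ J) ≤ L)
                  (τ-load : ΣJ (λ J → when (t ∈I? J) (s J * ρ (τ J))) ≤ L) where

      r-mono-≤ : ∀ {y z} → y Fin.≤ z → r y ≤ r z
      r-mono-≤ = mono-≤ r r-mono-<

      -- If the competitor runs an active job on a type not below `z`, then `r z` is at most `L`
      -- directly. Otherwise every active job runs below `z`, where it costs at least its weight, so
      -- `L` is at least the load, and `heavy` applies.
      used-rate : ∀ {z J} → z ∈ₗ zs → J ∈ K z → t ∈I J → r z ≤ fromℕ 6 * L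
      used-rate {z} {J} z∈ J∈ t∈ with Fin.any? (λ J′ → (t ∈I? J′) ×-dec (z Fin.≤? τ J′))
      ... | yes (J′ , t∈′ , z≤) = ≤-trans (≤-trans (r-mono-≤ z≤) (τ-rate J′ t∈′)) (x≤suc*x 5 0≤L)
      ... | no  none = ≤-trans (heavy z∈ J∈ t∈) (n*-mono 6 (≤-trans
        (Σ-mono (allFin n) λ J′ → when-mono (J′ ∈? (𝓡 z at t)) (t ∈I? J′)
          (*-nonNeg (s-nonNeg J′) (ρ-nonNeg (τ J′))) λ J′∈ → let t∈′ = proj₂ (∈at⁻ {𝓡 z} J′∈) in
            t∈′ , cheapest≤ z J′ {zs} (τ∈ J′) (ℕ.≰⇒> λ z≤ → none (J′ , t∈′ , z≤)) (τ-fits J′)) τ-load))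

      -- Rounding up adds at most one machine, and only to types with an active job; by `used-rate`
      -- these have rate at most 6 L, so the added machines form a geometric sum.
      machines-rate : ∀ {z} → z ∈ₗ zs → fromℕ ⌈ S (K z at t) / g z ⌉ * r z ≤
                      when (r z ≤? fromℕ 6 * L) (r z) + ΣJ (λ J → when (J ∈? (K z at t)) (s J * ρ z))
      machines-rate {z} z∈ with nonempty? (K z at t)
      ... | no empty = ≤-trans (≤-reflexive (trans (cong (λ k → fromℕ k * r z) (⌈⌉-nonPos
              (≤-reflexive (trans (cong (_/ g z) (S-empty λ J J∈ → empty (J , J∈))) (zeroˡ _))))) (zeroˡ (r z))))
            (+-nonNeg (when-nonNeg (r z ≤? fromℕ 6 * L) (r-nonNeg z))
              (Σ-nonNeg (allFin n) λ J → when-nonNeg (J ∈? (K z at t)) (*-nonNeg (s-nonNeg J) (ρ-nonNeg z))))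
      ... | yes (J , J∈) = begin
        fromℕ ⌈ S (K z at t) / g z ⌉ * r z
          ≤⟨ *-monoʳ-≤ (r-nonNeg z) (⌈⌉≤ (/-nonNeg (S-nonNeg (K z at t)) (g-positive z))) ⟩
        (S (K z at t) / g z + 1#) * r z
          ≡⟨ trans (distribʳ (r z) _ 1#) (trans (+-comm _ _) (cong₂ _+_ (*-identityˡ (r z))
               (solve 3 (λ a b c → (a :* b) :* c := (c :* b) :* a) refl (S (K z at t)) (g z ⁻¹) (r z)))) ⟩
        r z + ρ z * S (K z at t)
          ≡⟨ cong₂ _+_ (sym (when-yes (r z ≤? fromℕ 6 * L) (used-rate z∈ (proj₁ (∈at⁻ {K z} J∈)) (proj₂ (∈at⁻ {K z} J∈)))))
               (trans (cong (ρ z *_) (S≡ (K z at t))) (trans (sym (Σ-* (allFin n) (ρ z) _))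
                 (Σ-cong (allFin n) λ J → trans (*-when (J ∈? (K z at t))) (cong (when (J ∈? (K z at t))) (*-comm (ρ z) (s J)))))) ⟩
        when (r z ≤? fromℕ 6 * L) (r z) + ΣJ (λ J → when (J ∈? (K z at t)) (s J * ρ z)) ∎

      -- Restricting to `r q ≤ L` is what makes the total over all `q` a geometric sum of order `L`.
      passedOver : Fin n → Carrier
      passedOver J = Σᴸ zs λ q → when (r q ≤? L) (when ((J ∈? (𝓡 q at t)) ×-dec ¬? (J ∈? K q)) (weight q J))

      passedOver-nonNeg : ∀ J q → 0# ≤ when (r q ≤? L) (when ((J ∈? (𝓡 q at t)) ×-dec ¬? (J ∈? K q)) (weight q J))
      passedOver-nonNeg J q = when-nonNeg (r q ≤? L) (when-nonNeg ((J ∈? (𝓡 q at t)) ×-dec ¬? (J ∈? K q)) (weight-nonNeg q J))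

      -- If τ J is cheaper than z, then J was passed over by the first type
      -- after z that is cheaper than z.
      charge : ∀ {z J} → z ∈ₗ zs → J ∈ K z → t ∈I J → s J * ρ z ≤ s J * ρ (τ J) + passedOver J
      charge {z} {J} z∈ J∈ t∈ with ρ z ≤? ρ (τ J)
      ... | yes le = ≤-trans (*-monoˡ-≤ (s-nonNeg J) le) (x≤x+y (Σ-nonNeg zs (passedOver-nonNeg J)))
      ... | no ρz≰ = go (argmin (λ q → (q ∈ₗ? zs) ×-dec ((z Fin.<? q) ×-dec (ρ q <? ρ z))) r)
        where
        eligible : Eligible z J
        eligible = proj₁ (𝓡⁻ z∈ (K⊆𝓡 z∈ J∈))

        -- By eligibility, all types below `z` that the job fits are dearer per unit than `z`, so
        -- the cheaper type `τ J` lies above.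
        z<τ : z Fin.< τ J
        z<τ with Fin.<-cmp z (τ J)
        ... | tri< z<τ _ _ = z<τ
        ... | tri≈ _ refl _ = contradiction ≤-refl ρz≰
        ... | tri> _ _ τ<z = contradiction (<⇒≤ (proj₂ eligible (τ∈ J) τ<z (τ-fits J))) ρz≰

        Cheaper : Type → Set
        Cheaper q = q ∈ₗ zs × z Fin.< q × ρ q < ρ z

        go : (∀ q → ¬ Cheaper q) ⊎ (∃ λ q → Cheaper q × ∀ y → Cheaper y → r q ≤ r y) →
             s J * ρ z ≤ s J * ρ (τ J) + passedOver J
        go (inj₁ none) = contradiction (τ∈ J , z<τ , ≰⇒> ρz≰) (none (τ J))
        go (inj₂ (q , (q∈ , z<q , ρq<) , least)) = ≤-trans
          (≤-trans (≤-trans s*ρ≤ (≤-reflexive (sym (when-yes (J ∈? (𝓡 q at t) ×-dec ¬? (J ∈? K q))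
                              (∈at⁺ {𝓡 q} J∈𝓡 t∈ , unscheduled q∈ z<q)))))
            (≤-trans (≤-reflexive (sym (when-yes (r q ≤? L) rq≤L))) (Σ-∈ (passedOver-nonNeg J) q∈)))
          (x≤y+x (*-nonNeg (s-nonNeg J) (ρ-nonNeg (τ J))))
          where
          -- `τ J` itself is one of the cheaper types above `z`, so the first of them has no larger
          -- rate.
          rq≤L : r q ≤ L
          rq≤L = ≤-trans (least (τ J) (τ∈ J , z<τ , ≰⇒> ρz≰)) (τ-rate J t∈)

          unscheduled : ∀ {y} → y ∈ₗ zs → z Fin.< y → J ∉ K y
          unscheduled = proj₂ (𝓡⁻ z∈ (K⊆𝓡 z∈ J∈))

          -- No type below `q` that the job fits is cheaper than `z`: up to `z` by eligibility,
          -- beyond `z` because `q` is the first cheaper type. This gives both the eligibility for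
          -- `q` and the lower bound on the weight.
          ρz≤ : ∀ {y} → y ∈ₗ zs → y Fin.< q → s J ≤ g y → ρ z ≤ ρ y
          ρz≤ {y} y∈ y<q fits with Fin.<-cmp y z
          ... | tri< y<z _ _ = <⇒≤ (proj₂ eligible y∈ y<z fits)
          ... | tri≈ _ refl _ = ≤-refl
          ... | tri> _ _ z<y with ρ z ≤? ρ y
          ...   | yes le = le
          ...   | no ρz≰ρy = contradiction (least y (y∈ , z<y , ≰⇒> ρz≰ρy)) (<⇒≱ (r-mono-< y<q))

          J∈𝓡 : J ∈ 𝓡 q
          J∈𝓡 = 𝓡⁺ q∈ (≤-trans (proj₁ eligible) (<⇒≤ (g-mono-< z<q)) ,
              λ y∈ y<q fits → <-≤-trans ρq< (ρz≤ y∈ y<q fits))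
            λ y∈ q<y → unscheduled y∈ (ℕ.<-trans z<q q<y)

          -- The starting value `r q` of the minimum is large enough as well, since `s J * ρ z` is
          -- at most `g z * ρ z`, which is `r z`.
          s*ρ≤ : s J * ρ z ≤ weight q J
          s*ρ≤ = ≤cheapest q J {zs}
            (≤-trans (*-monoʳ-≤ (ρ-nonNeg z) (proj₁ eligible)) (≤-trans
              (≤-reflexive (trans (*-comm (g z) (ρ z)) (ρ*g z))) (<⇒≤ (r-mono-< z<q))))
            λ y∈ y<q fits → *-monoˡ-≤ (s-nonNeg J) (ρz≤ y∈ y<q fits)

      -- The larger of two types chooses first, and what it takes is no longer offered to the
      -- smaller.
      disjoint : ∀ {y z J} → y ∈ₗ zs → z ∈ₗ zs → J ∈ K y → J ∈ K z → y ≡ z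
      disjoint {y} {z} y∈ z∈ J∈y J∈z with Fin.<-cmp y z
      ... | tri< y<z _ _ = contradiction J∈z (proj₂ (𝓡⁻ y∈ (K⊆𝓡 y∈ J∈y)) z∈ y<z)
      ... | tri≈ _ y≡z _ = y≡z
      ... | tri> _ _ z<y = contradiction J∈y (proj₂ (𝓡⁻ z∈ (K⊆𝓡 z∈ J∈z)) y∈ z<y)

      job-charge : ∀ J → Σᴸ zs (λ z → when (J ∈? (K z at t)) (s J * ρ z)) ≤
                   when (t ∈I? J) (s J * ρ (τ J)) + passedOver J
      job-charge J = Σ-atMostOne (λ z → J ∈? (K z at t)) distinct
        (+-nonNeg (when-nonNeg (t ∈I? J) (*-nonNeg (s-nonNeg J) (ρ-nonNeg (τ J)))) (Σ-nonNeg zs (passedOver-nonNeg J)))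
        (λ {y} {z} y∈ z∈ J∈y J∈z → disjoint y∈ z∈ (proj₁ (∈at⁻ {K y} J∈y)) (proj₁ (∈at⁻ {K z} J∈z)))
        λ {z} z∈ J∈ → let J∈K , t∈ = ∈at⁻ {K z} J∈ in
          ≤-trans (charge z∈ J∈K t∈) (+-monoˡ-≤ (passedOver J) (≤-reflexive (sym (when-yes (t ∈I? J) t∈))))

      small : Carrier → Carrier
      small M = Σᴸ zs λ z → when (r z ≤? M) (r z)

      small≤ : ∀ {M} → 0# ≤ M → small M ≤ fromℕ 2 * M
      small≤ {M} 0≤M = subst (_≤ fromℕ 2 * M) (1*x (small M)) (geometric r 1 r-nonNeg 0≤M doubling)

      passedOver≤ : ΣJ passedOver ≤ fromℕ 4 * L
      passedOver≤ = begin
        ΣJ passedOver ≡⟨ Σ-swap (allFin n) zs _ ⟩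
        Σᴸ zs (λ q → ΣJ λ J → when (r q ≤? L) (when ((J ∈? (𝓡 q at t)) ×-dec ¬? (J ∈? K q)) (weight q J)))
          ≤⟨ Σ-mono-All (All.tabulate bound) ⟩
        Σᴸ zs (λ q → fromℕ 2 * when (r q ≤? L) (r q)) ≡⟨ Σ-* zs (fromℕ 2) _ ⟩
        fromℕ 2 * small L                             ≤⟨ n*-mono 2 (small≤ 0≤L) ⟩
        fromℕ 2 * (fromℕ 2 * L)                       ≡⟨ fromℕ-*-assoc 2 2 L ⟨
        fromℕ 4 * L                                   ∎
        where
        bound : ∀ {q} → q ∈ₗ zs →
          ΣJ (λ J → when (r q ≤? L) (when ((J ∈? (𝓡 q at t)) ×-dec ¬? (J ∈? K q)) (weight q J))) ≤
          fromℕ 2 * when (r q ≤? L) (r q)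
        bound {q} q∈ with does (r q ≤? L)
        ... | true  = passed-weight q∈ t
        ... | false = ≤-reflexive (trans (Σ-0 (allFin n) λ _ → refl) (sym (zeroʳ (fromℕ 2))))

      machines≤ : Σᴸ zs (λ z → fromℕ ⌈ S (K z at t) / g z ⌉ * r z) ≤ fromℕ 17 * L
      machines≤ = begin
        Σᴸ zs (λ z → fromℕ ⌈ S (K z at t) / g z ⌉ * r z)
          ≤⟨ Σ-mono-All (All.tabulate machines-rate) ⟩
        Σᴸ zs (λ z → when (r z ≤? fromℕ 6 * L) (r z) + ΣJ (λ J → when (J ∈? (K z at t)) (s J * ρ z)))
          ≡⟨ trans (Σ-+ zs _ _) (cong (small (fromℕ 6 * L) +_) (Σ-swap zs (allFin n) _)) ⟩
        small (fromℕ 6 * L) + ΣJ (λ J → Σᴸ zs λ z → when (J ∈? (K z at t)) (s J * ρ z))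
          ≤⟨ +-mono-≤ (small≤ (*-nonNeg (fromℕ-nonNeg 6) 0≤L)) (Σ-mono (allFin n) job-charge) ⟩
        fromℕ 2 * (fromℕ 6 * L) + ΣJ (λ J → when (t ∈I? J) (s J * ρ (τ J)) + passedOver J)
          ≡⟨ cong₂ _+_ (sym (fromℕ-*-assoc 2 6 L)) (Σ-+ (allFin n) _ _) ⟩
        fromℕ 12 * L + (ΣJ (λ J → when (t ∈I? J) (s J * ρ (τ J))) + ΣJ passedOver)
          ≤⟨ +-monoʳ-≤ _ (+-mono-≤ τ-load passedOver≤) ⟩
        fromℕ 12 * L + (L + fromℕ 4 * L)
          ≡⟨ trans (cong (fromℕ 12 * L +_) (sym (suc*x 4 L))) (sym (fromℕ-+* 12 5 L)) ⟩
        fromℕ 17 * L ∎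

-- Auxiliary facts on subsets, filtered lists and powers of 8.

x∈p─q⇒x∉q : ∀ {n} (p q : Subset n) {x} → x ∈ p ─ q → x ∉ q
x∈p─q⇒x∉q (_ ∷ p) (outside ∷ q) (there x∈) (there x∈q) = x∈p─q⇒x∉q p q x∈ x∈q
x∈p─q⇒x∉q (_ ∷ p) (inside  ∷ q) (there x∈) (there x∈q) = x∈p─q⇒x∉q p q x∈ x∈q

module _ {A : Set} {P : A → Set} (P? : Decidable P) where

  head-filter-nothing : ∀ {xs} → head (filter P? xs) ≡ nothing → ∀ {y} → y ∈ₗ xs → ¬ P y
  head-filter-nothing {x ∷ xs} eq y∈ with P? x
  head-filter-nothing {x ∷ xs} eq (here refl) | no ¬p = ¬p
  head-filter-nothing {x ∷ xs} eq (there y∈)  | no ¬p = head-filter-nothing eq y∈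

  -- The parent `p i` is the head of a filtered list of types; because the list ascends, this head
  -- is the minimum in the definition of the parent.
  head-filter-just : ∀ {_≺_ : A → A → Set} {xs x} → AllPairs _≺_ xs → head (filter P? xs) ≡ just x →
                     P x × (∀ {y} → y ∈ₗ xs → P y → x ≡ y ⊎ x ≺ y)
  head-filter-just {xs = z ∷ xs} (z≺ ∷ xs≺) eq with P? z
  head-filter-just {xs = z ∷ xs} (z≺ ∷ xs≺) refl | yes p = p , λ
    { (here refl) _ → inj₁ refl
    ; (there y∈)  _ → inj₂ (All.lookup z≺ y∈) }
  ... | no ¬p with head-filter-just xs≺ eq
  ...   | px , first = px , λ
    { (here refl) p → contradiction p ¬p
    ; (there y∈)  p → first y∈ p }

module PowersProperties (𝔽 : OrderedField) where

  open OrderedField 𝔽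
  open OrderedFieldProperties 𝔽
  open import Data.Integer as ℤ using (+_; -[1+_])
  import Data.Integer.Properties as ℤ

  private b = fromℕ 8

  b-pos : 0# < b
  b-pos = fromℕ-suc-pos 7

  *-pos : ∀ {x y} → 0# < x → 0# < y → 0# < x * y
  *-pos {x} {y} 0<x 0<y = *-nonNeg (<⇒≤ 0<x) (<⇒≤ 0<y) , λ 0≡xy →
    <⇒≱ 0<y (*-cancelˡ-pos 0<x (≤-reflexive (trans (sym 0≡xy) (sym (zeroʳ x)))))

  ^-pos : ∀ n → 0# < b ^ n
  ^-pos zero    = 0≤1 , 0≢1
  ^-pos (suc n) = *-pos b-pos (^-pos n)

  ^ᶻ-nonNeg : ∀ e → 0# ≤ b ^ᶻ e
  ^ᶻ-nonNeg (+ n)    = <⇒≤ (^-pos n)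
  ^ᶻ-nonNeg -[1+ n ] = ⁻¹-nonNeg (^-pos (suc n))

  ⁻¹-unique : ∀ {x y} → 0# < x → x * y ≡ 1# → x ⁻¹ ≡ y
  ⁻¹-unique {x} {y} 0<x xy≡1 = trans (sym (*-identityʳ (x ⁻¹))) (trans (cong (x ⁻¹ *_) (sym xy≡1))
    (trans (sym (*-assoc (x ⁻¹) x y)) (trans (cong (_* y)
      (trans (*-comm (x ⁻¹) x) (⁻¹-inverseʳ x (pos⇒≢0 0<x)))) (*-identityˡ y))))

  ^ᶻ-suc : ∀ e → b ^ᶻ ℤ.suc e ≡ b * b ^ᶻ e
  ^ᶻ-suc (+ n)          = refl
  ^ᶻ-suc -[1+ zero ]    = sym (trans (cong (λ x → b * x ⁻¹) (*-identityʳ b)) (⁻¹-inverseʳ b (pos⇒≢0 b-pos)))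
  ^ᶻ-suc -[1+ suc n ]   = ⁻¹-unique (^-pos (suc n)) (trans
    (trans (sym (*-assoc x b _)) (cong (_* (b * x) ⁻¹) (*-comm x b)))
    (⁻¹-inverseʳ (b * x) (pos⇒≢0 (^-pos (suc (suc n))))))
    where x = b ^ suc n

  ^ᶻ-+ : ∀ e n → b ^ᶻ e ≤ b ^ᶻ (e ℤ.+ + n)
  ^ᶻ-+ e zero    = ≤-reflexive (cong (b ^ᶻ_) (sym (ℤ.+-identityʳ e)))
  ^ᶻ-+ e (suc n) = ≤-trans (^ᶻ-+ e n) (≤-trans (x≤suc*x 7 (^ᶻ-nonNeg (e ℤ.+ + n)))
    (≤-reflexive (trans (sym (^ᶻ-suc (e ℤ.+ + n))) (cong (b ^ᶻ_) (sym shift)))))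
    where
    shift : e ℤ.+ + suc n ≡ ℤ.suc (e ℤ.+ + n)
    shift = trans (sym (ℤ.+-assoc e (+ 1) (+ n))) (trans (cong (ℤ._+ + n) (ℤ.+-comm e (+ 1))) (ℤ.+-assoc (+ 1) e (+ n)))

  ^ᶻ-mono : ∀ {d e} → d ℤ.≤ e → b ^ᶻ d ≤ b ^ᶻ e
  ^ᶻ-mono {d} {e} d≤e = subst (λ k → b ^ᶻ d ≤ b ^ᶻ k) difference (^ᶻ-+ d ℤ.∣ e ℤ.- d ∣)
    where
    difference : d ℤ.+ + ℤ.∣ e ℤ.- d ∣ ≡ e
    difference = trans (cong (λ k → d ℤ.+ k) (ℤ.0≤i⇒+∣i∣≡i (ℤ.i≤j⇒0≤j-i d≤e)))
      (trans (cong (λ k → d ℤ.+ k) (ℤ.+-comm e (ℤ.- d))) (trans (sym (ℤ.+-assoc d (ℤ.- d) e))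
        (trans (cong (ℤ._+ e) (ℤ.+-inverseʳ d)) (ℤ.+-identityˡ e))))

  -- Powers are monotone in the exponent, so a smaller power has a smaller exponent, and integer
  -- exponents then differ by at least one.
  powers-gap : ∀ {x y d e} → x ≡ b ^ᶻ d → y ≡ b ^ᶻ e → x < y → b * x ≤ y
  powers-gap {d = d} {e} refl refl x<y with ℤ.suc d ℤ.≤? e
  ... | yes d<e = ≤-trans (≤-reflexive (sym (^ᶻ-suc d))) (^ᶻ-mono {ℤ.suc d} {e} d<e)
  ... | no  d≮e = contradiction (^ᶻ-mono {e} {d} (ℤ.≮⇒≥ λ d<e → d≮e (ℤ.i<j⇒suc[i]≤j d<e))) (<⇒≱ x<y)

-- The algorithm `ALG-offline` for rates that are powers of 8.

module OfflineProperties (𝔽 : OrderedField) (𝓘 : BSHM.Instance 𝔽) (powers : BSHM.PowersOf8 𝔽 𝓘) where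

  open OrderedField 𝔽
  open OrderedFieldProperties 𝔽
  open BSHM 𝔽
  open Scheduling 𝓘
  open SchedulingProperties 𝔽 𝓘
  open Offline 𝓘 hiding (≰⇒>)
  open DecMembership (Fin._≟_ {suc top}) using () renaming (_∈?_ to _∈ₗ?_)
  open ≤-Reasoning

  types : List Type
  types = allFin (suc top)

  open Weights 𝔽 𝓘 types

  ascending : AllPairs Fin._<_ types
  ascending = tabulate⁺-< id

  octupling : ∀ {y z} → y Fin.< z → fromℕ 8 * r y ≤ r z
  octupling {y} {z} y<z = PowersProperties.powers-gap 𝔽 {d = proj₁ (powers y)} {e = proj₁ (powers z)} (proj₂ (powers y)) (proj₂ (powers z)) (r-mono-< y<z)

  p-just : ∀ {i j} → p i ≡ just j → (i Fin.< j × ρ j < ρ i) × (∀ {y} → i Fin.< y → y Fin.< j → ρ i ≤ ρ y)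
  p-just {i} {j} eq with head-filter-just (λ j → (i Fin.<? j) ×-dec (ρ j <? ρ i)) ascending eq
  ... | pj , first = pj , between
    where
    between : ∀ {y} → i Fin.< y → y Fin.< j → ρ i ≤ ρ y
    between {y} i<y y<j with ρ i ≤? ρ y
    ... | yes le = le
    ... | no ρi≰ with first (∈-allFin y) (i<y , ≰⇒> ρi≰)
    ...   | inj₁ refl = contradiction y<j (Fin.<-irrefl refl)
    ...   | inj₂ j<y  = contradiction j<y (Fin.<-asym y<j)

  p-nothing : ∀ {i y} → p i ≡ nothing → i Fin.< y → ¬ ρ y < ρ i
  p-nothing {i} {y} eq i<y ρy< =
    head-filter-nothing (λ j → (i Fin.<? j) ×-dec (ρ j <? ρ i)) eq (∈-allFin y) (i<y , ρy<)

  -- With `path⁺` this characterises the ancestors of `i` as the strict record lows of `ρ` from `i`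
  -- upwards. From here on the tree is replaced by comparisons of `ρ`.
  path⁻ : ∀ fuel {i z} → z ∈ₗ path fuel i → ∀ {y} → i Fin.≤ y → y Fin.< z → ρ z < ρ y
  path⁻ (suc fuel) (here refl) i≤y y<i = contradiction i≤y (ℕ.<⇒≱ y<i)
  path⁻ (suc fuel) {i} {z} (there z∈) {y} i≤y y<z with p i in eq
  ... | just j with y Fin.<? j
  ...   | no  y≮j = path⁻ fuel z∈ (ℕ.≮⇒≥ y≮j) y<z
  ...   | yes y<j = <-≤-trans (≤-<-trans z≤j (proj₂ (proj₁ (p-just eq)))) i≤
    where
    z≤j : ρ z ≤ ρ j
    z≤j with j Fin.≟ z
    ... | yes refl = ≤-refl
    ... | no  j≢z  = <⇒≤ (path⁻ fuel z∈ ℕ.≤-refl (Fin.≤∧≢⇒< (path-≥ fuel j z∈) j≢z))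

    i≤ : ρ i ≤ ρ y
    i≤ with i Fin.≟ y
    ... | yes refl = ≤-refl
    ... | no  i≢y  = proj₂ (p-just eq) (Fin.≤∧≢⇒< i≤y i≢y) y<j

  -- Each step to a parent uses one unit of fuel and raises the index by at least one, which
  -- preserves the first hypothesis; so the fuel cannot run out below the largest type.
  path⁺ : ∀ fuel {i z} → suc top ℕ.≤ toℕ i ℕ.+ fuel → i Fin.≤ z →
          (∀ {y} → i Fin.≤ y → y Fin.< z → ρ z < ρ y) → z ∈ₗ path fuel i
  path⁺ zero {i} enough _ _ = contradiction (Fin.toℕ<n i)
    (ℕ.≤⇒≯ (subst (suc top ℕ.≤_) (ℕ.+-identityʳ (toℕ i)) enough))
  path⁺ (suc fuel) {i} {z} enough i≤z cheaper with i Fin.≟ z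
  ... | yes refl = here refl
  ... | no  i≢z with p i in eq
  ...   | nothing = contradiction (cheaper ℕ.≤-refl i<z) (p-nothing eq i<z)
    where
    i<z : i Fin.< z
    i<z = Fin.≤∧≢⇒< i≤z i≢z
  ...   | just j = there (path⁺ fuel
      (ℕ.≤-trans enough (ℕ.≤-trans (ℕ.≤-reflexive (ℕ.+-suc (toℕ i) fuel)) (ℕ.+-monoˡ-≤ fuel i<j)))
      j≤z λ j≤y → cheaper (ℕ.≤-trans (ℕ.<⇒≤ i<j) j≤y))
    where
    i<z : i Fin.< z
    i<z = Fin.≤∧≢⇒< i≤z i≢z

    i<j : i Fin.< j
    i<j = proj₁ (proj₁ (p-just eq))

    j≤z : j Fin.≤ z
    j≤z = ℕ.≮⇒≥ λ z<j → <⇒≱ (cheaper ℕ.≤-refl i<z) (proj₂ (p-just eq) i<z z<j)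

  -- The vertex just before `z` on the path: the child of `z` whose subtree contains `i`.
  child : ∀ fuel {i z} → z ∈ₗ path fuel i → i ≢ z → ∃ λ x → x ∈ₗ path fuel i × p x ≡ just z
  child (suc fuel) (here refl) i≢z = contradiction refl i≢z
  child (suc fuel) {i} {z} (there z∈) i≢z with p i in eq
  ... | just j with j Fin.≟ z
  ...   | yes refl = i , here refl , eq
  ...   | no  j≢z with child fuel z∈ j≢z
  ...     | x , x∈ , px = x , there x∈ , px

  ∈A⁻ : ∀ {i z} → z ∈ A i → i ∈ₗ P z
  ∈A⁻ {i} = ∈⟪⟫⁻ (λ z → i ∈ₗ? P z)

  ∈A⁺ : ∀ {i z} → i ∈ₗ P z → z ∈ A i
  ∈A⁺ {i} = ∈⟪⟫⁺ (λ z → i ∈ₗ? P z)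

  ∈f⁻ : ∀ {i z} → z ∈ f i → p z ≡ just i
  ∈f⁻ {i} = ∈⟪⟫⁻ (λ z → Maybe.≡-dec Fin._≟_ (p z) (just i))

  ∈f⁺ : ∀ {i z} → p z ≡ just i → z ∈ f i
  ∈f⁺ {i} = ∈⟪⟫⁺ (λ z → Maybe.≡-dec Fin._≟_ (p z) (just i))

  g-mono-≤ : ∀ {y z} → y Fin.≤ z → g y ≤ g z
  g-mono-≤ = mono-≤ g g-mono-<

  g≤previous : ∀ {y z} → y Fin.< z → g y ≤ previous 0# g z
  g≤previous {y} {suc z} y<z = g-mono-≤ (subst (toℕ y ℕ.≤_) (sym (Fin.toℕ-inject₁ z)) (ℕ.s≤s⁻¹ y<z))

  fits⇒m≤ : ∀ {J y} → s J ≤ g y → m J Fin.≤ y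
  fits⇒m≤ {J} {y} fits = ℕ.≮⇒≥ λ y<m →
    <⇒≱ (proj₁ (proj₂ (typeOf J))) (≤-trans fits (g≤previous y<m))

  m≤⇒fits : ∀ {J y} → m J Fin.≤ y → s J ≤ g y
  m≤⇒fits {J} m≤y = ≤-trans (proj₂ (proj₂ (typeOf J))) (g-mono-≤ m≤y)

  -- The types that a job fits are those from `m J` on, so being a record low from `m J` on is
  -- exactly `Eligible`.
  R⁻ : ∀ {z J} → J ∈ R z → Eligible z J
  R⁻ {z} {J} J∈ = m≤⇒fits (path-≥ (suc top) (m J) z∈P) , λ _ y<z fits → path⁻ (suc top) z∈P (fits⇒m≤ fits) y<z
    where
    z∈P : z ∈ₗ P (m J)
    z∈P = ∈A⁻ (∈⟪⟫⁻ (λ J → m J ∈? A z) J∈)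

  R⁺ : ∀ {z J} → Eligible z J → J ∈ R z
  R⁺ {z} {J} (fits , cheaper) = ∈⟪⟫⁺ (λ J → m J ∈? A z) (∈A⁺ (path⁺ (suc top)
    (ℕ.m≤n+m (suc top) (toℕ (m J))) (fits⇒m≤ fits) λ m≤y y<z → cheaper (∈-allFin _) y<z (m≤⇒fits m≤y)))

  larger : Type → Subset n
  larger z = taken (toℕ (opposite z)) (ℕ.<⇒≤ (Fin.toℕ<n (opposite z)))

  opposite-fromℕ< : ∀ {d} .(d< : d ℕ.< suc top) → toℕ (opposite (opposite (fromℕ< d<))) ≡ d
  opposite-fromℕ< d< = trans (cong toℕ (Fin.opposite-involutive (fromℕ< d<))) (Fin.toℕ-fromℕ< d<)

  -- Stage `d` of `taken` treats the type with exactly `d` larger ones, and `K` of that type is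
  -- defined from the same stage; only the two descriptions of the number `d` have to be identified.
  selected≡K : ∀ {d} .(d< : d ℕ.< suc top) .(d≤ : d ℕ.≤ suc top) →
               Iteration.selected (opposite (fromℕ< d<)) (taken d d≤) ≡ K (opposite (fromℕ< d<))
  selected≡K d< d≤ = cong (Iteration.selected (opposite (fromℕ< d<))) (taken-cong (sym (opposite-fromℕ< d<)))

  taken⁻ : ∀ d .(d≤ : d ℕ.≤ suc top) {J} → J ∈ taken d d≤ → ∃ λ y → toℕ (opposite y) ℕ.< d × J ∈ K y
  taken⁻ zero    _  J∈ = contradiction J∈ ∉⊥
  taken⁻ (suc d) d< {J} J∈ = split (x∈p∪q⁻ T (Iteration.selected z T) J∈)
    where
    z : Type
    z = opposite (fromℕ< d<)

    T : Subset n
    T = taken d (ℕ.<⇒≤ d<)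

    split : J ∈ T ⊎ J ∈ Iteration.selected z T → ∃ λ y → toℕ (opposite y) ℕ.< suc d × J ∈ K y
    split (inj₁ J∈T) = let y , y< , J∈K = taken⁻ d (ℕ.<⇒≤ d<) J∈T in y , ℕ.m<n⇒m<1+n y< , J∈K
    split (inj₂ J∈s) = z , ℕ.≤-reflexive (cong suc (opposite-fromℕ< d<)) ,
      subst (J ∈_) (selected≡K d< (ℕ.<⇒≤ d<)) J∈s

  taken⁺ : ∀ d .(d≤ : d ℕ.≤ suc top) {y J} → toℕ (opposite y) ℕ.< d → J ∈ K y → J ∈ taken d d≤
  taken⁺ (suc d) d< {y} {J} y< J∈K = split (toℕ (opposite y) ℕ.≟ d)
    where
    z : Type
    z = opposite (fromℕ< d<)

    T : Subset n
    T = taken d (ℕ.<⇒≤ d<)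

    split : Dec (toℕ (opposite y) ≡ d) → J ∈ T ∪ Iteration.selected z T
    split (no  ≢d) = x∈p∪q⁺ {p = T} {q = Iteration.selected z T}
      (inj₁ (taken⁺ d (ℕ.<⇒≤ d<) (ℕ.≤∧≢⇒< (ℕ.s≤s⁻¹ y<) ≢d) J∈K))
    split (yes ≡d) = x∈p∪q⁺ {p = T} {q = Iteration.selected z T}
      (inj₂ (subst (J ∈_) (sym (selected≡K d< (ℕ.<⇒≤ d<))) (subst (λ y → J ∈ K y) (sym z≡y) J∈K)))
      where
      z≡y : z ≡ y
      z≡y = trans (cong opposite (Fin.toℕ-injective (trans (Fin.toℕ-fromℕ< d<) (sym ≡d)))) (Fin.opposite-involutive y)

  opposite-anti : ∀ {y z : Type} → z Fin.< y → toℕ (opposite y) ℕ.< toℕ (opposite z)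
  opposite-anti {y} {z} z<y = subst₂ ℕ._<_ (sym (Fin.opposite-prop y)) (sym (Fin.opposite-prop z))
    (ℕ.∸-monoʳ-< z<y (ℕ.s≤s⁻¹ (Fin.toℕ<n y)))

  opposite-anti⁻ : ∀ {y z : Type} → toℕ (opposite y) ℕ.< toℕ (opposite z) → z Fin.< y
  opposite-anti⁻ {y} {z} lt with Fin.<-cmp z y
  ... | tri< z<y _ _ = z<y
  ... | tri≈ _ refl _ = contradiction lt (ℕ.<-irrefl refl)
  ... | tri> _ _ y<z = contradiction (opposite-anti y<z) (ℕ.<-asym lt)

  module AtType (z : Type) where

    open Iteration z (larger z) hiding (≤-<-trans; <-≤-trans; <-irrefl)

    𝓡⁻′ : ∀ {J} → J ∈ 𝓡 → Eligible z J × (∀ {y} → y ∈ₗ types → z Fin.< y → J ∉ K y)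
    𝓡⁻′ J∈ = R⁻ (p─q⊆p (R z) (larger z) J∈) , λ _ z<y J∈K →
      x∈p─q⇒x∉q (R z) (larger z) J∈ (taken⁺ (toℕ (opposite z)) _ (opposite-anti z<y) J∈K)

    𝓡⁺′ : ∀ {J} → Eligible z J → (∀ {y} → y ∈ₗ types → z Fin.< y → J ∉ K y) → J ∈ 𝓡
    𝓡⁺′ {J} el none = x∈p∧x∉q⇒x∈p─q (R⁺ el) λ J∈ → let y , y< , J∈K = taken⁻ (toℕ (opposite z)) _ J∈ in
      none (∈-allFin y) (opposite-anti⁻ y<) J∈K

    ∈𝓡ʰ⁺ : ∀ {J} → J ∈ 𝓡 → m J ≡ z → J ∈ 𝓡ʰ
    ∈𝓡ʰ⁺ J∈ m≡z = x∈p∩q⁺ (J∈ , ∈⟪⟫⁺ (λ J → m J Fin.≟ z) m≡z)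

    ∈𝓡ʰ⁻ : ∀ {J} → J ∈ 𝓡ʰ → J ∈ 𝓡 × m J ≡ z
    ∈𝓡ʰ⁻ {J} J∈ = proj₁ (x∈p∩q⁻ 𝓡 _ J∈) , ∈⟪⟫⁻ (λ J → m J Fin.≟ z) (proj₂ (x∈p∩q⁻ 𝓡 _ J∈))

    ∈F⁻ : ∀ {x t J} → J ∈ F x t → J ∈ 𝓡 × t ∈I J × x ∈ₗ P (m J)
    ∈F⁻ {x} {t} {J} J∈ = let J∈𝓡t , J∈A = x∈p∩q⁻ (𝓡 at t) _ J∈ in proj₁ (∈at⁻ {𝓡} J∈𝓡t) , proj₂ (∈at⁻ {𝓡} J∈𝓡t) , ∈A⁻ (∈⟪⟫⁻ (λ J → m J ∈? A x) J∈A)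

    ∈F⁺ : ∀ {x t J} → J ∈ 𝓡 → t ∈I J → x ∈ₗ P (m J) → J ∈ F x t
    ∈F⁺ {x} J∈ t∈ x∈ = x∈p∩q⁺ (∈at⁺ {𝓡} J∈ t∈ , ∈⟪⟫⁺ (λ J → m J ∈? A x) (∈A⁺ x∈))

    -- What `c` would be without its ceilings.
    fractional : Carrier → Carrier
    fractional t = Σᴸ types λ x → when (x ∈? f z) (ρ x * S (F x t))

    swapped : ∀ t → fractional t ≡ ΣJ λ J → Σᴸ types λ x → when ((x ∈? f z) ×-dec (J ∈? F x t)) (s J * ρ x)
    swapped t = trans (Σ-cong types λ x → expand x (x ∈? f z)) (Σ-swap types (allFin n) _)
      where
      expand : ∀ x {Q : Set} (d : Dec Q) →
               when d (ρ x * S (F x t)) ≡ ΣJ λ J → when (d ×-dec (J ∈? F x t)) (s J * ρ x)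
      expand x (no _)  = sym (Σ-0 (allFin n) λ _ → refl)
      expand x (yes _) = trans (cong (ρ x *_) (S≡ (F x t))) (trans (sym (Σ-* (allFin n) (ρ x) _))
        (Σ-cong (allFin n) λ J → trans (*-when (J ∈? F x t)) (cong (when (J ∈? F x t)) (*-comm (ρ x) (s J)))))

    child-< : ∀ {x} → x ∈ f z → x Fin.< z
    child-< x∈ = proj₁ (proj₁ (p-just (∈f⁻ x∈)))

    -- Among the types below `z` that the job fits, its child `x` of `z` is cheapest per unit: those
    -- before `x` are dearer because `x` is a record low, those between `x` and `z` because `z` is
    -- the parent of `x`.
    weight≥ : ∀ {x J} → x ∈ f z → x ∈ₗ P (m J) → s J * ρ x ≤ weight z J
    weight≥ {x} {J} x∈f x∈P = ≤cheapest z J {types}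
      (≤-trans (*-monoʳ-≤ (ρ-nonNeg x) (m≤⇒fits (path-≥ (suc top) (m J) x∈P)))
        (≤-trans (≤-reflexive (trans (*-comm (g x) (ρ x)) (ρ*g x))) (<⇒≤ (r-mono-< (child-< x∈f)))))
      λ {y} _ y<z fits → *-monoˡ-≤ (s-nonNeg J) (cheaper y<z (fits⇒m≤ fits))
      where
      cheaper : ∀ {y} → y Fin.< z → m J Fin.≤ y → ρ x ≤ ρ y
      cheaper {y} y<z m≤y with Fin.<-cmp y x
      ... | tri< y<x _ _  = <⇒≤ (path⁻ (suc top) x∈P m≤y y<x)
      ... | tri≈ _ refl _ = ≤-refl
      ... | tri> _ _ x<y  = proj₂ (p-just (∈f⁻ x∈f)) x<y y<z

    one-child : ∀ {x y J} → x ∈ f z → y ∈ f z → x ∈ₗ P (m J) → y ∈ₗ P (m J) → x ≡ y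
    one-child {x} {y} {J} x∈f y∈f x∈P y∈P with Fin.<-cmp x y
    ... | tri≈ _ x≡y _ = x≡y
    ... | tri< x<y _ _ = contradiction (proj₂ (p-just (∈f⁻ x∈f)) x<y (child-< y∈f))
      (<⇒≱ (path⁻ (suc top) y∈P (path-≥ (suc top) (m J) x∈P) x<y))
    ... | tri> _ _ y<x = contradiction (proj₂ (p-just (∈f⁻ y∈f)) y<x (child-< x∈f))
      (<⇒≱ (path⁻ (suc top) x∈P (path-≥ (suc top) (m J) y∈P) y<x))

    fractional≤load : ∀ t → fractional t ≤ ΣJ (λ J → when (J ∈? (𝓡 at t)) (weight z J))
    fractional≤load t = ≤-trans (≤-reflexive (swapped t)) (Σ-mono (allFin n) λ J →
      Σ-atMostOne (λ x → (x ∈? f z) ×-dec (J ∈? F x t)) (allFin⁺ (suc top))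
        (when-nonNeg (J ∈? (𝓡 at t)) (weight-nonNeg z J))
        (λ {x} {y} _ _ (x∈ , J∈x) (y∈ , J∈y) →
          one-child {x} {y} {J} x∈ y∈ (proj₂ (proj₂ (∈F⁻ {x} J∈x))) (proj₂ (proj₂ (∈F⁻ {y} J∈y))))
        λ {x} _ (x∈ , J∈x) → let J∈𝓡 , t∈ , x∈P = ∈F⁻ {x} J∈x in
          ≤-trans (weight≥ {J = J} x∈ x∈P) (≤-reflexive (sym (when-yes (J ∈? (𝓡 at t)) (∈at⁺ {𝓡} J∈𝓡 t∈)))))

    c≡ : ∀ t → c t ≡ Σᴸ types λ x → when (x ∈? f z) (fromℕ ⌈ S (F x t) / g x ⌉ * r x)
    c≡ t = sum≡Σ (λ x → when (x ∈? f z) (fromℕ ⌈ S (F x t) / g x ⌉ * r x))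

    ρS≡ : ∀ x t → ρ x * S (F x t) ≡ (S (F x t) / g x) * r x
    ρS≡ x t = solve 3 (λ a b c → (c :* b) :* a := (a :* b) :* c) refl (S (F x t)) (g x ⁻¹) (r x)

    fractional≤c : ∀ t → fractional t ≤ c t
    fractional≤c t = ≤-trans (Σ-mono types λ x → when-mono (x ∈? f z) (x ∈? f z)
      (*-nonNeg (fromℕ-nonNeg ⌈ S (F x t) / g x ⌉) (r-nonNeg x)) λ x∈ → x∈ ,
        ≤-trans (≤-reflexive (ρS≡ x t)) (*-monoʳ-≤ (r-nonNeg x) (≤⌈⌉ _)))
      (≤-reflexive (sym (c≡ t)))

    children-rate : Carrier
    children-rate = Σᴸ types λ x → when (x ∈? f z) (r x)

    -- Children precede `z`, so their rates are at most `r z` / 8 and differ pairwise by factors of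
    -- at least 8; 1/8 + 1/64 + ... = 1/7.
    children-rate≤ : fromℕ 7 * children-rate ≤ r z
    children-rate≤ = ≤-trans (n*-mono 7 (Σ-mono types λ x → when-mono (x ∈? f z) (r x ≤? r z / fromℕ 8) (r-nonNeg x)
        λ x∈ → *≤⇒≤/ 8-pos (≤-trans (≤-reflexive (*-comm (r x) (fromℕ 8))) (octupling (child-< x∈))) , ≤-refl))
      (≤-trans (geometric r 7 r-nonNeg (/-nonNeg (r-nonNeg z) 8-pos) (tabulate⁺-< octupling))
        (≤-reflexive (trans (*-comm (fromℕ 8) _) (/-* (r z) 8-pos))))
      where
      8-pos : 0# < fromℕ 8
      8-pos = fromℕ-suc-pos 7

    c≤ : ∀ t → c t ≤ children-rate + fractional t
    c≤ t = begin
      c t ≡⟨ c≡ t ⟩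
      Σᴸ types (λ x → when (x ∈? f z) (fromℕ ⌈ S (F x t) / g x ⌉ * r x))
        ≤⟨ Σ-mono types (λ x → bound x (x ∈? f z)) ⟩
      Σᴸ types (λ x → when (x ∈? f z) (r x) + when (x ∈? f z) (ρ x * S (F x t)))
        ≡⟨ Σ-+ types _ _ ⟩
      children-rate + fractional t ∎
      where
      bound : ∀ x {Q : Set} (d : Dec Q) →
              when d (fromℕ ⌈ S (F x t) / g x ⌉ * r x) ≤ when d (r x) + when d (ρ x * S (F x t))
      bound x (no _)  = ≤-reflexive (sym (+-identityˡ 0#))
      bound x (yes _) = ≤-trans (*-monoʳ-≤ (r-nonNeg x) (⌈⌉≤ (/-nonNeg (S-nonNeg (F x t)) (g-positive x))))
        (≤-reflexive (trans (distribʳ (r x) _ 1#) (trans (+-comm _ _)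
          (cong₂ _+_ (*-identityˡ (r x)) (sym (ρS≡ x t))))))

    load′ : Carrier → Carrier
    load′ = load (λ _ → 𝓡) z

    load′-nonNeg : ∀ t → 0# ≤ load′ t
    load′-nonNeg = load-nonNeg (λ _ → 𝓡) z

    -- An active job with `m J ≡ z` fits no smaller type and weighs `r z` by itself. In the other
    -- case r/3 ≤ c ≤ r/7 + load leaves 4/21 of `r z` for the load; 21 is then rounded up to 24 = 4
    -- · 6.
    𝓣-heavy : ∀ {t} → 𝓣 t → r z ≤ fromℕ 6 * load′ t
    𝓣-heavy {t} (inj₁ (J , J∈)) = ≤-trans (≤-trans r≤weight (≤-trans
        (≤-reflexive (sym (when-yes (J ∈? (𝓡 at t)) (∈at⁺ {𝓡} J∈𝓡 (proj₂ (∈at⁻ {𝓡ʰ} J∈))))))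
        (Σ-∈ (λ J → when-nonNeg (J ∈? (𝓡 at t)) (weight-nonNeg z J)) (∈-allFin J))))
      (x≤suc*x 5 (load′-nonNeg t))
      where
      J∈𝓡 : J ∈ 𝓡
      J∈𝓡 = proj₁ (∈𝓡ʰ⁻ (proj₁ (∈at⁻ {𝓡ʰ} J∈)))

      r≤weight : r z ≤ weight z J
      r≤weight = ≤cheapest z J {types} ≤-refl λ _ y<z fits → contradiction
        (subst (Fin._≤ _) (proj₂ (∈𝓡ʰ⁻ (proj₁ (∈at⁻ {𝓡ʰ} J∈)))) (fits⇒m≤ fits)) (ℕ.<⇒≱ y<z)
    𝓣-heavy {t} (inj₂ r/3≤c) = *-cancelˡ-pos (fromℕ-suc-pos 3) (+-cancelˡ-≤ (fromℕ 3 * r z) (begin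
        fromℕ 3 * r z + fromℕ 4 * r z  ≡⟨ fromℕ-+* 3 4 (r z) ⟨
        fromℕ 7 * r z                  ≤⟨ n*-mono 7 (≤-trans (*≤ r/3≤c) (n*-mono 3 (c≤ t))) ⟩
        fromℕ 7 * (fromℕ 3 * (children-rate + fractional t))
          ≡⟨ trans (sym (fromℕ-*-assoc 7 3 _)) (distribˡ (fromℕ 21) children-rate (fractional t)) ⟩
        fromℕ 21 * children-rate + fromℕ 21 * fractional t
          ≡⟨ cong (_+ fromℕ 21 * fractional t) (fromℕ-*-assoc 3 7 children-rate) ⟩
        fromℕ 3 * (fromℕ 7 * children-rate) + fromℕ 21 * fractional t
          ≤⟨ +-mono-≤ (n*-mono 3 children-rate≤) (≤-trans (n*-mono 21 (fractional≤load t))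
               (n*-weaken (ℕ.m≤m+n 21 3) (load′-nonNeg t))) ⟩
        fromℕ 3 * r z + fromℕ 24 * load′ t
          ≡⟨ cong (λ x → fromℕ 3 * r z + x) (fromℕ-*-assoc 4 6 (load′ t)) ⟩
        fromℕ 3 * r z + fromℕ 4 * (fromℕ 6 * load′ t) ∎))
      where
      *≤ : r z / fromℕ 3 ≤ c t → r z ≤ fromℕ 3 * c t
      *≤ le = subst (_≤ fromℕ 3 * c t) (trans (*-comm (fromℕ 3) _) (/-* (r z) (fromℕ-suc-pos 2))) (n*-mono 3 le)

    -- With no job of class `z` active, every active job of `𝓡` lies below some child of `z`, where
    -- its share in `fractional` is at least its weight.
    ¬𝓣-light : ∀ {t} → ¬ 𝓣 t → load′ t ≤ r z
    ¬𝓣-light {t} ¬𝓣 = begin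
      load′ t ≤⟨ Σ-mono (allFin n) own ⟩
      (ΣJ λ J → Σᴸ types λ x → when ((x ∈? f z) ×-dec (J ∈? F x t)) (s J * ρ x)) ≡⟨ swapped t ⟨
      fractional t ≤⟨ fractional≤c t ⟩
      c t          ≤⟨ ≰⇒≥ (¬𝓣 ∘ inj₂) ⟩
      r z / fromℕ 3 ≤⟨ subst (r z / fromℕ 3 ≤_) (trans (*-comm (fromℕ 3) _) (/-* (r z) (fromℕ-suc-pos 2)))
                        (x≤suc*x 2 (/-nonNeg (r-nonNeg z) (fromℕ-suc-pos 2))) ⟩
      r z ∎
      where
      own : ∀ J → when (J ∈? (𝓡 at t)) (weight z J) ≤
            Σᴸ types λ x → when ((x ∈? f z) ×-dec (J ∈? F x t)) (s J * ρ x)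
      own J = when-≤ (J ∈? (𝓡 at t))
        (Σ-nonNeg types λ x → when-nonNeg ((x ∈? f z) ×-dec (J ∈? F x t)) (*-nonNeg (s-nonNeg J) (ρ-nonNeg x)))
        λ J∈ → split (∈at⁻ {𝓡} J∈)
        where
        split : J ∈ 𝓡 × t ∈I J → weight z J ≤
                Σᴸ types λ x → when ((x ∈? f z) ×-dec (J ∈? F x t)) (s J * ρ x)
        split (J∈ , t∈) with child (suc top) (∈A⁻ (∈⟪⟫⁻ (λ J → m J ∈? A z) (p─q⊆p (R z) (larger z) J∈)))
                                  (λ m≡z → ¬𝓣 (inj₁ (J , ∈at⁺ {𝓡ʰ} (∈𝓡ʰ⁺ J∈ m≡z) t∈)))
        ... | x , x∈P , px = Σ-atLeastOne (λ x → (x ∈? f z) ×-dec (J ∈? F x t))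
          (λ x → *-nonNeg (s-nonNeg J) (ρ-nonNeg x)) (∈-allFin x) (∈f⁺ px , ∈F⁺ J∈ t∈ x∈P)
          (cheapest≤ z J {types} (∈-allFin x) (child-< (∈f⁺ px)) (m≤⇒fits (path-≥ (suc top) (m J) x∈P)))

    byLoad : Subset n
    byLoad = (𝓡 ─ 𝓡ʰ) ∩ ⟪ I⊆𝓣? ⟫

    -- A job of `𝓡ʰ` also runs within `𝓣`, as it contributes to the span itself. So `K z` is
    -- uniformly the set of jobs of `𝓡` with interval in `𝓣`.
    K⁻ : ∀ {J} → J ∈ K z → J ∈ 𝓡 × I⊆𝓣 J
    K⁻ {J} J∈ = split (x∈p∪q⁻ 𝓡ʰ byLoad J∈)
      where
      split : J ∈ 𝓡ʰ ⊎ J ∈ byLoad → J ∈ 𝓡 × I⊆𝓣 J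
      split (inj₁ J∈ʰ) = proj₁ (∈𝓡ʰ⁻ J∈ʰ) , λ t t∈ → inj₁ (J , ∈at⁺ {𝓡ʰ} J∈ʰ t∈)
      split (inj₂ J∈ᵗ) = p─q⊆p 𝓡 𝓡ʰ (proj₁ (x∈p∩q⁻ (𝓡 ─ 𝓡ʰ) ⟪ I⊆𝓣? ⟫ J∈ᵗ)) ,
        ∈⟪⟫⁻ I⊆𝓣? (proj₂ (x∈p∩q⁻ (𝓡 ─ 𝓡ʰ) ⟪ I⊆𝓣? ⟫ J∈ᵗ))

    K⁺ : ∀ {J} → J ∈ 𝓡 → I⊆𝓣 J → J ∈ K z
    K⁺ {J} J∈ I⊆ = split (J ∈? 𝓡ʰ)
      where
      split : Dec (J ∈ 𝓡ʰ) → J ∈ 𝓡ʰ ∪ byLoad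
      split (yes J∈ʰ) = x∈p∪q⁺ {p = 𝓡ʰ} {q = byLoad} (inj₁ J∈ʰ)
      split (no  J∉ʰ) = x∈p∪q⁺ {p = 𝓡ʰ} {q = byLoad} (inj₂ (x∈p∩q⁺ {p = 𝓡 ─ 𝓡ʰ} {q = ⟪ I⊆𝓣? ⟫}
        (x∈p∧x∉q⇒x∈p─q {p = 𝓡} J∈ J∉ʰ , ∈⟪⟫⁺ I⊆𝓣? I⊆)))

    -- A negated universal statement over all times has to yield a witness. Since `𝓣` depends only
    -- on the active jobs, a finite search through the endpoints finds one.
    escape : ∀ {J} → J ∈ 𝓡 → J ∉ K z → ∃ λ u → u ∈I J × ¬ 𝓣 u
    escape {J} J∈ J∉ = search (Any.any? (λ e → (e ∈I? J) ×-dec ¬? (𝓣? e)) endpoints)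
      where
      endpoint : ∀ {e} → e ≡ I⁻ J ⊎ e ∈ₗ endpoints → e ∈ₗ endpoints
      endpoint (inj₁ refl) = ∈-++⁺ˡ (∈-tabulate⁺ {f = I⁻} J)
      endpoint (inj₂ i)    = i

      search : Dec (Any.Any (λ e → e ∈I J × ¬ 𝓣 e) endpoints) → ∃ λ u → u ∈I J × ¬ 𝓣 u
      search (yes found) = Any.satisfied found
      search (no  none)  = contradiction (K⁺ J∈ I⊆) J∉
        where
        I⊆ : I⊆𝓣 J
        I⊆ t (a≤t , t<b) = let e , a≤e , e∈ , last = lastBefore endpoints t (I⁻ J) a≤t in
          𝓣-active (same-active last) (decidable-stable (𝓣? e) λ ¬𝓣 →
            none (Any.map (λ { refl → (a≤e , ≤-<-trans (proj₁ last) t<b) , ¬𝓣 }) (endpoint e∈)))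

  topDown : TopDown
  topDown = record
    { K     = K
    ; 𝓡     = λ z → Iteration.𝓡 z (larger z)
    ; 𝓡⁻    = λ {z} _ → AtType.𝓡⁻′ z
    ; 𝓡⁺    = λ {z} _ → AtType.𝓡⁺′ z
    ; K⊆𝓡   = λ {z} _ → proj₁ ∘ AtType.K⁻ z
    ; heavy = λ {z} _ J∈ t∈ → AtType.𝓣-heavy z (proj₂ (AtType.K⁻ z J∈) _ t∈)
    ; light = λ {z} _ J∈ J∉ → let u , u∈ , ¬𝓣 = AtType.escape z J∈ J∉ in u , u∈ , AtType.¬𝓣-light z ¬𝓣
    }

  module _ (dc : DualColouring) where

    open Colouring dc types K (λ z J∈ → R-fits z (K⊆R z J∈)) machineType (λ J → ∈-allFin (machineType J))
                   (λ J → proj₂ (covered J))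

    -- `schedule` unfolds to `ALG-offline dc`. The pointwise constant is 68, which is then relaxed
    -- to 180.
    ALG-offline-approximates : ALG-offline dc CostsAtMost 180 ×OPT
    ALG-offline-approximates = approximates 180 schedule-feasible λ σ feas t → begin
      rate schedule t ≤⟨ rate-schedule t ⟩
      fromℕ 4 * Σᴸ types (λ z → fromℕ (machines z t) * r z)
        ≤⟨ n*-mono 4 (Analysis.AtTime.machines≤ ascending (tabulate⁺-< λ y<z →
             ≤-trans (n*-weaken (ℕ.m≤m+n 2 6) (r-nonNeg _)) (octupling y<z)) topDown t (rate σ t) (rate-nonNeg σ t)
             (proj₁ ∘ σ) (λ J → ∈-allFin _) (fits-on feas) (λ J → r≤rate σ) (load≤rate feas t)) ⟩
      fromℕ 4 * (fromℕ 17 * rate σ t) ≡⟨ fromℕ-*-assoc 4 17 (rate σ t) ⟨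
      fromℕ 68 * rate σ t             ≤⟨ n*-weaken (ℕ.m≤m+n 68 112) (rate-nonNeg σ t) ⟩
      fromℕ 180 * rate σ t            ∎

-- Boolean tests that programs can evaluate.

does⁻ : ∀ {P : Set} (d : Dec P) → does d ≡ true → P
does⁻ (yes p) _ = p

does⁻¬ : ∀ {P : Set} (d : Dec P) → does d ≡ false → ¬ P
does⁻¬ (no ¬p) _ = ¬p

∧⁻ : ∀ {a b} → a ∧ b ≡ true → a ≡ true × b ≡ true
∧⁻ {true} {true} _ = refl , refl

∧⁺ : ∀ {a b} → a ≡ true → b ≡ true → a ∧ b ≡ true
∧⁺ refl refl = refl

not⁻ : ∀ {a} → not a ≡ true → a ≡ false
not⁻ {false} _ = refl

-- Implication is spelled `not (a ∧ not b)`, since conjunction and negation are the connectives that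
-- get programs.
implies⁺ : ∀ {a b} → (a ≡ true → b ≡ true) → not (a ∧ not b) ≡ true
implies⁺ {false}        _ = refl
implies⁺ {true} {true}  _ = refl
implies⁺ {true} {false} h = h refl

implies⁻ : ∀ {a b} → not (a ∧ not b) ≡ true → a ≡ true → b ≡ true
implies⁻ {true} {true} _ _ = refl

implies-false : ∀ {a b} → not (a ∧ not b) ≡ false → a ≡ true × b ≡ false
implies-false {true} {false} _ = refl , refl

≡true-cong : ∀ {a b} → (a ≡ true → b ≡ true) → (b ≡ true → a ≡ true) → a ≡ b
≡true-cong {true}  {b}     f g = sym (f refl)
≡true-cong {false} {false} f g = refl
≡true-cong {false} {true}  f g = g refl

module _ {A : Set} (p : A → Bool) where

  allᵇ : List A → Bool
  allᵇ = List.foldr (λ a b → p a ∧ b) true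

  allᵇ⁻ : ∀ {xs} → allᵇ xs ≡ true → ∀ {x} → x ∈ₗ xs → p x ≡ true
  allᵇ⁻ {_ ∷ xs} eq (here refl) = proj₁ (∧⁻ eq)
  allᵇ⁻ {_ ∷ xs} eq (there x∈)  = allᵇ⁻ (proj₂ (∧⁻ eq)) x∈

  allᵇ⁺ : ∀ {xs} → (∀ {x} → x ∈ₗ xs → p x ≡ true) → allᵇ xs ≡ true
  allᵇ⁺ {[]}     _ = refl
  allᵇ⁺ {_ ∷ xs} h = ∧⁺ (h (here refl)) (allᵇ⁺ (h ∘ there))

  allᵇ-false : ∀ {xs} → allᵇ xs ≡ false → ∃ λ x → x ∈ₗ xs × p x ≡ false
  allᵇ-false {x ∷ xs} eq with p x in px
  ... | true  = let y , y∈ , py = allᵇ-false {xs} eq in y , there y∈ , py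
  ... | false = x , here refl , px

-- The algorithm for arbitrary rates.

module Approximation (𝔽 : OrderedField) (𝓘 : BSHM.Instance 𝔽) where

  open OrderedField 𝔽
  open OrderedFieldProperties 𝔽
  open BSHM 𝔽
  open Scheduling 𝓘
  open SchedulingProperties 𝔽 𝓘
  open ≤-Reasoning
  open DecMembership (Fin._≟_ {suc top}) using () renaming (_∈?_ to _∈ₗ?_)

  twiceBelow : Type → Type → Bool
  twiceBelow z k = does (r z + r z ≤? r k)

  -- Larger types are decided first, so the largest is always kept and every job still fits some
  -- kept type.
  keep : Type → List Type → List Type
  keep z ks = if allᵇ (twiceBelow z) ks then z ∷ ks else ks

  thin : List Type → List Type
  thin = List.foldr keep []

  kept : List Type
  kept = thin (allFin (suc top))

  keep-All : ∀ {P : Type → Set} {z ks} → P z → All P ks → All P (keep z ks)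
  keep-All {z = z} {ks} p ps with allᵇ (twiceBelow z) ks
  ... | true  = p ∷ ps
  ... | false = ps

  thin-All : ∀ {P : Type → Set} {zs} → All P zs → All P (thin zs)
  thin-All []       = []
  thin-All (p ∷ ps) = keep-All p (thin-All ps)

  keep-AllPairs : ∀ {_≺_ : Type → Type → Set} {z ks} → (allᵇ (twiceBelow z) ks ≡ true → All (z ≺_) ks) →
                  AllPairs _≺_ ks → AllPairs _≺_ (keep z ks)
  keep-AllPairs {z = z} {ks} z≺ ks≺ with allᵇ (twiceBelow z) ks
  ... | true  = z≺ refl ∷ ks≺
  ... | false = ks≺

  thin-ascending : ∀ {zs} → AllPairs Fin._<_ zs → AllPairs Fin._<_ (thin zs)
  thin-ascending []         = []
  thin-ascending (z< ∷ zs<) = keep-AllPairs (λ _ → thin-All z<) (thin-ascending zs<)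

  thin-doubling : ∀ zs → AllPairs (λ y z → fromℕ 2 * r y ≤ r z) (thin zs)
  thin-doubling []       = []
  thin-doubling (z ∷ zs) = keep-AllPairs (λ below → All.tabulate λ {k} k∈ →
      ≤-trans (≤-reflexive (2*x (r z))) (does⁻ (r z + r z ≤? r k) (allᵇ⁻ (twiceBelow z) below k∈)))
    (thin-doubling zs)

  -- A type is dropped only because of a kept larger type of at most twice its rate, which can stand
  -- in for it.
  thin-covers : ∀ {zs} → AllPairs Fin._<_ zs → ∀ {y} → y ∈ₗ zs →
                ∃ λ k → k ∈ₗ thin zs × y Fin.≤ k × r k ≤ fromℕ 2 * r y
  thin-covers {z ∷ zs} (z< ∷ _) (here refl) with allᵇ (twiceBelow z) (thin zs) in below
  ... | true  = z , here refl , ℕ.≤-refl , x≤suc*x 1 (r-nonNeg z)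
  ... | false = let k , k∈ , ≰r = allᵇ-false (twiceBelow z) {thin zs} below in
    k , k∈ , ℕ.<⇒≤ (All.lookup (thin-All z<) k∈) ,
    ≤-trans (≰⇒≥ (does⁻¬ (r z + r z ≤? r k) ≰r)) (≤-reflexive (sym (2*x (r z))))
  thin-covers {z ∷ zs} (_ ∷ zs<) (there y∈) with thin-covers zs< y∈
  ... | k , k∈ , p with allᵇ (twiceBelow z) (thin zs)
  ...   | true  = k , there k∈ , p
  ...   | false = k , k∈ , p

  ascending : AllPairs Fin._<_ kept
  ascending = thin-ascending (tabulate⁺-< id)

  cover : ∀ y → ∃ λ k → k ∈ₗ kept × y Fin.≤ k × r k ≤ fromℕ 2 * r y
  cover y = thin-covers (tabulate⁺-< id) (∈-allFin y)

  open Weights 𝔽 𝓘 kept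

  Status : Set
  Status = Fin n → Maybe Type

  eligibleᵇ : Type → Fin n → Bool
  eligibleᵇ z J = does (s J ≤? g z) ∧ allᵇ (λ y → not (does (lower? z J y) ∧ does (ρ y ≤? ρ z))) kept

  candidateᵇ : Status → Type → Fin n → Bool
  candidateᵇ A z J = is-nothing (A J) ∧ eligibleᵇ z J

  -- Refers to the assignments made so far, as a program must, whereas `load` refers to sets read
  -- off from the final result. `load≡` reconciles the two.
  loadᴬ : Status → Type → Carrier → Carrier
  loadᴬ A z t = ΣJ λ J → if candidateᵇ A z J ∧ does (t ∈I? J) then weight z J else 0#

  overᵇ : Status → Type → Carrier → Bool
  overᵇ A z t = does (r z ≤? loadᴬ A z t)

  -- While J runs the load can only drop when some job ends.
  selectᵇ : Status → Type → Fin n → Bool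
  selectᵇ A z J = candidateᵇ A z J ∧ (overᵇ A z (I⁻ J) ∧
    allᵇ (λ J′ → not (does (I⁺ J′ ∈I? J) ∧ not (overᵇ A z (I⁺ J′)))) (allFin n))

  step : Type → Status → Status
  step z A J = if selectᵇ A z J then just z else A J

  assign : List Type → Status
  assign = List.foldr step (λ _ → nothing)

  final : Status
  final = assign kept

  eligible⁻ : ∀ {z J} → eligibleᵇ z J ≡ true → Eligible z J
  eligible⁻ {z} {J} eq = does⁻ (s J ≤? g z) (proj₁ (∧⁻ eq)) , λ {y} y∈ y<z fits →
    ≰⇒> λ ρy≤ → case trans (sym (∧⁺ {does (lower? z J y)} (dec-true (lower? z J y) (y<z , fits)) (dec-true (ρ y ≤? ρ z) ρy≤)))
      (not⁻ (allᵇ⁻ (λ y → not (does (lower? z J y) ∧ does (ρ y ≤? ρ z))) (proj₂ (∧⁻ {does (s J ≤? g z)} eq)) y∈)) of λ ()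

  eligible⁺ : ∀ {z J} → Eligible z J → eligibleᵇ z J ≡ true
  eligible⁺ {z} {J} (fits , cheaper) = ∧⁺ (dec-true (s J ≤? g z) fits)
    (allᵇ⁺ (λ y → not (does (lower? z J y) ∧ does (ρ y ≤? ρ z))) λ {y} y∈ → go y∈ (lower? z J y))
    where
    go : ∀ {y} → y ∈ₗ kept → (d : Dec (y Fin.< z × s J ≤ g y)) → not (does d ∧ does (ρ y ≤? ρ z)) ≡ true
    go y∈ (no _) = refl
    go {y} y∈ (yes (y<z , fits)) = cong not (dec-false (ρ y ≤? ρ z) (<⇒≱ (cheaper y∈ y<z fits)))

  step-keeps : ∀ {z A J y} → A J ≡ just y → step z A J ≡ just y
  step-keeps {z} {A} {J} eq with A J
  step-keeps refl | just y = refl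

  step⁻ : ∀ {z A J y} → step z A J ≡ just y → A J ≡ just y ⊎ (y ≡ z × selectᵇ A z J ≡ true)
  step⁻ {z} {A} {J} eq with selectᵇ A z J in sel
  step⁻ refl | true  = inj₂ (refl , refl)
  ...        | false = inj₁ eq

  step⁺ : ∀ {z A J} → selectᵇ A z J ≡ true → step z A J ≡ just z
  step⁺ sel rewrite sel = refl

  assign-∈ : ∀ zs {J y} → assign zs J ≡ just y → y ∈ₗ zs
  assign-∈ (z ∷ zs) {J} eq with step⁻ {z} {assign zs} {J} eq
  ... | inj₁ eq′        = there (assign-∈ zs eq′)
  ... | inj₂ (refl , _) = here refl

  assign-++ : ∀ pre {post J y} → assign post J ≡ just y → assign (pre ++ post) J ≡ just y
  assign-++ []        eq = eq
  assign-++ (z ∷ pre) {post} {J} eq = step-keeps {z} {assign (pre ++ post)} {J} (assign-++ pre eq)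

  assign-++⁻ : ∀ pre {post J y} → assign post J ≡ nothing → assign (pre ++ post) J ≡ just y → y ∈ₗ pre
  assign-++⁻ []        none eq = case trans (sym none) eq of λ ()
  assign-++⁻ (z ∷ pre) {post} {J} none eq with step⁻ {z} {assign (pre ++ post)} {J} eq
  ... | inj₁ eq′        = there (assign-++⁻ pre none eq′)
  ... | inj₂ (refl , _) = here refl

  _≟ᴹᵗ_ : (a b : Maybe Type) → Dec (a ≡ b)
  _≟ᴹᵗ_ = Maybe.≡-dec Fin._≟_

  K : Type → Subset n
  K z = ⟪ (λ J → final J ≟ᴹᵗ just z) ⟫

  ∈K⁻ : ∀ {z J} → J ∈ K z → final J ≡ just z
  ∈K⁻ {z} = ∈⟪⟫⁻ (λ J → final J ≟ᴹᵗ just z)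

  ∈K⁺ : ∀ {z J} → final J ≡ just z → J ∈ K z
  ∈K⁺ {z} = ∈⟪⟫⁺ (λ J → final J ≟ᴹᵗ just z)

  -- A status once set never changes, and after `z` only smaller types are assigned. So the jobs
  -- still open when `z` has its turn can be recognised from the final status.
  Waiting : Type → Fin n → Set
  Waiting z J = eligibleᵇ z J ∧ maybe′ (λ y → does (y Fin.≤? z)) true (final J) ≡ true

  waiting? : ∀ z J → Dec (Waiting z J)
  waiting? z J = (eligibleᵇ z J ∧ maybe′ (λ y → does (y Fin.≤? z)) true (final J)) Bool.≟ true

  𝓡 : Type → Subset n
  𝓡 z = ⟪ waiting? z ⟫

  -- assign folds from the right, so post is what is processed before z.
  module Before {pre z post} (kept≡ : kept ≡ pre ++ z ∷ post) where

    A : Status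
    A = assign post

    order : ∀ pre → AllPairs Fin._<_ (pre ++ z ∷ post) → (∀ {y} → y ∈ₗ pre → y Fin.< z) × All (z Fin.<_) post
    order []        (z< ∷ _)   = (λ ()) , z<
    order (x ∷ pre) (x< ∷ asc) = let below , above = order pre asc in
      (λ { (here refl) → All.lookup x< (∈-++⁺ʳ pre (here refl)) ; (there y∈) → below y∈ }) , above

    pre<z : ∀ {y} → y ∈ₗ pre → y Fin.< z
    pre<z = proj₁ (order pre (subst (AllPairs Fin._<_) kept≡ ascending))

    post>z : ∀ {y} → y ∈ₗ post → z Fin.< y
    post>z = All.lookup (proj₂ (order pre (subst (AllPairs Fin._<_) kept≡ ascending)))

    final≡ : final ≡ assign (pre ++ z ∷ post)
    final≡ = cong assign kept≡

    z∈ : z ∈ₗ kept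
    z∈ = subst (z ∈ₗ_) (sym kept≡) (∈-++⁺ʳ pre (here refl))

    -- Later steps preserve an assignment; conversely, by `final-before`, they cannot produce a type
    -- above `z`.
    assigned-before : ∀ {J y} → A J ≡ just y → final J ≡ just y × z Fin.< y
    assigned-before {J} {y} eq = trans (cong (λ B → B J) final≡)
      (assign-++ pre (step-keeps {z} {A} {J} eq)) , post>z (assign-∈ post eq)

    final-before : ∀ {J y} → final J ≡ just y → z Fin.< y → A J ≡ just y
    final-before {J} {y} eq z<y with A J in AJ
    ... | just x  = trans (sym (proj₁ (assigned-before AJ))) eq
    ... | nothing with step z A J in sJ
    ...   | nothing = contradiction (pre<z (assign-++⁻ pre sJ (trans (cong (λ B → B J) (sym final≡)) eq))) (Fin.<-asym z<y)
    ...   | just x with step⁻ {z} {A} {J} sJ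
    ...     | inj₁ eq′ = case trans (sym AJ) eq′ of λ ()
    ...     | inj₂ (refl , _) = contradiction z<y (Fin.<-irrefl (Maybe.just-injective
              (trans (sym (trans (cong (λ B → B J) final≡) (assign-++ pre sJ))) eq)))

    K⁺ : ∀ {J} → selectᵇ A z J ≡ true → J ∈ K z
    K⁺ {J} sel = ∈K⁺ (trans (cong (λ B → B J) final≡) (assign-++ pre (step⁺ {z} {A} {J} sel)))

    K⁻ : ∀ {J} → J ∈ K z → selectᵇ A z J ≡ true
    K⁻ {J} J∈ with step z A J in sJ
    ... | nothing = contradiction (pre<z (assign-++⁻ pre sJ (trans (cong (λ B → B J) (sym final≡)) (∈K⁻ J∈)))) (Fin.<-irrefl refl)
    ... | just y with step⁻ {z} {A} {J} sJ
    ...   | inj₂ (_ , sel) = sel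
    ...   | inj₁ eq′ = let final≡y , z<y = assigned-before eq′ in
      contradiction z<y (Fin.<-irrefl (Maybe.just-injective (trans (sym (∈K⁻ J∈)) final≡y)))

    unassigned⁺ : ∀ {J} → (∀ {y} → y ∈ₗ kept → z Fin.< y → J ∉ K y) → A J ≡ nothing
    unassigned⁺ {J} none with A J in AJ
    ... | nothing = refl
    ... | just y  = let final≡y , z<y = assigned-before AJ in
      contradiction (∈K⁺ final≡y) (none (subst (y ∈ₗ_) (sym kept≡) (∈-++⁺ʳ pre (there (assign-∈ post AJ)))) z<y)

    candidate⁺ : ∀ {J} → J ∈ 𝓡 z → candidateᵇ A z J ≡ true
    candidate⁺ {J} J∈ with ∧⁻ {eligibleᵇ z J} (∈⟪⟫⁻ (waiting? z) J∈)
    ... | el , w with A J in AJ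
    ...   | nothing = el
    ...   | just y  = let final≡y , z<y = assigned-before AJ in
      contradiction (does⁻ (y Fin.≤? z) (trans (sym (cong (maybe′ (λ y → does (y Fin.≤? z)) true) final≡y)) w)) (ℕ.<⇒≱ z<y)

    candidate⁻ : ∀ {J} → candidateᵇ A z J ≡ true → J ∈ 𝓡 z
    candidate⁻ {J} cand with A J in AJ
    ... | nothing = ∈⟪⟫⁺ (waiting? z) (∧⁺ cand waits)
      where
      waits : maybe′ (λ y → does (y Fin.≤? z)) true (final J) ≡ true
      waits with final J in fJ
      ... | nothing = refl
      ... | just y  = dec-true (y Fin.≤? z) (ℕ.≮⇒≥ λ z<y → case trans (sym AJ) (final-before fJ z<y) of λ ())

    𝓡⁻ : ∀ {J} → J ∈ 𝓡 z → Eligible z J × (∀ {y} → y ∈ₗ kept → z Fin.< y → J ∉ K y)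
    𝓡⁻ {J} J∈ = eligible⁻ (proj₂ (∧⁻ {is-nothing (A J)} (candidate⁺ J∈))) , λ y∈ z<y J∈K →
      case subst (λ a → is-nothing a ≡ true) (final-before (∈K⁻ J∈K) z<y) (proj₁ (∧⁻ (candidate⁺ J∈))) of λ ()

    𝓡⁺ : ∀ {J} → Eligible z J → (∀ {y} → y ∈ₗ kept → z Fin.< y → J ∉ K y) → J ∈ 𝓡 z
    𝓡⁺ el none = candidate⁻ (∧⁺ (cong is-nothing (unassigned⁺ none)) (eligible⁺ el))

    load≡ : ∀ t → loadᴬ A z t ≡ load 𝓡 z t
    load≡ t = Σ-cong (allFin n) λ J → cong (λ b → if b then weight z J else 0#) (≡true-cong
      (λ eq → dec-true (J ∈? (𝓡 z at t)) (∈at⁺ {𝓡 z} (candidate⁻ (proj₁ (∧⁻ eq))) (does⁻ (t ∈I? J) (proj₂ (∧⁻ {candidateᵇ A z J} eq)))))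
      λ eq → let J∈ , t∈ = ∈at⁻ {𝓡 z} (does⁻ (J ∈? (𝓡 z at t)) eq) in ∧⁺ (candidate⁺ J∈) (dec-true (t ∈I? J) t∈))

    over⁻ : ∀ {t} → overᵇ A z t ≡ true → r z ≤ load 𝓡 z t
    over⁻ {t} eq = ≤-trans (does⁻ (r z ≤? loadᴬ A z t) eq) (≤-reflexive (load≡ t))

    over-false : ∀ {t} → overᵇ A z t ≡ false → load 𝓡 z t ≤ r z
    over-false {t} eq = ≤-trans (≤-reflexive (sym (load≡ t))) (≰⇒≥ (does⁻¬ (r z ≤? loadᴬ A z t) eq))

    ends : Fin n → Fin n → Bool
    ends J J′ = not (does (I⁺ J′ ∈I? J) ∧ not (overᵇ A z (I⁺ J′)))

    over-end : ∀ {J J′} → allᵇ (ends J) (allFin n) ≡ true → I⁺ J′ ∈I J → overᵇ A z (I⁺ J′) ≡ true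
    over-end {J} {J′} eq e∈ = implies⁻ {does (I⁺ J′ ∈I? J)} (allᵇ⁻ (ends J) eq (∈-allFin J′)) (dec-true (I⁺ J′ ∈I? J) e∈)

    -- Jobs that start between the two moments only add to the load.
    load-monotone : ∀ {e t} → e ≤ t → (∀ {J} → e ∈I J → t < I⁺ J) → load 𝓡 z e ≤ load 𝓡 z t
    load-monotone {e} {t} e≤t alive = Σ-mono (allFin n) λ J →
      when-mono (J ∈? (𝓡 z at e)) (J ∈? (𝓡 z at t)) (weight-nonNeg z J) λ J∈ → let J∈𝓡 , e∈ = ∈at⁻ {𝓡 z} J∈ in
        ∈at⁺ {𝓡 z} J∈𝓡 (≤-trans (proj₁ e∈) e≤t , alive e∈) , ≤-refl

    -- Take the last tested moment up to `t`: the start of `J`, or the last end of a job since then.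
    -- No job active at that moment ends by `t`, so the load at `t` is no lower. There are no
    -- ceilings here, so the factor 6 is mere slack.
    heavy : ∀ {J t} → J ∈ K z → t ∈I J → r z ≤ fromℕ 6 * load 𝓡 z t
    heavy {J} {t} J∈ (a≤t , t<b) = ≤-trans (go (argmax (λ J′ → (I⁺ J′ ≤? t) ×-dec (I⁻ J ≤? I⁺ J′)) I⁺))
      (x≤suc*x 5 (load-nonNeg 𝓡 z t))
      where
      checks : overᵇ A z (I⁻ J) ≡ true × allᵇ (ends J) (allFin n) ≡ true
      checks = ∧⁻ (proj₂ (∧⁻ {candidateᵇ A z J} (K⁻ J∈)))

      go : (∀ J′ → ¬ (I⁺ J′ ≤ t × I⁻ J ≤ I⁺ J′)) ⊎
           (∃ λ J′ → (I⁺ J′ ≤ t × I⁻ J ≤ I⁺ J′) × ∀ J″ → I⁺ J″ ≤ t × I⁻ J ≤ I⁺ J″ → I⁺ J″ ≤ I⁺ J′) →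
           r z ≤ load 𝓡 z t
      go (inj₁ none) = ≤-trans (over⁻ (proj₁ checks)) (load-monotone a≤t λ {J′} (_ , a<end) →
        ≰⇒> λ end≤t → none J′ (end≤t , <⇒≤ a<end))
      go (inj₂ (J′ , (e≤t , a≤e) , last)) = ≤-trans (over⁻ (over-end (proj₂ checks) (a≤e , ≤-<-trans e≤t t<b)))
        (load-monotone e≤t λ {J″} (_ , e<end) → ≰⇒> λ end≤t →
          <⇒≱ e<end (last J″ (end≤t , ≤-trans a≤e (<⇒≤ e<end))))

    light : ∀ {J} → J ∈ 𝓡 z → J ∉ K z → ∃ λ u → u ∈I J × load 𝓡 z u ≤ r z
    light {J} J∈ J∉ with overᵇ A z (I⁻ J) in over | allᵇ (ends J) (allFin n) in all
    ... | false | _     = I⁻ J , (≤-refl , I-positive J) , over-false over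
    ... | true  | true  = contradiction (K⁺ (∧⁺ (candidate⁺ J∈) (∧⁺ over all))) J∉
    ... | true  | false with allᵇ-false (ends J) {allFin n} all
    ...   | J′ , _ , end = let e∈ , ¬over = implies-false {does (I⁺ J′ ∈I? J)} end in
      I⁺ J′ , does⁻ (I⁺ J′ ∈I? J) e∈ , over-false ¬over

  before : ∀ {z} → z ∈ₗ kept → ∃ λ pre → ∃ λ post → kept ≡ pre ++ z ∷ post
  before = ∈-∃++

  topDown : TopDown
  topDown = record
    { K     = K
    ; 𝓡     = 𝓡
    ; 𝓡⁻    = λ z∈ → Before.𝓡⁻ (proj₂ (proj₂ (before z∈)))
    ; 𝓡⁺    = λ z∈ → Before.𝓡⁺ (proj₂ (proj₂ (before z∈)))
    ; K⊆𝓡   = λ {z} {J} z∈ J∈ → let open Before (proj₂ (proj₂ (before z∈))) in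
        candidate⁻ (proj₁ (∧⁻ (K⁻ J∈)))
    ; heavy = λ z∈ → Before.heavy (proj₂ (proj₂ (before z∈)))
    ; light = λ z∈ → Before.light (proj₂ (proj₂ (before z∈)))
    }

  K-fits : ∀ z {J} → J ∈ K z → s J ≤ g z
  K-fits z J∈ = proj₁ (proj₁ (TopDown.𝓡⁻ topDown z∈ (TopDown.K⊆𝓡 topDown z∈ J∈)))
    where
    z∈ : z ∈ₗ kept
    z∈ = assign-∈ kept (∈K⁻ J∈)

  g-mono-≤ : ∀ {y z} → y Fin.≤ z → g y ≤ g z
  g-mono-≤ = mono-≤ g g-mono-<

  -- If no larger type takes the job, the smallest kept type that it fits must: there it weighs
  -- `r z` alone, so the load is high enough throughout its interval. Minimising `r` finds this
  -- type, as rates increase with the index.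
  assigned : ∀ J → ∃ λ z → final J ≡ just z
  assigned J with argmin (λ z → (z ∈ₗ? kept) ×-dec (s J ≤? g z)) r
  ... | inj₁ none = let k , k∈ , top≤k , _ = cover (Fin.fromℕ top) in
    contradiction (k∈ , ≤-trans (fits J) (g-mono-≤ top≤k)) (none k)
  ... | inj₂ (z , (z∈ , s≤g) , least) with before z∈
  ...   | pre , post , kept≡ = go (assign post J) refl
    where
    open Before kept≡

    alone : ∀ {y} → y ∈ₗ kept → y Fin.< z → ¬ s J ≤ g y
    alone y∈ y<z s≤ = <⇒≱ (r-mono-< y<z) (least _ (y∈ , s≤))

    go : ∀ a → A J ≡ a → ∃ λ z → final J ≡ just z
    go (just y) AJ = y , proj₁ (assigned-before AJ)
    go nothing  AJ = z , ∈K⁻ (K⁺ (∧⁺ cand (∧⁺ (over (≤-refl , I-positive J)) (allᵇ⁺ (ends J) {allFin n} λ {J′} _ → end J′))))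
      where
      cand : candidateᵇ A z J ≡ true
      cand = ∧⁺ (cong is-nothing AJ) (eligible⁺ (s≤g , λ y∈ y<z fits → contradiction fits (alone y∈ y<z)))

      over : ∀ {u} → u ∈I J → overᵇ A z u ≡ true
      over {u} u∈ = dec-true (r z ≤? loadᴬ A z u) (≤-trans
        (≤cheapest z J {kept} ≤-refl λ y∈ y<z fits → contradiction fits (alone y∈ y<z))
        (≤-trans (≤-trans (≤-reflexive (sym (when-yes (J ∈? (𝓡 z at u)) (∈at⁺ {𝓡 z} (candidate⁻ cand) u∈))))
          (Σ-∈ (λ J → when-nonNeg (J ∈? (𝓡 z at u)) (weight-nonNeg z J)) (∈-allFin J))) (≤-reflexive (sym (load≡ u)))))

      end : ∀ J′ → ends J J′ ≡ true
      end J′ = implies⁺ {does (I⁺ J′ ∈I? J)} λ e∈ → over (does⁻ (I⁺ J′ ∈I? J) e∈)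

  type : Fin n → Type
  type J = proj₁ (assigned J)

  J∈K : ∀ J → J ∈ K (type J)
  J∈K J = ∈K⁺ (proj₂ (assigned J))

  type∈kept : ∀ J → type J ∈ₗ kept
  type∈kept J = assign-∈ kept (proj₂ (assigned J))

  module _ (dc : DualColouring) where

    open Colouring dc kept K K-fits type type∈kept J∈K public

    -- Each type of the competitor is replaced by a kept type covering it. This at most doubles
    -- rates and, as capacities do not decrease, prices per unit too; so `L` is twice the rate, and
    -- 4 · 17 · 2 = 136.
    schedule-approximates : schedule CostsAtMost 136 ×OPT
    schedule-approximates = approximates 136 schedule-feasible λ σ feas t →
      let up = λ J → proj₁ (cover (proj₁ (σ J)))
          up≥ = λ J → proj₁ (proj₂ (proj₂ (cover (proj₁ (σ J)))))
          r-up = λ J → proj₂ (proj₂ (proj₂ (cover (proj₁ (σ J)))))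
      in begin
      rate schedule t ≤⟨ rate-schedule t ⟩
      fromℕ 4 * Σᴸ kept (λ z → fromℕ (machines z t) * r z)
        ≤⟨ n*-mono 4 (Analysis.AtTime.machines≤ ascending (thin-doubling (allFin (suc top))) topDown
             t (fromℕ 2 * rate σ t) (*-nonNeg (fromℕ-nonNeg 2) (rate-nonNeg σ t))
             up (λ J → proj₁ (proj₂ (cover (proj₁ (σ J)))))
             (λ J → ≤-trans (fits-on feas J) (g-mono-≤ (up≥ J)))
             (λ J t∈ → ≤-trans (r-up J) (n*-mono 2 (r≤rate σ t∈)))
             (≤-trans (Σ-mono (allFin n) λ J → when-mono (t ∈I? J) (t ∈I? J)
                 (*-nonNeg (s-nonNeg J) (*-nonNeg (fromℕ-nonNeg 2) (ρ-nonNeg (proj₁ (σ J)))))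
                 λ t∈ → t∈ , *-monoˡ-≤ (s-nonNeg J) (ρ-up (up≥ J) (r-up J)))
               (≤-trans (≤-reflexive (trans (Σ-cong (allFin n) λ J → double t J (ρ (proj₁ (σ J)))) (Σ-* (allFin n) (fromℕ 2) _)))
                 (n*-mono 2 (load≤rate feas t))))) ⟩
      fromℕ 4 * (fromℕ 17 * (fromℕ 2 * rate σ t))
        ≡⟨ trans (sym (fromℕ-*-assoc 4 17 _)) (sym (fromℕ-*-assoc 68 2 (rate σ t))) ⟩
      fromℕ 136 * rate σ t ∎
      where
      ρ-up : ∀ {y k} → y Fin.≤ k → r k ≤ fromℕ 2 * r y → ρ k ≤ fromℕ 2 * ρ y
      ρ-up {y} {k} y≤k r≤ = *-cancelˡ-pos (g-positive y) (begin
        g y * ρ k           ≤⟨ *-monoʳ-≤ (ρ-nonNeg k) (g-mono-≤ y≤k) ⟩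
        g k * ρ k           ≡⟨ trans (*-comm (g k) (ρ k)) (ρ*g k) ⟩
        r k                 ≤⟨ r≤ ⟩
        fromℕ 2 * r y       ≡⟨ cong (fromℕ 2 *_) (trans (sym (ρ*g y)) (*-comm (ρ y) (g y))) ⟩
        fromℕ 2 * (g y * ρ y) ≡⟨ solve 3 (λ a b c → a :* (b :* c) := b :* (a :* c)) refl (fromℕ 2) (g y) (ρ y) ⟩
        g y * (fromℕ 2 * ρ y) ∎)

      double : ∀ t J x → when (t ∈I? J) (s J * (fromℕ 2 * x)) ≡ fromℕ 2 * when (t ∈I? J) (s J * x)
      double t J x = trans (cong (when (t ∈I? J)) (solve 3 (λ a b c → a :* (b :* c) := b :* (a :* c)) refl (s J) (fromℕ 2) x))
        (sym (*-when (t ∈I? J)))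

-- Combinators for programs of polynomial running time.

module PolynomialTimePrograms where

  open import Data.Bool.Properties using (if-float)
  open import Data.Integer as ℤ using (ℤ; +_; -[1+_]; +[1+_])
  import Data.Integer.Properties as ℤ
  open import Data.List using (reverse)
  open import Data.Nat using (_+_; _*_; _^_; _≤_; _<_; z≤n; s≤s; _⊔_; ⌊_/2⌋)
  import Data.Nat.DivMod as ℕ
  open import Data.Nat.Induction using (<-rec)
  open import Data.Nat.Logarithm using (⌊log₂_⌋; ⌊log₂⌋-mono-≤; ⌊log₂⌊n/2⌋⌋≡⌊log₂n⌋∸1; ⌊log₂[2^n]⌋≡n)
  open import Data.Nat.Properties
  open import Data.Nat.Solver using (module +-*-Solver)
  open import Data.Rational as ℚ using (ℚ; mkℚ; ↥_; ↧_; 0ℚ; toℚᵘ)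
  import Data.Rational.Properties as ℚ
  open import Data.Rational.Unnormalised as ℚᵘ using (ℚᵘ; mkℚᵘ; 0ℚᵘ; _≃_)
  import Data.Rational.Unnormalised.Properties as ℚᵘ

  -- Polynomially bounded functions

  IsPoly : (ℕ → ℕ) → Set
  IsPoly F = ∃ λ a → ∃ λ b → ∀ n → 1 ≤ n → F n ≤ a * n ^ b

  ^-raise : ∀ {n} → 1 ≤ n → ∀ {b c} → b ≤ c → n ^ b ≤ n ^ c
  ^-raise {suc n} _ = ^-monoʳ-≤ (suc n)

  poly-id : IsPoly id
  poly-id = 1 , 1 , λ n _ → ≤-reflexive (sym (trans (*-identityˡ (n ^ 1)) (*-identityʳ n)))

  poly-const : ∀ c → IsPoly (λ _ → c)
  poly-const c = c , 0 , λ n _ → ≤-reflexive (sym (*-identityʳ c))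

  poly-+ : ∀ {F G} → IsPoly F → IsPoly G → IsPoly (λ n → F n + G n)
  poly-+ (a , b , F≤) (c , d , G≤) = a + c , b + d , λ n 1≤n → ≤-trans
    (+-mono-≤ (≤-trans (F≤ n 1≤n) (*-monoʳ-≤ a (^-raise 1≤n (m≤m+n b d))))
              (≤-trans (G≤ n 1≤n) (*-monoʳ-≤ c (^-raise 1≤n (m≤n+m d b)))))
    (≤-reflexive (sym (*-distribʳ-+ (n ^ (b + d)) a c)))

  poly-* : ∀ {F G} → IsPoly F → IsPoly G → IsPoly (λ n → F n * G n)
  poly-* (a , b , F≤) (c , d , G≤) = a * c , b + d , λ n 1≤n → ≤-trans (*-mono-≤ (F≤ n 1≤n) (G≤ n 1≤n))
    (≤-reflexive (trans (solve 4 (λ a x c y → (a :* x) :* (c :* y) := (a :* c) :* (x :* y)) refl a (n ^ b) c (n ^ d))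
      (cong (a * c *_) (sym (^-distribˡ-+-* n b d)))))
    where open +-*-Solver

  poly-^ : ∀ {F} → IsPoly F → ∀ k → IsPoly (λ n → F n ^ k)
  poly-^ polyF zero    = poly-const 1
  poly-^ polyF (suc k) = poly-* polyF (poly-^ polyF k)

  poly-monomial : ∀ {F} → IsPoly F → ∀ a b → IsPoly (λ n → a * F n ^ b)
  poly-monomial polyF a b = poly-* (poly-const a) (poly-^ polyF b)

  monomial-mono : ∀ a b {m n} → m ≤ n → a * m ^ b ≤ a * n ^ b
  monomial-mono a b m≤n = *-monoʳ-≤ a (^-monoˡ-≤ b m≤n)

  -- Sizes of values

  size≥1 : ∀ v → 1 ≤ size v
  size≥1 (int _)    = s≤s z≤n
  size≥1 (pair _ _) = s≤s z≤n

  n<2^[1+log] : ∀ n → n < 2 ^ suc ⌊log₂ n ⌋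
  n<2^[1+log] = <-rec _ go
    where
    ⌊n/2⌋-bound : ∀ n → n < 2 * suc ⌊ n /2⌋
    ⌊n/2⌋-bound zero          = s≤s z≤n
    ⌊n/2⌋-bound (suc zero)    = s≤s (s≤s z≤n)
    ⌊n/2⌋-bound (suc (suc n)) = ≤-trans (s≤s (s≤s (⌊n/2⌋-bound n)))
      (≤-reflexive (solve 1 (λ k → con 2 :+ con 2 :* k := con 2 :* (con 1 :+ k)) refl (suc ⌊ n /2⌋)))
      where open +-*-Solver

    go : ∀ n → (∀ {m} → m < n → m < 2 ^ suc ⌊log₂ m ⌋) → n < 2 ^ suc ⌊log₂ n ⌋
    go zero          _  = s≤s z≤n
    go (suc zero)    _  = s≤s (s≤s z≤n)
    go n@(suc (suc n′)) ih = ≤-trans (⌊n/2⌋-bound n) (*-monoʳ-≤ 2 (≤-trans (ih half<)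
      (≤-reflexive (cong (2 ^_) (trans (cong suc (⌊log₂⌊n/2⌋⌋≡⌊log₂n⌋∸1 n)) (m+[n∸m]≡n 1≤log))))))
      where
      half< : ⌊ n /2⌋ < n
      half< = ⌊n/2⌋<n (suc n′)

      1≤log : 1 ≤ ⌊log₂ n ⌋
      1≤log = subst (_≤ ⌊log₂ n ⌋) (⌊log₂[2^n]⌋≡n 1) (⌊log₂⌋-mono-≤ (s≤s (s≤s (z≤n {n′}))))

  sizeℤ : ℤ → ℕ
  sizeℤ i = size (int i)

  ∣i∣<2^size : ∀ i → ℤ.∣ i ∣ < 2 ^ sizeℤ i
  ∣i∣<2^size i = n<2^[1+log] ℤ.∣ i ∣

  size≤ : ∀ i {k} → ℤ.∣ i ∣ ≤ 2 ^ k → sizeℤ i ≤ suc k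
  size≤ i {k} le = s≤s (≤-trans (⌊log₂⌋-mono-≤ le) (≤-reflexive (⌊log₂[2^n]⌋≡n k)))

  size-* : ∀ i j → sizeℤ (i ℤ.* j) ≤ suc (sizeℤ i + sizeℤ j)
  size-* i j = size≤ (i ℤ.* j) {sizeℤ i + sizeℤ j} (≤-trans (≤-reflexive (ℤ.abs-* i j))
    (≤-trans (*-mono-≤ (<⇒≤ (∣i∣<2^size i)) (<⇒≤ (∣i∣<2^size j)))
      (≤-reflexive (sym (^-distribˡ-+-* 2 (sizeℤ i) (sizeℤ j))))))

  -- The maximum matters: in `size-sumᵘ` a bound by the sum of the sizes would double at every
  -- summand.
  size-+ : ∀ i j → sizeℤ (i ℤ.+ j) ≤ 2 + (sizeℤ i ⊔ sizeℤ j)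
  size-+ i j = size≤ (i ℤ.+ j) {suc m} (≤-trans (ℤ.∣i+j∣≤∣i∣+∣j∣ i j)
    (≤-trans (+-mono-≤ (half i (m≤m⊔n (sizeℤ i) (sizeℤ j))) (half j (m≤n⊔m (sizeℤ i) (sizeℤ j))))
      (≤-reflexive (cong (λ k → 2 ^ m + k) (sym (+-identityʳ (2 ^ m)))))))
    where
    m = sizeℤ i ⊔ sizeℤ j

    half : ∀ k → sizeℤ k ≤ m → ℤ.∣ k ∣ ≤ 2 ^ m
    half k le = ≤-trans (<⇒≤ (∣i∣<2^size k)) (^-monoʳ-≤ 2 le)

  size-+′ : ∀ i j → sizeℤ (i ℤ.+ j) ≤ 2 + (sizeℤ i + sizeℤ j)
  size-+′ i j = ≤-trans (size-+ i j) (+-monoʳ-≤ 2 (m⊔n≤m+n (sizeℤ i) (sizeℤ j)))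

  -- Integer division rounds downwards, so for negative `i` the absolute value may exceed the
  -- quotient of absolute values by one.
  ∣/ℕ∣≤ : ∀ i d .{{_ : ℕ.NonZero d}} → ℤ.∣ i ℤ./ℕ d ∣ ≤ suc ℤ.∣ i ∣
  ∣/ℕ∣≤ (+ n)    d = m≤n⇒m≤1+n (ℕ.m/n≤m n d)
  ∣/ℕ∣≤ -[1+ n ] d with suc n ℕ.% d
  ... | zero  = ≤-trans (≤-reflexive (ℤ.∣-i∣≡∣i∣ (+ (suc n ℕ./ d)))) (m≤n⇒m≤1+n (ℕ.m/n≤m (suc n) d))
  ... | suc _ = s≤s (ℕ.m/n≤m (suc n) d)

  ∣/∣≤ : ∀ i j .{{_ : ℤ.NonZero j}} → ℤ.∣ i ℤ./ j ∣ ≤ suc ℤ.∣ i ∣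
  ∣/∣≤ i (+ d)      = ≤-trans (≤-reflexive (cong ℤ.∣_∣ (ℤ.*-identityˡ (i ℤ./ℕ d)))) (∣/ℕ∣≤ i d)
  ∣/∣≤ i -[1+ d ]   = ≤-trans (≤-reflexive (trans (ℤ.abs-* (-[1+ 0 ]) (i ℤ./ℕ suc d)) (+-identityʳ _))) (∣/ℕ∣≤ i (suc d))

  boolᵛ : Bool → Val
  boolᵛ b = int (if b then + 1 else + 0)

  size-boolᵛ : ∀ b → size (boolᵛ b) ≡ 1
  size-boolᵛ true  = refl
  size-boolᵛ false = refl

  size-apply : ∀ f x → size (apply f x) ≤ 2 + size x
  size-apply copy   x                      = m≤n+m (size x) 2
  size-apply fst    (int _)                = s≤s z≤n
  size-apply fst    (pair x y)             = m≤n⇒m≤1+n (m≤n⇒m≤1+n (m≤n⇒m≤1+n (m≤m+n (size x) (size y))))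
  size-apply snd    (int _)                = s≤s z≤n
  size-apply snd    (pair x y)             = m≤n⇒m≤1+n (m≤n⇒m≤1+n (m≤n⇒m≤1+n (m≤n+m (size y) (size x))))
  size-apply isPair (int _)                = s≤s z≤n
  size-apply isPair (pair _ _)             = s≤s z≤n
  size-apply add    (int _)                = s≤s z≤n
  size-apply add    (pair (int i) (int j)) = ≤-trans (size-+′ i j) (m≤n⇒m≤1+n ≤-refl)
  size-apply add    (pair (int i) (pair _ _)) = s≤s z≤n
  size-apply add    (pair (pair _ _) _)    = s≤s z≤n
  size-apply neg    (int i)                = ≤-trans (≤-reflexive (cong (λ n → suc ⌊log₂ n ⌋) (ℤ.∣-i∣≡∣i∣ i))) (m≤n+m _ 2)
  size-apply neg    (pair _ _)             = s≤s z≤n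
  size-apply mul    (int _)                = s≤s z≤n
  size-apply mul    (pair (int i) (int j)) = ≤-trans (size-* i j) (m≤n+m _ 2)
  size-apply mul    (pair (int i) (pair _ _)) = s≤s z≤n
  size-apply mul    (pair (pair _ _) _)    = s≤s z≤n
  size-apply quot   (int _)                = s≤s z≤n
  size-apply quot   (pair (int i) (int j)) with j ℤ.≟ + 0
  ... | yes _   = s≤s z≤n
  ... | no  j≢0 = ≤-trans (size≤ (ℤ._/_ i j {{ℤ.≢-nonZero j≢0}}) {sizeℤ i}
    (≤-trans (∣/∣≤ i j {{ℤ.≢-nonZero j≢0}}) (∣i∣<2^size i))) (s≤s (≤-trans (m≤m+n (sizeℤ i) (sizeℤ j)) (m≤n+m _ 2)))
  size-apply quot   (pair (int i) (pair _ _)) = s≤s z≤n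
  size-apply quot   (pair (pair _ _) _)    = s≤s z≤n
  size-apply leq    (int _)                = s≤s z≤n
  size-apply leq    (pair (int i) (int j)) = ≤-trans (≤-reflexive (size-boolᵛ (does (i ℤ.≤? j)))) (s≤s z≤n)
  size-apply leq    (pair (int i) (pair _ _)) = s≤s z≤n
  size-apply leq    (pair (pair _ _) _)    = s≤s z≤n

  growth : Prog → ℕ
  growth (prim _)     = 3
  growth (const i)    = sizeℤ i
  growth (p ⨾ q)      = growth q
  growth (fork p q)   = 1 + growth p + growth q
  growth (cond b p q) = growth p + growth q
  growth (while b p)  = 1

  -- Every step is charged the size of what it works on, so an output can exceed the cost only by a
  -- factor depending on the program. This bounds the input of whatever runs next. For `while` the
  -- factor is 1, as the final value is charged at the last test.
  size-output : ∀ {p x y k} → p ⊢ x ⇓ y cost k → size y ≤ growth p * k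
  size-output {x = x} (prim {f}) = ≤-trans (size-apply f x)
    (≤-trans (+-monoˡ-≤ (size x) (*-monoʳ-≤ 2 (size≥1 x))) (≤-reflexive
      (solve 1 (λ n → con 2 :* n :+ n := con 3 :* n) refl (size x))))
    where open +-*-Solver
  size-output {x = x} (const {i}) = ≤-trans (≤-reflexive (sym (*-identityʳ (sizeℤ i)))) (*-monoʳ-≤ (sizeℤ i) (size≥1 x))
  size-output (seq {q = q} {k = k} {l} _ d) = ≤-trans (size-output d) (*-monoʳ-≤ (growth q) (m≤n+m l k))
  size-output {x = x} (fork {p} {q} {k = k} {l} c d) = ≤-trans
    (+-mono-≤ (size≥1 x) (+-mono-≤ (size-output c) (size-output d)))
    (≤-trans (m≤m+n _ _) (≤-reflexive (solve 5 (λ n p q k l →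
      (n :+ (p :* k :+ q :* l)) :+ (p :* n :+ p :* l :+ q :* n :+ q :* k :+ k :+ l) :=
      (con 1 :+ p :+ q) :* (n :+ k :+ l)) refl (size x) (growth p) (growth q) k l)))
    where open +-*-Solver
  size-output {x = x} (ifTrue {p = p} {q} {k = k} {l} _ _ d) = ≤-trans (size-output d)
    (*-mono-≤ (m≤m+n (growth p) (growth q)) (m≤n+m l (size x + k)))
  size-output {x = x} (ifFalse {p = p} {q} {k = k} {l} _ _ d) = ≤-trans (size-output d)
    (*-mono-≤ (m≤n+m (growth q) (growth p)) (m≤n+m l (size x + k)))
  size-output {x = x} (stop {k = k} _ _) = ≤-trans (m≤m+n (size x) k) (≤-reflexive (sym (+-identityʳ _)))
  size-output {x = x} (loop {k = k} {l} {j} _ _ _ d) = ≤-trans (size-output d)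
    (*-monoʳ-≤ 1 (m≤n+m j (size x + k + l)))

  -- A term with value o γ in an environment encoded as e γ; binders extend Γ and e.

  record PT {Γ : Set} (e o : Γ → Val) : Set where
    constructor pt
    field
      program    : Prog
      coeff deg  : ℕ
      run        : ∀ γ → ∃ λ k → program ⊢ e γ ⇓ o γ cost k × k ≤ coeff * size (e γ) ^ deg

  private variable
    Γ Δ : Set
    e o o₁ o₂ : Γ → Val

  Small : (e o : Γ → Val) → Set
  Small e o = ∃ λ a → ∃ λ b → ∀ γ → size (o γ) ≤ a * size (e γ) ^ b

  -- Opacity keeps Agda from computing the astronomical coefficients.
  opaque

    mkPT : ∀ {F} (p : Prog) → IsPoly F → (∀ γ → ∃ λ k → p ⊢ e γ ⇓ o γ cost k × k ≤ F (size (e γ))) → PT e o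
    mkPT {e = e} p (a , b , F≤) run = pt p a b λ γ → let k , d , k≤ = run γ in
      k , d , ≤-trans k≤ (F≤ (size (e γ)) (size≥1 (e γ)))

    small : PT e o → Small e o
    small (pt p a b run) = growth p * a , b , λ γ → let k , d , k≤ = run γ in
      ≤-trans (size-output d) (≤-trans (*-monoʳ-≤ (growth p) k≤) (≤-reflexive (sym (*-assoc (growth p) a _))))

  recode : (∀ γ → o₁ γ ≡ o₂ γ) → PT e o₁ → PT e o₂
  recode {e = e} eq (pt p a b run) = pt p a b λ γ → let k , d , k≤ = run γ in
    k , subst (λ v → p ⊢ e γ ⇓ v cost k) (eq γ) d , k≤

  reindex : (h : Δ → Γ) → PT e o → PT (e ∘ h) (o ∘ h)
  reindex h (pt p a b run) = pt p a b (run ∘ h)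

  primᴾ : ∀ f → PT e (apply f ∘ e)
  primᴾ f = mkPT (prim f) poly-id λ γ → _ , prim , ≤-refl

  idᴾ : PT e e
  idᴾ = primᴾ copy

  constᴾ : ∀ i → PT e (λ _ → int i)
  constᴾ i = mkPT (const i) poly-id λ γ → _ , const , ≤-refl

  infixr 5 _⨾ᴾ_
  _⨾ᴾ_ : PT e o₁ → PT o₁ o₂ → PT e o₂
  s@(pt p a b run) ⨾ᴾ pt q c d run′ with small s
  ... | a′ , b′ , small≤ = mkPT (p ⨾ q)
    (poly-+ (poly-monomial poly-id a b) (poly-monomial (poly-monomial poly-id a′ b′) c d))
    λ γ → let k , D , k≤ = run γ ; l , E , l≤ = run′ γ in
      k + l , seq D E , +-mono-≤ k≤ (≤-trans l≤ (monomial-mono c d (small≤ γ)))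

  pairᴾ : PT e o₁ → PT e o₂ → PT e (λ γ → pair (o₁ γ) (o₂ γ))
  pairᴾ (pt p a b run) (pt q c d run′) = mkPT (fork p q)
    (poly-+ (poly-+ poly-id (poly-monomial poly-id a b)) (poly-monomial poly-id c d))
    λ γ → let k , D , k≤ = run γ ; l , E , l≤ = run′ γ in
      _ , fork D E , +-mono-≤ (+-monoʳ-≤ _ k≤) l≤

  ifᴾ : ∀ {b : Γ → Bool} → PT e (boolᵛ ∘ b) → PT e o₁ → PT e o₂ → PT e (λ γ → if b γ then o₁ γ else o₂ γ)
  ifᴾ {e = e} {o₁ = o₁} {o₂ = o₂} {b = b} (pt t a₀ b₀ run₀) (pt p a₁ b₁ run₁) (pt q a₂ b₂ run₂) = mkPT (cond t p q)
    (poly-+ (poly-+ poly-id (poly-monomial poly-id a₀ b₀))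
      (poly-+ (poly-monomial poly-id a₁ b₁) (poly-monomial poly-id a₂ b₂)))
    λ γ → branch γ (b γ) (run₀ γ)
    where
    -- A variable `c` in place of `b γ` lets the output reduce when `c` is matched.
    branch : ∀ γ (c : Bool) → (∃ λ k → t ⊢ e γ ⇓ boolᵛ c cost k × k ≤ a₀ * size (e γ) ^ b₀) →
             ∃ λ k → cond t p q ⊢ e γ ⇓ (if c then o₁ γ else o₂ γ) cost k ×
               k ≤ size (e γ) + a₀ * size (e γ) ^ b₀ + (a₁ * size (e γ) ^ b₁ + a₂ * size (e γ) ^ b₂)
    branch γ true  (k , D , k≤) = let l , E , l≤ = run₁ γ in
      _ , ifTrue D (λ ()) E , +-mono-≤ (+-monoʳ-≤ _ k≤) (≤-trans l≤ (m≤m+n _ _))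
    branch γ false (k , D , k≤) = let l , E , l≤ = run₂ γ in
      _ , ifFalse D refl E , +-mono-≤ (+-monoʳ-≤ _ k≤) (≤-trans l≤ (m≤n+m _ _))

  fstᴾ : PT e (λ γ → pair (o₁ γ) (o₂ γ)) → PT e o₁
  fstᴾ t = t ⨾ᴾ primᴾ fst

  sndᴾ : PT e (λ γ → pair (o₁ γ) (o₂ γ)) → PT e o₂
  sndᴾ t = t ⨾ᴾ primᴾ snd

  outerᴾ : PT {Γ} (λ γ → pair (o₁ γ) (o₂ γ)) o₁
  outerᴾ = primᴾ fst

  innerᴾ : PT {Γ} (λ γ → pair (o₁ γ) (o₂ γ)) o₂
  innerᴾ = primᴾ snd

  addᴾ : ∀ {i j : Γ → ℤ} → PT e (int ∘ i) → PT e (int ∘ j) → PT e (λ γ → int (i γ ℤ.+ j γ))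
  addᴾ s t = pairᴾ s t ⨾ᴾ primᴾ add

  mulᴾ : ∀ {i j : Γ → ℤ} → PT e (int ∘ i) → PT e (int ∘ j) → PT e (λ γ → int (i γ ℤ.* j γ))
  mulᴾ s t = pairᴾ s t ⨾ᴾ primᴾ mul

  leqᴾ : ∀ {i j : Γ → ℤ} → PT e (int ∘ i) → PT e (int ∘ j) → PT e (λ γ → truth (i γ ℤ.≤? j γ))
  leqᴾ s t = pairᴾ s t ⨾ᴾ primᴾ leq

  andᴾ : ∀ {b c : Γ → Bool} → PT e (boolᵛ ∘ b) → PT e (boolᵛ ∘ c) → PT e (λ γ → boolᵛ (b γ ∧ c γ))
  andᴾ {b = b} {c} s t = recode (λ γ → eq (b γ) (c γ)) (ifᴾ {b = b} s t (constᴾ (+ 0)))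
    where
    eq : ∀ b c → (if b then boolᵛ c else int (+ 0)) ≡ boolᵛ (b ∧ c)
    eq true  c = refl
    eq false c = refl

  notᴾ : ∀ {b : Γ → Bool} → PT e (boolᵛ ∘ b) → PT e (λ γ → boolᵛ (not (b γ)))
  notᴾ {b = b} s = recode (λ γ → eq (b γ)) (ifᴾ {b = b} s (constᴾ (+ 0)) (constᴾ (+ 1)))
    where
    eq : ∀ b → (if b then int (+ 0) else int (+ 1)) ≡ boolᵛ (not b)
    eq true  = refl
    eq false = refl

  -- Lists

  encL : ∀ {A : Set} → (A → Val) → List A → Val
  encL eA as = encodeList (List.map eA as)

  module _ {A : Set} (eA : A → Val) where

    size-++ : ∀ us vs → suc (size (encL eA (us ++ vs))) ≡ size (encL eA us) + size (encL eA vs)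
    size-++ []       vs = refl
    size-++ (u ∷ us) vs = cong suc (trans (sym (+-suc a X)) (trans (cong (λ k → a + k) (size-++ us vs)) (sym (+-assoc a B C))))
      where
      a = size (eA u)
      X = size (encL eA (us ++ vs))
      B = size (encL eA us)
      C = size (encL eA vs)

    size-prefix : ∀ us vs → size (encL eA us) ≤ size (encL eA (us ++ vs))
    size-prefix us vs = ℕ.s≤s⁻¹ (≤-trans (≤-trans (≤-reflexive (+-comm 1 _))
      (+-monoʳ-≤ (size (encL eA us)) (size≥1 (encL eA vs)))) (≤-reflexive (sym (size-++ us vs))))

    size-suffix : ∀ us vs → size (encL eA vs) ≤ size (encL eA (us ++ vs))
    size-suffix us vs = ℕ.s≤s⁻¹ (≤-trans (+-monoˡ-≤ (size (encL eA vs)) (size≥1 (encL eA us)))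
      (≤-reflexive (sym (size-++ us vs))))

    size-reverse : ∀ us → size (encL eA (reverse us)) ≡ size (encL eA us)
    size-reverse []       = refl
    size-reverse (u ∷ us) = suc-injective (trans (cong (suc ∘ size ∘ encL eA) (List.unfold-reverse u us))
      (trans (size-++ (reverse us) (u ∷ [])) (trans (cong (λ k → k + size (encL eA (u ∷ []))) (size-reverse us))
        (solve 2 (λ a b → b :+ (con 1 :+ (a :+ con 1)) := con 1 :+ (con 1 :+ (a :+ b))) refl
          (size (eA u)) (size (encL eA us))))))
      where open +-*-Solver

    length≤size : ∀ us → length us ≤ size (encL eA us)
    length≤size []       = z≤n
    length≤size (u ∷ us) = s≤s (≤-trans (length≤size us) (m≤n+m _ (size (eA u))))

  nonempty : ∀ {A : Set} → List A → Bool
  nonempty []      = false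
  nonempty (_ ∷ _) = true

  module _ {Γ : Set} {e : Γ → Val} {A S : Γ → Set}
           (eA : ∀ γ → A γ → Val) (eS : ∀ γ → S γ → Val) (f : ∀ γ → A γ → S γ → S γ) where

    Step : Set
    Step = PT {Σ[ γ ∈ Γ ] A γ × S γ} (λ (γ , a , s) → pair (pair (e γ) (eA γ a)) (eS γ s))
                                     (λ (γ , a , s) → eS γ (f γ a s))

    private
      State : Γ → Set
      State γ = List (A γ) × S γ

      enc : ∀ γ → State γ → Val
      enc γ (as , s) = pair (e γ) (pair (encL (eA γ) as) (eS γ s))

      test : PT {Σ Γ State} (λ (γ , st) → enc γ st) (λ (γ , as , s) → boolᵛ (nonempty as))
      test = recode (λ { (γ , [] , s) → refl ; (γ , a ∷ as , s) → refl }) (fstᴾ innerᴾ ⨾ᴾ primᴾ isPair)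

      body : Step → PT {Σ[ γ ∈ Γ ] A γ × State γ} (λ (γ , a , as , s) → enc γ (a ∷ as , s))
                                                  (λ (γ , a , as , s) → enc γ (as , f γ a s))
      body step = pairᴾ outerᴾ (pairᴾ (sndᴾ (fstᴾ innerᴾ))
        (pairᴾ (pairᴾ outerᴾ (fstᴾ (fstᴾ innerᴾ))) (sndᴾ innerᴾ) ⨾ᴾ
          reindex (λ (γ , a , as , s) → γ , a , s) step))

    -- One round is polynomial in the current state, which does not prevent exponential growth over
    -- many rounds. Hence the hypothesis that the state after every prefix is polynomial in the size
    -- of the environment.
    foldlᴾ : ∀ (xs : ∀ γ → List (A γ)) (s₀ : ∀ γ → S γ) →
             PT e (λ γ → encL (eA γ) (xs γ)) → PT e (λ γ → eS γ (s₀ γ)) → Step →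
             (∃ λ a → ∃ λ b → ∀ γ us vs → us ++ vs ≡ xs γ →
               size (eS γ (List.foldl (flip (f γ)) (s₀ γ) us)) ≤ a * size (e γ) ^ b) →
             PT e (λ γ → eS γ (List.foldl (flip (f γ)) (s₀ γ) (xs γ)))
    foldlᴾ xs s₀ list init step (a , b , bounded) = pairᴾ idᴾ (pairᴾ list init) ⨾ᴾ iterate ⨾ᴾ sndᴾ innerᴾ
      where
      module Test = PT test
      module Body = PT (body step)

      round : ℕ → ℕ
      round N = N + Test.coeff * N ^ Test.deg + Body.coeff * N ^ Body.deg

      iterations : ∀ γ N as s →
        (∀ us vs → us ++ vs ≡ as → size (enc γ (vs , List.foldl (flip (f γ)) s us)) ≤ N) →
        ∃ λ k → while Test.program Body.program ⊢ enc γ (as , s) ⇓ enc γ ([] , List.foldl (flip (f γ)) s as) cost k ×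
          k ≤ suc (length as) * round N
      iterations γ N [] s N≥ = let k , D , k≤ = Test.run (γ , [] , s) in
        _ , stop D refl , ≤-trans (+-mono-≤ (N≥ [] [] refl) (≤-trans k≤ (monomial-mono Test.coeff Test.deg (N≥ [] [] refl))))
          (≤-trans (m≤m+n _ _) (≤-reflexive (sym (+-identityʳ _))))
      iterations γ N (x ∷ as) s N≥ =
        let k , D , k≤ = Test.run (γ , x ∷ as , s)
            l , E , l≤ = Body.run (γ , x , as , s)
            j , F , j≤ = iterations γ N as (f γ x s) (λ us vs eq → N≥ (x ∷ us) vs (cong (x ∷_) eq))
            N≥₀ = N≥ [] (x ∷ as) refl
        in _ , loop D (λ ()) E F , +-mono-≤ (+-mono-≤
             (+-mono-≤ N≥₀ (≤-trans k≤ (monomial-mono Test.coeff Test.deg N≥₀)))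
             (≤-trans l≤ (monomial-mono Body.coeff Body.deg N≥₀))) j≤

      c = proj₁ (small list)
      d = proj₁ (proj₂ (small list))

      stateSize : ℕ → ℕ
      stateSize n = suc (n + suc (c * n ^ d + a * n ^ b))

      stateSize-poly : IsPoly stateSize
      stateSize-poly = poly-+ (poly-const 1) (poly-+ poly-id (poly-+ (poly-const 1)
        (poly-+ (poly-monomial poly-id c d) (poly-monomial poly-id a b))))

      stateSize≥ : ∀ γ us vs → us ++ vs ≡ xs γ →
        size (enc γ (vs , List.foldl (flip (f γ)) (s₀ γ) us)) ≤ stateSize (size (e γ))
      stateSize≥ γ us vs eq = s≤s (+-monoʳ-≤ (size (e γ)) (s≤s (+-mono-≤
        (≤-trans (size-suffix (eA γ) us vs) (≤-trans (≤-reflexive (cong (size ∘ encL (eA γ)) eq))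
          (proj₂ (proj₂ (small list)) γ))) (bounded γ us vs eq))))

      iterate : PT {Γ} (λ γ → enc γ (xs γ , s₀ γ)) (λ γ → enc γ ([] , List.foldl (flip (f γ)) (s₀ γ) (xs γ)))
      iterate = mkPT (while Test.program Body.program)
        (poly-* (poly-+ (poly-const 1) poly-id)
          (poly-+ (poly-+ N-poly (poly-monomial N-poly Test.coeff Test.deg)) (poly-monomial N-poly Body.coeff Body.deg)))
        λ γ → let k , D , k≤ = iterations γ (stateSize (size (e γ))) (xs γ) (s₀ γ) (stateSize≥ γ) in
          k , D , ≤-trans k≤ (*-mono-≤ (s≤s (≤-trans (length≤size (eA γ) (xs γ)) (list≤ γ)))
            (round-mono (stateSize-mono (env≤ γ))))
        where
        env≤ : ∀ γ → size (e γ) ≤ size (enc γ (xs γ , s₀ γ))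
        env≤ γ = m≤n⇒m≤1+n (m≤m+n (size (e γ)) _)

        list≤ : ∀ γ → size (encL (eA γ) (xs γ)) ≤ size (enc γ (xs γ , s₀ γ))
        list≤ γ = m≤n⇒m≤1+n (≤-trans (m≤n⇒m≤1+n (m≤m+n _ _)) (m≤n+m _ (size (e γ))))

        N-poly : IsPoly stateSize
        N-poly = stateSize-poly

        stateSize-mono : ∀ {m n} → m ≤ n → stateSize m ≤ stateSize n
        stateSize-mono m≤n = s≤s (+-mono-≤ m≤n (s≤s (+-mono-≤ (monomial-mono c d m≤n) (monomial-mono a b m≤n))))

        round-mono : ∀ {m n} → m ≤ n → round m ≤ round n
        round-mono m≤n = +-mono-≤ (+-mono-≤ m≤n (monomial-mono Test.coeff Test.deg m≤n)) (monomial-mono Body.coeff Body.deg m≤n)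

  reverseᴾ : ∀ {A : Γ → Set} (eA : ∀ γ → A γ → Val) (xs : ∀ γ → List (A γ)) →
             PT e (λ γ → encL (eA γ) (xs γ)) → PT e (λ γ → encL (eA γ) (reverse (xs γ)))
  reverseᴾ {e = e} eA xs list with small list
  ... | a , b , small≤ = foldlᴾ {e = e} eA (λ γ → encL (eA γ)) (λ γ → _∷_) xs (λ γ → []) list (constᴾ (+ 0))
    (pairᴾ (sndᴾ outerᴾ) innerᴾ)
    (a , b , λ γ us vs eq → ≤-trans (≤-reflexive (size-reverse (eA γ) us)) (≤-trans (size-prefix (eA γ) us vs)
      (≤-trans (≤-reflexive (cong (size ∘ encL (eA γ)) eq)) (small≤ γ))))

  module _ {Γ : Set} {e : Γ → Val} {A S : Γ → Set}
           (eA : ∀ γ → A γ → Val) (eS : ∀ γ → S γ → Val) (f : ∀ γ → A γ → S γ → S γ) where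

    -- Computed as a left fold over the reversed list. Prefixes of the latter are reversed suffixes
    -- of the list, so a bound valid for every list `ys` covers all intermediate states.
    foldrᴾ : ∀ (xs : ∀ γ → List (A γ)) (s₀ : ∀ γ → S γ) →
             PT e (λ γ → encL (eA γ) (xs γ)) → PT e (λ γ → eS γ (s₀ γ)) → Step {e = e} eA eS f →
             (∃ λ G → IsPoly G × ∀ γ ys →
               size (eS γ (List.foldr (f γ) (s₀ γ) ys)) ≤ G (size (e γ) + size (encL (eA γ) ys))) →
             PT e (λ γ → eS γ (List.foldr (f γ) (s₀ γ) (xs γ)))
    foldrᴾ xs s₀ list init step (G , (a , b , G≤) , bounded) =
      recode (λ γ → cong (eS γ) (List.reverse-foldl (flip (f γ)) (s₀ γ) (xs γ)))
        (foldlᴾ {e = e} eA eS f (λ γ → reverse (xs γ)) s₀ (reverseᴾ eA xs list) init step (proj₁ bound , proj₁ (proj₂ bound) , within))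
      where
      c = proj₁ (small list)
      d = proj₁ (proj₂ (small list))

      bound : IsPoly (λ n → a * (n + c * n ^ d) ^ b)
      bound = poly-monomial (poly-+ poly-id (poly-monomial poly-id c d)) a b

      within : ∀ γ us vs → us ++ vs ≡ reverse (xs γ) →
               size (eS γ (List.foldl (flip (f γ)) (s₀ γ) us)) ≤ proj₁ bound * size (e γ) ^ proj₁ (proj₂ bound)
      within γ us vs eq = begin
        size (eS γ (List.foldl (flip (f γ)) (s₀ γ) us))
          ≡⟨ cong (λ ws → size (eS γ (List.foldl (flip (f γ)) (s₀ γ) ws))) (List.reverse-involutive us) ⟨
        size (eS γ (List.foldl (flip (f γ)) (s₀ γ) (reverse (reverse us))))
          ≡⟨ cong (size ∘ eS γ) (List.reverse-foldl (flip (f γ)) (s₀ γ) (reverse us)) ⟩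
        size (eS γ (List.foldr (f γ) (s₀ γ) (reverse us)))
          ≤⟨ bounded γ (reverse us) ⟩
        G (size (e γ) + size (encL (eA γ) (reverse us)))
          ≤⟨ G≤ _ (≤-trans (size≥1 (e γ)) (m≤m+n _ _)) ⟩
        a * (size (e γ) + size (encL (eA γ) (reverse us))) ^ b
          ≤⟨ monomial-mono a b (+-monoʳ-≤ (size (e γ)) list≤) ⟩
        a * (size (e γ) + c * size (e γ) ^ d) ^ b
          ≤⟨ proj₂ (proj₂ bound) (size (e γ)) (size≥1 (e γ)) ⟩
        proj₁ bound * size (e γ) ^ proj₁ (proj₂ bound) ∎
        where
        open ≤-Reasoning
        list≤ : size (encL (eA γ) (reverse us)) ≤ c * size (e γ) ^ d
        list≤ = ≤-trans (≤-reflexive (size-reverse (eA γ) us)) (≤-trans (size-prefix (eA γ) us vs)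
          (≤-trans (≤-reflexive (trans (cong (size ∘ encL (eA γ)) eq) (size-reverse (eA γ) (xs γ))))
            (proj₂ (proj₂ (small list)) γ)))

    -- The growth must not depend on the state, whose size could otherwise double at each step.
    foldr⁺ᴾ : ∀ (xs : ∀ γ → List (A γ)) (s₀ : ∀ γ → S γ) →
              PT e (λ γ → encL (eA γ) (xs γ)) → PT e (λ γ → eS γ (s₀ γ)) → Step {e = e} eA eS f →
              (∃ λ G → IsPoly G × ∀ γ x s → size (eS γ (f γ x s)) ≤ size (eS γ s) + G (size (e γ) + size (eA γ x))) →
              PT e (λ γ → eS γ (List.foldr (f γ) (s₀ γ) (xs γ)))
    foldr⁺ᴾ xs s₀ list init step (G , (a , b , G≤) , adds) with small init
    ... | c , d , init≤ = foldrᴾ xs s₀ list init step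
      ( (λ m → c * m ^ d + m * (a * m ^ b))
      , poly-+ (poly-monomial poly-id c d) (poly-* poly-id (poly-monomial poly-id a b))
      , λ γ ys → ≤-trans (total γ ys) (+-mono-≤ (≤-trans (init≤ γ) (monomial-mono c d (m≤m+n (size (e γ)) (size (encL (eA γ) ys)))))
          (*-monoˡ-≤ _ (m≤n+m (size (encL (eA γ) ys)) (size (e γ))))) )
      where
      total : ∀ γ ys → size (eS γ (List.foldr (f γ) (s₀ γ) ys)) ≤
              size (eS γ (s₀ γ)) + size (encL (eA γ) ys) * (a * (size (e γ) + size (encL (eA γ) ys)) ^ b)
      total γ []       = m≤m+n _ _
      total γ (y ∷ ys) = begin
        size (eS γ (f γ y (List.foldr (f γ) (s₀ γ) ys)))
          ≤⟨ adds γ y _ ⟩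
        size (eS γ (List.foldr (f γ) (s₀ γ) ys)) + G (size (e γ) + size (eA γ y))
          ≤⟨ +-mono-≤ (total γ ys) (G≤ _ (≤-trans (size≥1 (e γ)) (m≤m+n _ _))) ⟩
        (size (eS γ (s₀ γ)) + L * (a * (size (e γ) + L) ^ b)) + a * (size (e γ) + size (eA γ y)) ^ b
          ≤⟨ +-mono-≤ (+-monoʳ-≤ _ (*-monoʳ-≤ L (monomial-mono a b (+-monoʳ-≤ (size (e γ)) L≤))))
               (monomial-mono a b (+-monoʳ-≤ (size (e γ)) y≤)) ⟩
        (size (eS γ (s₀ γ)) + L * Q) + Q
          ≡⟨ solve 3 (λ s l q → (s :+ l :* q) :+ q := s :+ (con 1 :+ l) :* q) refl (size (eS γ (s₀ γ))) L Q ⟩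
        size (eS γ (s₀ γ)) + suc L * Q
          ≤⟨ +-monoʳ-≤ (size (eS γ (s₀ γ))) (*-monoˡ-≤ Q (s≤s (m≤n+m L (size (eA γ y))))) ⟩
        size (eS γ (s₀ γ)) + size (encL (eA γ) (y ∷ ys)) * Q ∎
        where
        open ≤-Reasoning
        open +-*-Solver using (solve; _:+_; _:*_; _:=_; con)
        L = size (encL (eA γ) ys)
        Q = a * (size (e γ) + size (encL (eA γ) (y ∷ ys))) ^ b
        L≤ : L ≤ size (encL (eA γ) (y ∷ ys))
        L≤ = m≤n⇒m≤1+n (m≤n+m L (size (eA γ y)))
        y≤ : size (eA γ y) ≤ size (encL (eA γ) (y ∷ ys))
        y≤ = m≤n⇒m≤1+n (m≤m+n (size (eA γ y)) L)

  mapᴾ : ∀ {A : Γ → Set} (eA : ∀ γ → A γ → Val) (xs : ∀ γ → List (A γ)) (h : ∀ γ → A γ → Val) →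
         PT e (λ γ → encL (eA γ) (xs γ)) → PT {Σ Γ A} (λ (γ , a) → pair (e γ) (eA γ a)) (λ (γ , a) → h γ a) →
         PT e (λ γ → encL (h γ) (xs γ))
  mapᴾ {e = e} {A = A} eA xs h list elem with small elem
  ... | a , b , small≤ = recode (λ γ → cong encodeList (sym (map≡foldr γ (xs γ))))
    (foldr⁺ᴾ {e = e} {S = λ _ → List Val} eA (λ _ → encodeList) (λ γ x → h γ x ∷_) xs (λ _ → [])
      list (constᴾ (+ 0)) (pairᴾ (outerᴾ ⨾ᴾ reindex (λ (γ , x , s) → γ , x) elem) innerᴾ)
      ( (λ m → suc (a * suc m ^ b))
      , poly-+ (poly-const 1) (poly-monomial (poly-+ (poly-const 1) poly-id) a b)
      , λ γ x s → ≤-trans (s≤s (≤-trans (≤-reflexive (+-comm (size (h γ x)) _)) (+-monoʳ-≤ _ (small≤ (γ , x)))))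
          (≤-reflexive (sym (+-suc _ _)))))
    where
    map≡foldr : ∀ γ as → List.map (h γ) as ≡ List.foldr (λ x → h γ x ∷_) [] as
    map≡foldr γ []       = refl
    map≡foldr γ (x ∷ as) = cong (h γ x ∷_) (map≡foldr γ as)

  -- Folds over lists

  allᴾ : ∀ {A : Γ → Set} (eA : ∀ γ → A γ → Val) (xs : ∀ γ → List (A γ)) (p : ∀ γ → A γ → Bool) →
         PT e (λ γ → encL (eA γ) (xs γ)) → PT {Σ Γ A} (λ (γ , a) → pair (e γ) (eA γ a)) (λ (γ , a) → boolᵛ (p γ a)) →
         PT e (λ γ → boolᵛ (allᵇ (p γ) (xs γ)))
  allᴾ {e = e} eA xs p list elem = foldr⁺ᴾ {e = e} {S = λ _ → Bool} eA (λ _ → boolᵛ) (λ γ a b → p γ a ∧ b)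
    xs (λ _ → true) list (constᴾ (+ 1)) (andᴾ (outerᴾ ⨾ᴾ reindex (λ (γ , a , b) → γ , a) elem) innerᴾ)
    ( (λ _ → 1) , poly-const 1 , λ γ a b → ≤-trans (≤-reflexive (size-boolᵛ (p γ a ∧ b))) (m≤n+m 1 (size (boolᵛ b))) )

  module _ {A : Set} where

    nextTag : List (ℕ × A) → ℕ
    nextTag []            = 0
    nextTag ((k , _) ∷ _) = suc k

    pushTagged : A → List (ℕ × A) → List (ℕ × A)
    pushTagged x s = (nextTag s , x) ∷ s

    tagged : List A → List (ℕ × A)
    tagged = List.foldr pushTagged []

    nextTag-tagged : ∀ xs → nextTag (tagged xs) ≡ length xs
    nextTag-tagged []       = refl
    nextTag-tagged (x ∷ xs) = cong suc (nextTag-tagged xs)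

    -- A right fold meets the last entry first, so the numbering runs from the end and yields
    -- `opposite`.
    tagged-tabulate : ∀ {n} (o : Fin n → A) → tagged (List.tabulate o) ≡ List.tabulate (λ i → toℕ (opposite i) , o i)
    tagged-tabulate {zero}  o = refl
    tagged-tabulate {suc n} o = cong₂ _∷_
      (cong (_, o zero) (trans (nextTag-tagged (List.tabulate (o ∘ suc)))
        (trans (List.length-tabulate (o ∘ suc)) (sym (Fin.toℕ-fromℕ n)))))
      (trans (tagged-tabulate (o ∘ suc)) (List.tabulate-cong λ i → cong (_, o (suc i)) (sym (Fin.toℕ-inject₁ (opposite i)))))

  eTagged : ℕ × Val → Val
  eTagged (k , v) = pair (int (+ k)) v

  size-tagged : ∀ vs → size (encL eTagged (tagged vs)) ≤ size (encL id vs) + length vs * (2 + length vs)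
  size-tagged []       = s≤s z≤n
  size-tagged (v ∷ vs) = begin
    suc (suc (sizeℤ (+ nextTag (tagged vs)) + size v) + size (encL eTagged (tagged vs)))
      ≤⟨ s≤s (+-mono-≤ (s≤s (+-monoˡ-≤ (size v) tag≤)) (size-tagged vs)) ⟩
    suc (suc (suc ℓ + size v) + (L + ℓ * (2 + ℓ)))
      ≤⟨ m≤m+n _ (suc ℓ) ⟩
    suc (suc (suc ℓ + size v) + (L + ℓ * (2 + ℓ))) + suc ℓ
      ≡⟨ solve 3 (λ l v m → (con 1 :+ ((con 1 :+ ((con 1 :+ l) :+ v)) :+ (m :+ l :* (con 2 :+ l)))) :+ (con 1 :+ l)
           := (con 1 :+ (v :+ m)) :+ (con 1 :+ l) :* (con 3 :+ l) :+ (con 0)) refl ℓ (size v) L ⟩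
    suc (size v + L) + suc ℓ * (3 + ℓ) + 0
      ≡⟨ +-identityʳ _ ⟩
    suc (size v + L) + suc ℓ * (3 + ℓ) ∎
    where
    open ≤-Reasoning
    open +-*-Solver using (solve; _:+_; _:*_; _:=_; con)
    ℓ = length vs
    L = size (encL id vs)

    n≤2^n : ∀ n → n ≤ 2 ^ n
    n≤2^n zero    = z≤n
    n≤2^n (suc n) = +-mono-≤ (^-monoʳ-≤ 2 (z≤n {n})) (≤-trans (n≤2^n n) (m≤m+n (2 ^ n) 0))

    tag≤ : sizeℤ (+ nextTag (tagged vs)) ≤ suc ℓ
    tag≤ = ≤-trans (≤-reflexive (cong (λ k → sizeℤ (+ k)) (nextTag-tagged vs))) (size≤ (+ ℓ) (n≤2^n ℓ))

  tagᴾ : ∀ {n : Γ → ℕ} (o : ∀ γ → Fin (n γ) → Val) → PT e (λ γ → encodeFamily (o γ)) →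
         PT e (λ γ → encL (λ i → pair (int (+ toℕ (opposite i))) (o γ i)) (allFin (n γ)))
  tagᴾ {e = e} {n} o list = recode (λ γ → cong encodeList (trans
      (cong (List.map eTagged) (tagged-tabulate (o γ)))
      (trans (List.map-tabulate _ eTagged) (sym (List.map-tabulate id _)))))
    (foldrᴾ {e = e} {A = λ _ → Val} {S = λ _ → List (ℕ × Val)} (λ _ → id) (λ _ → encL eTagged) (λ _ → pushTagged)
      (λ γ → List.tabulate (o γ)) (λ _ → []) (recode (λ γ → cong encodeList (sym (List.map-id (List.tabulate (o γ))))) list)
      (constᴾ (+ 0)) (pairᴾ (pairᴾ next (sndᴾ outerᴾ)) innerᴾ)
      ( (λ m → m + m * (2 + m))
      , poly-+ poly-id (poly-* poly-id (poly-+ (poly-const 2) poly-id))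
      , λ γ vs → ≤-trans (size-tagged vs) (+-mono-≤ (m≤n+m _ (size (e γ)))
          (*-mono-≤ (≤-trans (length≤size id vs) (m≤n+m _ (size (e γ)))) (+-monoʳ-≤ 2 (≤-trans (length≤size id vs) (m≤n+m _ (size (e γ)))))))))
    where
    next : PT {Σ[ γ ∈ _ ] Val × List (ℕ × Val)} (λ (γ , v , s) → pair (pair (e γ) v) (encL eTagged s))
              (λ (γ , v , s) → int (+ nextTag s))
    next = recode (λ { (γ , v , []) → refl ; (γ , v , (k , w) ∷ s) → refl })
      (ifᴾ {b = λ (γ , v , s) → nonempty s}
        (recode (λ { (γ , v , []) → refl ; (γ , v , _ ∷ s) → refl }) (innerᴾ ⨾ᴾ primᴾ isPair))
        (pairᴾ (constᴾ (+ 1)) (innerᴾ ⨾ᴾ primᴾ fst ⨾ᴾ primᴾ fst) ⨾ᴾ primᴾ add) (constᴾ (+ 0)))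

  -- Lists have no random access, so the entry is found by tagging the list and scanning it for the
  -- wanted tag.
  pickᴾ : ∀ {n : Γ → ℕ} (c : ∀ γ → Fin (n γ) → ℕ) (i : ∀ γ → Fin (n γ)) →
          PT e (λ γ → encodeFamily (λ j → encodeℕ (c γ j))) → PT e (λ γ → int (+ toℕ (opposite (i γ)))) →
          PT e (λ γ → int (+ c γ (i γ)))
  pickᴾ {e = e} {n} c i list index = recode (λ γ → cong (int ∘ +_) (pick-allFin (c γ) (i γ)))
    (foldr⁺ᴾ {e = e} {S = λ _ → ℕ} (λ γ j → pair (int (+ toℕ (opposite j))) (int (+ c γ j))) (λ _ → int ∘ +_)
      (λ γ → choose (c γ) (i γ)) (λ γ → allFin (n γ)) (λ _ → 0) (tagᴾ (λ γ j → int (+ c γ j)) list) (constᴾ (+ 0))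
      (recode (λ (γ , j , k) → sym (if-float (int ∘ +_) (does (j Fin.≟ i γ))))
        (ifᴾ {b = λ (γ , j , k) → does (j Fin.≟ i γ)}
          (recode (λ (γ , j , k) → cong boolᵛ (same j (i γ)))
            (andᴾ (leqᴾ (fstᴾ (sndᴾ outerᴾ)) (outerᴾ ⨾ᴾ outerᴾ ⨾ᴾ reindex proj₁ index))
                  (leqᴾ (outerᴾ ⨾ᴾ outerᴾ ⨾ᴾ reindex proj₁ index) (fstᴾ (sndᴾ outerᴾ)))))
          (sndᴾ (sndᴾ outerᴾ)) innerᴾ))
      ( suc , poly-+ (poly-const 1) poly-id , λ γ j k → adds γ j k ))
    where
    choose : ∀ {m} → (Fin m → ℕ) → Fin m → Fin m → ℕ → ℕ
    choose c i j k = if does (j Fin.≟ i) then c j else k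

    pick-∈ : ∀ {m} (c : Fin m → ℕ) i {js} → i ∈ₗ js → List.foldr (choose c i) 0 js ≡ c i
    pick-∈ c i {j ∷ js} i∈ with j Fin.≟ i
    pick-∈ c i {j ∷ js} i∈           | yes refl = refl
    pick-∈ c i {j ∷ js} (here refl)  | no j≢i = contradiction refl j≢i
    pick-∈ c i {j ∷ js} (there i∈)   | no j≢i = pick-∈ c i i∈

    pick-allFin : ∀ {m} (c : Fin m → ℕ) i → List.foldr (choose c i) 0 (allFin m) ≡ c i
    pick-allFin c i = pick-∈ c i (∈-allFin i)
      where open import Data.List.Membership.Propositional.Properties using (∈-allFin)

    adds : ∀ γ j k → sizeℤ (+ choose (c γ) (i γ) j k) ≤
           sizeℤ (+ k) + suc (size (e γ) + size (pair (int (+ toℕ (opposite j))) (int (+ c γ j))))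
    adds γ j k with does (j Fin.≟ i γ)
    ... | false = m≤m+n _ _
    ... | true  = ≤-trans (m≤n⇒m≤1+n (m≤n+m (sizeℤ (+ c γ j)) (sizeℤ (+ toℕ (opposite j)))))
      (≤-trans (m≤n⇒m≤1+n (m≤n+m _ (size (e γ)))) (m≤n+m _ (sizeℤ (+ k))))

    same : ∀ {m} (j i : Fin m) → does (+ toℕ (opposite j) ℤ.≤? + toℕ (opposite i)) ∧
           does (+ toℕ (opposite i) ℤ.≤? + toℕ (opposite j)) ≡ does (j Fin.≟ i)
    same j i = ≡true-cong
      (λ eq → dec-true (j Fin.≟ i) (trans (sym (Fin.opposite-involutive j)) (trans (cong opposite (Fin.toℕ-injective
        (ℤ.+-injective (ℤ.≤-antisym (does⁻ (+ toℕ (opposite j) ℤ.≤? + toℕ (opposite i)) (proj₁ (∧⁻ eq)))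
          (does⁻ (+ toℕ (opposite i) ℤ.≤? + toℕ (opposite j)) (proj₂ (∧⁻ {does (+ toℕ (opposite j) ℤ.≤? + toℕ (opposite i))} eq)))))))
        (Fin.opposite-involutive i))))
      λ eq → let j≡i = cong (+_ ∘ toℕ ∘ opposite) (does⁻ (j Fin.≟ i) eq) in
        ∧⁺ (dec-true (+ toℕ (opposite j) ℤ.≤? + toℕ (opposite i)) (ℤ.≤-reflexive j≡i))
           (dec-true (+ toℕ (opposite i) ℤ.≤? + toℕ (opposite j)) (ℤ.≤-reflexive (sym j≡i)))

  -- Rational arithmetic.  Values that are not in the input are computed
  -- without reducing fractions.

  encᵘ : ℚᵘ → Val
  encᵘ q = pair (int (ℚᵘ.↥ q)) (int (ℚᵘ.↧ q))

  encᵘ-+ : ∀ p q → pair (int (ℚᵘ.↥ p ℤ.* ℚᵘ.↧ q ℤ.+ ℚᵘ.↥ q ℤ.* ℚᵘ.↧ p)) (int (ℚᵘ.↧ p ℤ.* ℚᵘ.↧ q)) ≡ encᵘ (p ℚᵘ.+ q)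
  encᵘ-+ (mkℚᵘ _ _) (mkℚᵘ _ _) = refl

  encᵘ-* : ∀ p q → pair (int (ℚᵘ.↥ p ℤ.* ℚᵘ.↥ q)) (int (ℚᵘ.↧ p ℤ.* ℚᵘ.↧ q)) ≡ encᵘ (p ℚᵘ.* q)
  encᵘ-* (mkℚᵘ _ _) (mkℚᵘ _ _) = refl

  encᵘ-toℚᵘ : ∀ q → encodeℚ q ≡ encᵘ (toℚᵘ q)
  encᵘ-toℚᵘ (mkℚ _ _ _) = refl

  addᵘᴾ : ∀ {u v : Γ → ℚᵘ} → PT e (encᵘ ∘ u) → PT e (encᵘ ∘ v) → PT e (λ γ → encᵘ (u γ ℚᵘ.+ v γ))
  addᵘᴾ {u = u} {v} s t = recode (λ γ → encᵘ-+ (u γ) (v γ))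
    (pairᴾ (addᴾ (mulᴾ (fstᴾ s) (sndᴾ t)) (mulᴾ (fstᴾ t) (sndᴾ s))) (mulᴾ (sndᴾ s) (sndᴾ t)))

  mulᵘᴾ : ∀ {u v : Γ → ℚᵘ} → PT e (encᵘ ∘ u) → PT e (encᵘ ∘ v) → PT e (λ γ → encᵘ (u γ ℚᵘ.* v γ))
  mulᵘᴾ {u = u} {v} s t = recode (λ γ → encᵘ-* (u γ) (v γ)) (pairᴾ (mulᴾ (fstᴾ s) (fstᴾ t)) (mulᴾ (sndᴾ s) (sndᴾ t)))

  toᵘᴾ : ∀ {x : Γ → ℚ} → PT e (encodeℚ ∘ x) → PT e (λ γ → encᵘ (toℚᵘ (x γ)))
  toᵘᴾ {x = x} = recode (λ γ → encᵘ-toℚᵘ (x γ))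

  leqᵘᴾ : ∀ {u v : Γ → ℚᵘ} → PT e (encᵘ ∘ u) → PT e (encᵘ ∘ v) → PT e (λ γ → boolᵛ (does (u γ ℚᵘ.≤? v γ)))
  leqᵘᴾ s t = leqᴾ (mulᴾ (fstᴾ s) (sndᴾ t)) (mulᴾ (fstᴾ t) (sndᴾ s))

  infix 4 _~_
  -- A computed fraction represents its exact value only up to equivalence. That is enough, because
  -- computed fractions enter the result solely through comparisons, and these respect `≃`.
  _~_ : ℚ → ℚᵘ → Set
  x ~ u = toℚᵘ x ≃ u

  ~-≤? : ∀ {x y u v} → x ~ u → y ~ v → does (u ℚᵘ.≤? v) ≡ does (x ℚ.≤? y)
  ~-≤? {x} {y} {u} {v} x~u y~v = ≡true-cong
    (λ eq → dec-true (x ℚ.≤? y) (ℚ.toℚᵘ-cancel-≤ (ℚᵘ.≤-respʳ-≃ (ℚᵘ.≃-sym y~v) (ℚᵘ.≤-respˡ-≃ (ℚᵘ.≃-sym x~u) (does⁻ (u ℚᵘ.≤? v) eq)))))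
    (λ eq → dec-true (u ℚᵘ.≤? v) (ℚᵘ.≤-respʳ-≃ y~v (ℚᵘ.≤-respˡ-≃ x~u (ℚ.toℚᵘ-mono-≤ (does⁻ (x ℚ.≤? y) eq)))))

  ~-+ : ∀ {x y u v} → x ~ u → y ~ v → x ℚ.+ y ~ u ℚᵘ.+ v
  ~-+ {x} {y} x~u y~v = ℚᵘ.≃-trans (ℚ.toℚᵘ-homo-+ x y) (ℚᵘ.+-cong x~u y~v)

  ~-* : ∀ {x y u v} → x ~ u → y ~ v → x ℚ.* y ~ u ℚᵘ.* v
  ~-* {x} {y} x~u y~v = ℚᵘ.≃-trans (ℚ.toℚᵘ-homo-* x y) (ℚᵘ.*-cong x~u y~v)

  ~-if : ∀ b {x y u v} → x ~ u → y ~ v → (if b then x else y) ~ (if b then u else v)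
  ~-if true  x~u _ = x~u
  ~-if false _ y~v = y~v

  leq~ᴾ : ∀ {x y : Γ → ℚ} {u v : Γ → ℚᵘ} → (∀ γ → x γ ~ u γ) → (∀ γ → y γ ~ v γ) →
          PT e (encᵘ ∘ u) → PT e (encᵘ ∘ v) → PT e (λ γ → boolᵛ (does (x γ ℚ.≤? y γ)))
  leq~ᴾ {x = x} {y} {u} {v} x~u y~v s t = recode (λ γ → cong boolᵛ (~-≤? (x~u γ) (y~v γ))) (leqᵘᴾ {u = u} {v} s t)

  leqℚᴾ : ∀ {x y : Γ → ℚ} → PT e (encodeℚ ∘ x) → PT e (encodeℚ ∘ y) → PT e (λ γ → boolᵛ (does (x γ ℚ.≤? y γ)))
  leqℚᴾ {x = x} {y} s t = leq~ᴾ {x = x} {y} {toℚᵘ ∘ x} {toℚᵘ ∘ y} (λ _ → ℚᵘ.≃-refl) (λ _ → ℚᵘ.≃-refl)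
    (toᵘᴾ {x = x} s) (toᵘᴾ {x = y} t)

  inverseᵘ : ℚᵘ → ℚᵘ
  inverseᵘ (mkℚᵘ +[1+ n ] d) = mkℚᵘ +[1+ d ] n
  inverseᵘ (mkℚᵘ _        _) = 0ℚᵘ

  encᵘ-inverseᵘ : ∀ q → ¬ q ℚ.≤ 0ℚ → pair (int (↧ q)) (int (↥ q)) ≡ encᵘ (inverseᵘ (toℚᵘ q))
  encᵘ-inverseᵘ (mkℚ +[1+ n ] d _) _ = refl
  encᵘ-inverseᵘ q@(mkℚ (+ zero) d _) q≰0 = contradiction (ℚ.nonPositive⁻¹ q) q≰0
  encᵘ-inverseᵘ q@(mkℚ -[1+ n ] d _) q≰0 = contradiction (ℚ.nonPositive⁻¹ q) q≰0

  ~-inverse : ∀ q → ¬ q ℚ.≤ 0ℚ → inverseℚ q ~ inverseᵘ (toℚᵘ q)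
  ~-inverse q@(mkℚ +[1+ n ] d _) _ = ℚᵘ.≃-refl
  ~-inverse q@(mkℚ (+ zero) d _) q≰0 = contradiction (ℚ.nonPositive⁻¹ q) q≰0
  ~-inverse q@(mkℚ -[1+ n ] d _) q≰0 = contradiction (ℚ.nonPositive⁻¹ q) q≰0

  sumᵘ : List ℚᵘ → ℚᵘ
  sumᵘ = List.foldr ℚᵘ._+_ 0ℚᵘ

  -- Denominators multiply, but each summand adds only about its own size to the numbers of bits;
  -- the factor 3 absorbs the carries.
  size-sumᵘ : ∀ us → let L = size (encL encᵘ us) in sizeℤ (ℚᵘ.↥ sumᵘ us) ≤ 3 * L × sizeℤ (ℚᵘ.↧ sumᵘ us) ≤ 3 * L
  size-sumᵘ []       = s≤s z≤n , s≤s z≤n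
  size-sumᵘ (u ∷ us) =
    subst (_≤ 3 * (suc (suc (a + b) + L))) (cong (size ∘ left) (encᵘ-+ u (sumᵘ us))) numerator′ ,
    subst (_≤ 3 * (suc (suc (a + b) + L))) (cong (size ∘ right) (encᵘ-+ u (sumᵘ us))) denominator′
    where
    open +-*-Solver using (solve; _:+_; _:*_; _:=_; con)
    L = size (encL encᵘ us)
    a = sizeℤ (ℚᵘ.↥ u)
    b = sizeℤ (ℚᵘ.↧ u)
    N = ℚᵘ.↥ sumᵘ us
    D = ℚᵘ.↧ sumᵘ us

    left right : Val → Val
    left  = apply fst
    right = apply snd

    total : 3 + (a + b + 3 * L) ≤ 3 * (suc (suc (a + b) + L))
    total = ≤-trans (m≤m+n _ (3 + 2 * (a + b))) (≤-reflexive
      (solve 2 (λ x l → (con 3 :+ (x :+ con 3 :* l)) :+ (con 3 :+ con 2 :* x) := con 3 :* (con 1 :+ ((con 1 :+ x) :+ l))) refl (a + b) L))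

    denominator′ : sizeℤ (ℚᵘ.↧ u ℤ.* D) ≤ 3 * (suc (suc (a + b) + L))
    denominator′ = ≤-trans (size-* (ℚᵘ.↧ u) D) (≤-trans (≤-trans
      (s≤s (+-mono-≤ (m≤n+m b a) (proj₂ (size-sumᵘ us)))) (m≤n+m _ 2)) total)

    numerator′ : sizeℤ (ℚᵘ.↥ u ℤ.* D ℤ.+ N ℤ.* ℚᵘ.↧ u) ≤ 3 * (suc (suc (a + b) + L))
    numerator′ = ≤-trans (size-+ (ℚᵘ.↥ u ℤ.* D) (N ℤ.* ℚᵘ.↧ u)) (≤-trans (+-monoʳ-≤ 2 (⊔-lub
      (≤-trans (size-* (ℚᵘ.↥ u) D) (s≤s (+-mono-≤ (m≤m+n a b) (proj₂ (size-sumᵘ us)))))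
      (≤-trans (size-* N (ℚᵘ.↧ u)) (s≤s (≤-trans (+-mono-≤ (proj₁ (size-sumᵘ us)) (m≤n+m b a)) (≤-reflexive (+-comm (3 * L) (a + b))))))))
      total)

  sumᵘᴾ : ∀ (us : Γ → List ℚᵘ) → PT e (λ γ → encL encᵘ (us γ)) → PT e (λ γ → encᵘ (sumᵘ (us γ)))
  sumᵘᴾ {e = e} us list = foldrᴾ {e = e} {A = λ _ → ℚᵘ} {S = λ _ → ℚᵘ} (λ _ → encᵘ) (λ _ → encᵘ) (λ _ → ℚᵘ._+_)
    us (λ _ → 0ℚᵘ) list (pairᴾ (constᴾ (+ 0)) (constᴾ (+ 1)))
    (addᵘᴾ {u = λ (γ , u , v) → u} {λ (γ , u , v) → v} (sndᴾ outerᴾ) innerᴾ)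
    ( (λ m → 1 + (3 * m + 3 * m))
    , poly-+ (poly-const 1) (poly-+ (poly-* (poly-const 3) poly-id) (poly-* (poly-const 3) poly-id))
    , λ γ vs → s≤s (+-mono-≤ (≤-trans (proj₁ (size-sumᵘ vs)) (*-monoʳ-≤ 3 (m≤n+m _ (size (e γ)))))
                             (≤-trans (proj₂ (size-sumᵘ vs)) (*-monoʳ-≤ 3 (m≤n+m _ (size (e γ)))))) )

  ~-sum : ∀ {A : Set} (as : List A) {f : A → ℚ} {g : A → ℚᵘ} → (∀ a → f a ~ g a) →
          OrderedField.sumᴸ ℚ-orderedField (List.map f as) ~ sumᵘ (List.map g as)
  ~-sum []       f~g = ℚᵘ.≃-refl
  ~-sum (a ∷ as) f~g = ~-+ (f~g a) (~-sum as f~g)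

  -- The approximation algorithm as a program.

  Inst : Set
  Inst = BSHMℚ.Instance

  module Sch = BSHMℚ.Scheduling
  module SchP = SchedulingProperties ℚ-orderedField
  module Alg = Approximation ℚ-orderedField
  module Wt (𝓘 : Inst) = Weights ℚ-orderedField 𝓘 (Alg.kept 𝓘)
  module ℚF = OrderedField ℚ-orderedField
  module ℚFP = OrderedFieldProperties ℚ-orderedField

  -- A type is represented by its data, as in the input. Capacities are strictly increasing, so
  -- comparing them compares types.
  eT : ∀ 𝓘 → Sch.Type 𝓘 → Val
  eT 𝓘 z = pair (encodeℚ (Sch.g 𝓘 z)) (encodeℚ (Sch.r 𝓘 z))

  rawJob : ∀ 𝓘 → Fin (Sch.n 𝓘) → Val
  rawJob 𝓘 J = pair (encodeℚ (Sch.s 𝓘 J)) (pair (encodeℚ (Sch.I⁻ 𝓘 J)) (encodeℚ (Sch.I⁺ 𝓘 J)))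

  -- Jobs with equal data are told apart by a tag.
  eJ : ∀ 𝓘 → Fin (Sch.n 𝓘) → Val
  eJ 𝓘 J = pair (int (+ toℕ (opposite J))) (rawJob 𝓘 J)

  eMaybe : ∀ 𝓘 → Maybe (Sch.Type 𝓘) → Val
  eMaybe 𝓘 nothing  = int (+ 0)
  eMaybe 𝓘 (just z) = eT 𝓘 z

  eEntry : ∀ 𝓘 → Alg.Status 𝓘 → Fin (Sch.n 𝓘) → Val
  eEntry 𝓘 A J = pair (eJ 𝓘 J) (eMaybe 𝓘 (A J))

  eStatus : ∀ 𝓘 → Alg.Status 𝓘 → Val
  eStatus 𝓘 A = encL (eEntry 𝓘 A) (allFin (Sch.n 𝓘))

  wk : ∀ {A : Γ → Set} {eA : ∀ γ → A γ → Val} → PT e o →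
       PT {Σ Γ A} (λ δ → pair (e (proj₁ δ)) (eA (proj₁ δ) (proj₂ δ))) (o ∘ proj₁)
  wk t = outerᴾ ⨾ᴾ reindex proj₁ t

  wk₂ : ∀ {A S : Γ → Set} {eA : ∀ γ → A γ → Val} {eS : ∀ γ → S γ → Val} → PT e o →
        PT {Σ[ γ ∈ Γ ] A γ × S γ} (λ δ → pair (pair (e (proj₁ δ)) (eA (proj₁ δ) (proj₁ (proj₂ δ)))) (eS (proj₁ δ) (proj₂ (proj₂ δ))))
           (o ∘ proj₁)
  wk₂ t = outerᴾ ⨾ᴾ outerᴾ ⨾ᴾ reindex proj₁ t

  <?≡not≥? : ∀ x y → does (x ℚF.<? y) ≡ not (does (y ℚ.≤? x))
  <?≡not≥? x y = ≡true-cong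
    (λ eq → cong not (dec-false (y ℚ.≤? x) (ℚFP.<⇒≱ (does⁻ (x ℚF.<? y) eq))))
    (λ eq → dec-true (x ℚF.<? y) (ℚFP.≰⇒> (does⁻¬ (y ℚ.≤? x) (not⁻ eq))))

  g-reflects-< : ∀ 𝓘 {y z : Sch.Type 𝓘} → Sch.g 𝓘 y ℚF.< Sch.g 𝓘 z → y Fin.< z
  g-reflects-< 𝓘 {y} {z} gy<gz = ≰⇒> λ z≤y → ℚFP.<⇒≱ gy<gz (Alg.g-mono-≤ 𝓘 z≤y)

  type<≡ : ∀ 𝓘 (y z : Sch.Type 𝓘) → not (does (Sch.g 𝓘 z ℚ.≤? Sch.g 𝓘 y)) ≡ does (y Fin.<? z)
  type<≡ 𝓘 y z = ≡true-cong
    (λ eq → dec-true (y Fin.<? z) (g-reflects-< 𝓘 (ℚFP.≰⇒> (does⁻¬ (Sch.g 𝓘 z ℚ.≤? Sch.g 𝓘 y) (not⁻ eq)))))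
    (λ eq → cong not (dec-false (Sch.g 𝓘 z ℚ.≤? Sch.g 𝓘 y) (ℚFP.<⇒≱ (Sch.g-mono-< 𝓘 (does⁻ (y Fin.<? z) eq)))))

  pos⇒≰0 : ∀ {q} → 0ℚ ℚF.< q → ¬ q ℚ.≤ 0ℚ
  pos⇒≰0 = ℚFP.<⇒≱

  ρᵘ : ∀ 𝓘 → Sch.Type 𝓘 → ℚᵘ
  ρᵘ 𝓘 z = toℚᵘ (Sch.r 𝓘 z) ℚᵘ.* inverseᵘ (toℚᵘ (Sch.g 𝓘 z))

  ~-ρ : ∀ 𝓘 z → SchP.ρ 𝓘 z ~ ρᵘ 𝓘 z
  ~-ρ 𝓘 z = ~-* {Sch.r 𝓘 z} {inverseℚ (Sch.g 𝓘 z)} ℚᵘ.≃-refl (~-inverse (Sch.g 𝓘 z) (pos⇒≰0 (Sch.g-positive 𝓘 z)))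

  minᵘ : ℚᵘ → ℚᵘ → ℚᵘ
  minᵘ u v = if does (u ℚᵘ.≤? v) then u else v

  includeᵘ : Bool → ℚᵘ → ℚᵘ → ℚᵘ
  includeᵘ b u v = if b then minᵘ u v else v

  job·ρᵘ : ∀ 𝓘 → Fin (Sch.n 𝓘) → Sch.Type 𝓘 → ℚᵘ
  job·ρᵘ 𝓘 J y = toℚᵘ (Sch.s 𝓘 J) ℚᵘ.* ρᵘ 𝓘 y

  ~-job·ρ : ∀ 𝓘 J y → Sch.s 𝓘 J ℚ.* SchP.ρ 𝓘 y ~ job·ρᵘ 𝓘 J y
  ~-job·ρ 𝓘 J y = ~-* {Sch.s 𝓘 J} {SchP.ρ 𝓘 y} ℚᵘ.≃-refl (~-ρ 𝓘 y)

  cheapestᵘ : ∀ 𝓘 → Sch.Type 𝓘 → Fin (Sch.n 𝓘) → List (Sch.Type 𝓘) → ℚᵘ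
  cheapestᵘ 𝓘 z J = List.foldr (λ y → includeᵘ (does (Wt.lower? 𝓘 z J y)) (job·ρᵘ 𝓘 J y)) (toℚᵘ (Sch.r 𝓘 z))

  weightᵘ : ∀ 𝓘 → Sch.Type 𝓘 → Fin (Sch.n 𝓘) → ℚᵘ
  weightᵘ 𝓘 z J = cheapestᵘ 𝓘 z J (Alg.kept 𝓘)

  ~-cheapest : ∀ 𝓘 z J ys → Wt.cheapest 𝓘 z J ys ~ cheapestᵘ 𝓘 z J ys
  ~-cheapest 𝓘 z J []       = ℚᵘ.≃-refl
  ~-cheapest 𝓘 z J (y ∷ ys) = ~-if (does (Wt.lower? 𝓘 z J y)) minimum (~-cheapest 𝓘 z J ys)
    where
    x x′ : ℚ
    x  = Sch.s 𝓘 J ℚ.* SchP.ρ 𝓘 y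
    x′ = Wt.cheapest 𝓘 z J ys

    minimum : (if does (x ℚ.≤? x′) then x else x′) ~ minᵘ (job·ρᵘ 𝓘 J y) (cheapestᵘ 𝓘 z J ys)
    minimum = subst (λ b → (if b then x else x′) ~ minᵘ (job·ρᵘ 𝓘 J y) (cheapestᵘ 𝓘 z J ys))
      (~-≤? {x} {x′} (~-job·ρ 𝓘 J y) (~-cheapest 𝓘 z J ys))
      (~-if (does (job·ρᵘ 𝓘 J y ℚᵘ.≤? cheapestᵘ 𝓘 z J ys)) {x} {x′} (~-job·ρ 𝓘 J y) (~-cheapest 𝓘 z J ys))

  loadTerm : ∀ 𝓘 → Alg.Status 𝓘 → Sch.Type 𝓘 → ℚ → Fin (Sch.n 𝓘) → Bool
  loadTerm 𝓘 A z t J = Alg.candidateᵇ 𝓘 A z J ∧ does (Sch._∈I?_ 𝓘 t J)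

  loadᵘ : ∀ 𝓘 → Alg.Status 𝓘 → Sch.Type 𝓘 → ℚ → ℚᵘ
  loadᵘ 𝓘 A z t = sumᵘ (List.map (λ J → if loadTerm 𝓘 A z t J then weightᵘ 𝓘 z J else 0ℚᵘ) (allFin (Sch.n 𝓘)))

  ~-load : ∀ 𝓘 A z t → Alg.loadᴬ 𝓘 A z t ~ loadᵘ 𝓘 A z t
  ~-load 𝓘 A z t = ~-sum (allFin (Sch.n 𝓘)) λ J →
    ~-if (loadTerm 𝓘 A z t J) {Wt.weight 𝓘 z J} {0ℚ} (~-cheapest 𝓘 z J (Alg.kept 𝓘)) ℚᵘ.≃-refl

  module _ (I : Γ → Inst) where

    private
      T : Γ → Set
      T γ = Sch.Type (I γ)

      J? : Γ → Set
      J? γ = Fin (Sch.n (I γ))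

    ρᴾ : (z : ∀ γ → T γ) → PT e (λ γ → eT (I γ) (z γ)) → PT e (λ γ → encᵘ (ρᵘ (I γ) (z γ)))
    ρᴾ z zt = mulᵘᴾ {u = λ γ → toℚᵘ (Sch.r (I γ) (z γ))} {λ γ → inverseᵘ (toℚᵘ (Sch.g (I γ) (z γ)))}
      (toᵘᴾ {x = λ γ → Sch.r (I γ) (z γ)} (sndᴾ zt))
      (recode (λ γ → encᵘ-inverseᵘ (Sch.g (I γ) (z γ)) (pos⇒≰0 (Sch.g-positive (I γ) (z γ))))
        (pairᴾ (sndᴾ (fstᴾ zt)) (fstᴾ (fstᴾ zt))))

    sᴾ : (J : ∀ γ → J? γ) → PT e (λ γ → eJ (I γ) (J γ)) → PT e (λ γ → encodeℚ (Sch.s (I γ) (J γ)))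
    sᴾ J jt = fstᴾ (sndᴾ jt)

    I⁻ᴾ : (J : ∀ γ → J? γ) → PT e (λ γ → eJ (I γ) (J γ)) → PT e (λ γ → encodeℚ (Sch.I⁻ (I γ) (J γ)))
    I⁻ᴾ J jt = fstᴾ (sndᴾ (sndᴾ jt))

    I⁺ᴾ : (J : ∀ γ → J? γ) → PT e (λ γ → eJ (I γ) (J γ)) → PT e (λ γ → encodeℚ (Sch.I⁺ (I γ) (J γ)))
    I⁺ᴾ J jt = sndᴾ (sndᴾ (sndᴾ jt))

    job·ρᴾ : (J : ∀ γ → J? γ) (y : ∀ γ → T γ) → PT e (λ γ → eJ (I γ) (J γ)) → PT e (λ γ → eT (I γ) (y γ)) →
             PT e (λ γ → encᵘ (job·ρᵘ (I γ) (J γ) (y γ)))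
    job·ρᴾ J y jt yt = mulᵘᴾ {u = λ γ → toℚᵘ (Sch.s (I γ) (J γ))} {λ γ → ρᵘ (I γ) (y γ)}
      (toᵘᴾ {x = λ γ → Sch.s (I γ) (J γ)} (sᴾ J jt)) (ρᴾ y yt)

    type<ᴾ : (y z : ∀ γ → T γ) → PT e (λ γ → eT (I γ) (y γ)) → PT e (λ γ → eT (I γ) (z γ)) →
             PT e (λ γ → boolᵛ (does (y γ Fin.<? z γ)))
    type<ᴾ y z yt zt = recode (λ γ → cong boolᵛ (type<≡ (I γ) (y γ) (z γ)))
      (notᴾ {b = λ γ → does (Sch.g (I γ) (z γ) ℚ.≤? Sch.g (I γ) (y γ))}
        (leqℚᴾ {x = λ γ → Sch.g (I γ) (z γ)} {λ γ → Sch.g (I γ) (y γ)} (fstᴾ zt) (fstᴾ yt)))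

    fitsᴾ : (J : ∀ γ → J? γ) (y : ∀ γ → T γ) → PT e (λ γ → eJ (I γ) (J γ)) → PT e (λ γ → eT (I γ) (y γ)) →
            PT e (λ γ → boolᵛ (does (Sch.s (I γ) (J γ) ℚ.≤? Sch.g (I γ) (y γ))))
    fitsᴾ J y jt yt = leqℚᴾ {x = λ γ → Sch.s (I γ) (J γ)} {λ γ → Sch.g (I γ) (y γ)} (sᴾ J jt) (fstᴾ yt)

    lowerᴾ : (z : ∀ γ → T γ) (J : ∀ γ → J? γ) (y : ∀ γ → T γ) →
             PT e (λ γ → eT (I γ) (z γ)) → PT e (λ γ → eJ (I γ) (J γ)) → PT e (λ γ → eT (I γ) (y γ)) →
             PT e (λ γ → boolᵛ (does (Wt.lower? (I γ) (z γ) (J γ) (y γ))))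
    lowerᴾ z J y zt jt yt = andᴾ (type<ᴾ y z yt zt) (fitsᴾ J y jt yt)

    activeᴾ : (t : Γ → ℚ) (J : ∀ γ → J? γ) → PT e (λ γ → encodeℚ (t γ)) → PT e (λ γ → eJ (I γ) (J γ)) →
              PT e (λ γ → boolᵛ (does (Sch._∈I?_ (I γ) (t γ) (J γ))))
    activeᴾ t J tt jt = andᴾ (leqℚᴾ {x = λ γ → Sch.I⁻ (I γ) (J γ)} {t} (I⁻ᴾ J jt) tt)
      (recode (λ γ → cong boolᵛ (sym (<?≡not≥? (t γ) (Sch.I⁺ (I γ) (J γ)))))
        (notᴾ (leqℚᴾ {x = λ γ → Sch.I⁺ (I γ) (J γ)} {t} (I⁺ᴾ J jt) tt)))

  keptOf : Inst → Val
  keptOf 𝓘 = encL (eT 𝓘) (Alg.kept 𝓘)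

  eligibleᴾ : (I : Γ → Inst) → PT e (keptOf ∘ I) →
              (z : ∀ γ → Sch.Type (I γ)) (J : ∀ γ → Fin (Sch.n (I γ))) →
              PT e (λ γ → eT (I γ) (z γ)) → PT e (λ γ → eJ (I γ) (J γ)) →
              PT e (λ γ → boolᵛ (Alg.eligibleᵇ (I γ) (z γ) (J γ)))
  eligibleᴾ {Γ} {e} I kt z J zt jt = andᴾ (fitsᴾ I J z jt zt)
    (allᴾ {e = e} (λ γ → eT (I γ)) (λ γ → Alg.kept (I γ))
      (λ γ y → not (does (Wt.lower? (I γ) (z γ) (J γ) y) ∧ does (SchP.ρ (I γ) y ℚ.≤? SchP.ρ (I γ) (z γ)))) kt
      (notᴾ (andᴾ {b = λ (γ , y) → does (Wt.lower? (I γ) (z γ) (J γ) y)} (lowerᴾ (I ∘ proj₁) (z ∘ proj₁) (J ∘ proj₁) proj₂ (wk zt) (wk jt) innerᴾ)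
        (leq~ᴾ {x = λ (γ , y) → SchP.ρ (I γ) y} {λ (γ , y) → SchP.ρ (I γ) (z γ)}
               {λ (γ , y) → ρᵘ (I γ) y} {λ (γ , y) → ρᵘ (I γ) (z γ)}
          (λ (γ , y) → ~-ρ (I γ) y) (λ (γ , y) → ~-ρ (I γ) (z γ))
          (ρᴾ (I ∘ proj₁) proj₂ innerᴾ) (ρᴾ (I ∘ proj₁) (z ∘ proj₁) (wk zt))))))

  -- A minimum is one of its arguments, so the state grows by at most the size of the new term,
  -- which does not depend on the state.
  size-includeᵘ : ∀ b u v → size (encᵘ (includeᵘ b u v)) ≤ size (encᵘ v) + size (encᵘ u)
  size-includeᵘ false u v = m≤m+n (size (encᵘ v)) (size (encᵘ u))
  size-includeᵘ true  u v with does (u ℚᵘ.≤? v)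
  ... | true  = m≤n+m (size (encᵘ u)) (size (encᵘ v))
  ... | false = m≤m+n (size (encᵘ v)) (size (encᵘ u))

  weightᴾ : (I : Γ → Inst) → PT e (keptOf ∘ I) →
            (z : ∀ γ → Sch.Type (I γ)) (J : ∀ γ → Fin (Sch.n (I γ))) →
            PT e (λ γ → eT (I γ) (z γ)) → PT e (λ γ → eJ (I γ) (J γ)) →
            PT e (λ γ → encᵘ (weightᵘ (I γ) (z γ) (J γ)))
  weightᴾ {Γ} {e} I kt z J zt jt = foldr⁺ᴾ {e = e} {S = λ _ → ℚᵘ} (λ γ → eT (I γ)) (λ _ → encᵘ)
    (λ γ y → includeᵘ (does (Wt.lower? (I γ) (z γ) (J γ) y)) (job·ρᵘ (I γ) (J γ) y))
    (λ γ → Alg.kept (I γ)) (λ γ → toℚᵘ (Sch.r (I γ) (z γ))) kt (toᵘᴾ {x = λ γ → Sch.r (I γ) (z γ)} (sndᴾ zt))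
    (recode (λ (γ , y , u) → float (does (Wt.lower? (I γ) (z γ) (J γ) y)) (job·ρᵘ (I γ) (J γ) y) u)
      (ifᴾ {b = λ (γ , y , u) → does (Wt.lower? (I γ) (z γ) (J γ) y)}
        (lowerᴾ (I ∘ proj₁) (z ∘ proj₁) (J ∘ proj₁) (proj₁ ∘ proj₂) (wk₂ zt) (wk₂ jt) (sndᴾ outerᴾ))
        (ifᴾ {b = λ (γ , y , u) → does (job·ρᵘ (I γ) (J γ) y ℚᵘ.≤? u)}
          (leqᵘᴾ {u = λ (γ , y , u) → job·ρᵘ (I γ) (J γ) y} {λ (γ , y , u) → u} product innerᴾ) product innerᴾ)
        innerᴾ))
    ( (λ m → proj₁ (small term) * suc m ^ proj₁ (proj₂ (small term)))
    , poly-monomial (poly-+ (poly-const 1) poly-id) (proj₁ (small term)) (proj₁ (proj₂ (small term)))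
    , λ γ y u → ≤-trans (size-includeᵘ (does (Wt.lower? (I γ) (z γ) (J γ) y)) (job·ρᵘ (I γ) (J γ) y) u)
        (+-monoʳ-≤ (size (encᵘ u)) (proj₂ (proj₂ (small term)) (γ , y))) )
    where
    float : ∀ b u v → (if b then (if does (u ℚᵘ.≤? v) then encᵘ u else encᵘ v) else encᵘ v) ≡ encᵘ (includeᵘ b u v)
    float false u v = refl
    float true  u v = sym (if-float encᵘ (does (u ℚᵘ.≤? v)))

    term : PT {Σ[ γ ∈ Γ ] Sch.Type (I γ)} (λ (γ , y) → pair (e γ) (eT (I γ) y)) (λ (γ , y) → encᵘ (job·ρᵘ (I γ) (J γ) y))
    term = job·ρᴾ (I ∘ proj₁) (J ∘ proj₁) proj₂ (wk jt) innerᴾ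

    product : PT {Σ[ γ ∈ Γ ] Sch.Type (I γ) × ℚᵘ} (λ (γ , y , u) → pair (pair (e γ) (eT (I γ) y)) (encᵘ u))
                 (λ (γ , y , u) → encᵘ (job·ρᵘ (I γ) (J γ) y))
    product = outerᴾ ⨾ᴾ reindex (λ (γ , y , u) → γ , y) term

  candidateᴾ : (I : Γ → Inst) → PT e (keptOf ∘ I) → (z : ∀ γ → Sch.Type (I γ)) → PT e (λ γ → eT (I γ) (z γ)) →
               (A : ∀ γ → Alg.Status (I γ)) →
               PT {Σ[ γ ∈ Γ ] Fin (Sch.n (I γ))} (λ (γ , J) → pair (e γ) (eEntry (I γ) (A γ) J))
                  (λ (γ , J) → boolᵛ (Alg.candidateᵇ (I γ) (A γ) (z γ) J))
  candidateᴾ I kt z zt A = andᴾ {b = λ (γ , J) → is-nothing (A γ J)}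
    (notᴾ (recode (λ (γ , J) → isPair-eMaybe (I γ) (A γ J)) (sndᴾ innerᴾ ⨾ᴾ primᴾ isPair)))
    (eligibleᴾ (I ∘ proj₁) (wk kt) (z ∘ proj₁) proj₂ (wk zt) (fstᴾ innerᴾ))
    where
    isPair-eMaybe : ∀ 𝓘 a → apply isPair (eMaybe 𝓘 a) ≡ boolᵛ (is-just a)
    isPair-eMaybe 𝓘 nothing  = refl
    isPair-eMaybe 𝓘 (just _) = refl

  module _ {Γ : Set} {e : Γ → Val} (I : Γ → Inst) (kt : PT e (keptOf ∘ I))
           (z : ∀ γ → Sch.Type (I γ)) (zt : PT e (λ γ → eT (I γ) (z γ)))
           (A : ∀ γ → Alg.Status (I γ)) (at : PT e (λ γ → eStatus (I γ) (A γ))) where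

    loadᴾ : (t : Γ → ℚ) → PT e (encodeℚ ∘ t) → PT e (λ γ → encᵘ (loadᵘ (I γ) (A γ) (z γ) (t γ)))
    loadᴾ t tt = sumᵘᴾ {e = e} (λ γ → List.map (summand γ) (allFin (Sch.n (I γ))))
      (recode (λ γ → cong encodeList (List.map-∘ (allFin (Sch.n (I γ)))))
        (mapᴾ {e = e} (λ γ → eEntry (I γ) (A γ)) (λ γ → allFin (Sch.n (I γ))) (λ γ J → encᵘ (summand γ J)) at
          (recode (λ (γ , J) → sym (if-float encᵘ (loadTerm (I γ) (A γ) (z γ) (t γ) J)))
            (ifᴾ {b = λ (γ , J) → loadTerm (I γ) (A γ) (z γ) (t γ) J}
              (andᴾ (candidateᴾ I kt z zt A) (activeᴾ (I ∘ proj₁) (t ∘ proj₁) proj₂ (wk tt) (fstᴾ innerᴾ)))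
              (weightᴾ (I ∘ proj₁) (wk kt) (z ∘ proj₁) proj₂ (wk zt) (fstᴾ innerᴾ))
              (pairᴾ (constᴾ (+ 0)) (constᴾ (+ 1)))))))
      where
      summand : ∀ γ → Fin (Sch.n (I γ)) → ℚᵘ
      summand γ J = if loadTerm (I γ) (A γ) (z γ) (t γ) J then weightᵘ (I γ) (z γ) J else 0ℚᵘ

    overᴾ : (t : Γ → ℚ) → PT e (encodeℚ ∘ t) → PT e (λ γ → boolᵛ (Alg.overᵇ (I γ) (A γ) (z γ) (t γ)))
    overᴾ t tt = leq~ᴾ {x = λ γ → Sch.r (I γ) (z γ)} {λ γ → Alg.loadᴬ (I γ) (A γ) (z γ) (t γ)}
      {λ γ → toℚᵘ (Sch.r (I γ) (z γ))} {λ γ → loadᵘ (I γ) (A γ) (z γ) (t γ)}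
      (λ _ → ℚᵘ.≃-refl) (λ γ → ~-load (I γ) (A γ) (z γ) (t γ))
      (toᵘᴾ {x = λ γ → Sch.r (I γ) (z γ)} (sndᴾ zt)) (loadᴾ t tt)

  module _ {Γ : Set} {e : Γ → Val} (I : Γ → Inst) (kt : PT e (keptOf ∘ I))
           (z : ∀ γ → Sch.Type (I γ)) (zt : PT e (λ γ → eT (I γ) (z γ)))
           (A : ∀ γ → Alg.Status (I γ)) (at : PT e (λ γ → eStatus (I γ) (A γ))) where

    private
      E : (Σ[ γ ∈ Γ ] Fin (Sch.n (I γ))) → Val
      E (γ , J) = pair (e γ) (eEntry (I γ) (A γ) J)

      job : PT E (λ (γ , J) → eJ (I γ) J)
      job = fstᴾ innerᴾ

    selectᴾ : PT E (λ (γ , J) → boolᵛ (Alg.selectᵇ (I γ) (A γ) (z γ) J))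
    selectᴾ = andᴾ (candidateᴾ I kt z zt A)
      (andᴾ {b = λ (γ , J) → Alg.overᵇ (I γ) (A γ) (z γ) (Sch.I⁻ (I γ) J)}
        (overᴾ (I ∘ proj₁) (wk kt) (z ∘ proj₁) (wk zt) (A ∘ proj₁) (wk at) (λ (γ , J) → Sch.I⁻ (I γ) J)
          (I⁻ᴾ (I ∘ proj₁) proj₂ job))
        (allᴾ {e = E} (λ (γ , J) → eEntry (I γ) (A γ)) (λ (γ , J) → allFin (Sch.n (I γ)))
          (λ (γ , J) J′ → let t = Sch.I⁺ (I γ) J′ in
            not (does (Sch._∈I?_ (I γ) t J) ∧ not (Alg.overᵇ (I γ) (A γ) (z γ) t)))
          (wk at)
          (notᴾ (andᴾ {b = λ ((γ , J) , J′) → does (Sch._∈I?_ (I γ) (Sch.I⁺ (I γ) J′) J)}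
            (activeᴾ (I ∘ proj₁ ∘ proj₁) end (proj₂ ∘ proj₁) endᴾ (wk job))
            (notᴾ (overᴾ (I ∘ proj₁ ∘ proj₁) (wk (wk kt)) (z ∘ proj₁ ∘ proj₁) (wk (wk zt))
              (A ∘ proj₁ ∘ proj₁) (wk (wk at)) end endᴾ))))))
      where
      end : Σ[ δ ∈ (Σ[ γ ∈ Γ ] Fin (Sch.n (I γ))) ] Fin (Sch.n (I (proj₁ δ))) → ℚ
      end ((γ , J) , J′) = Sch.I⁺ (I γ) J′

      endᴾ : PT (λ ((γ , J) , J′) → pair (E (γ , J)) (eEntry (I γ) (A γ) J′)) (encodeℚ ∘ end)
      endᴾ = I⁺ᴾ (I ∘ proj₁ ∘ proj₁) proj₂ (fstᴾ innerᴾ)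

    stepᴾ : PT e (λ γ → eStatus (I γ) (Alg.step (I γ) (z γ) (A γ)))
    stepᴾ = mapᴾ {e = e} (λ γ → eEntry (I γ) (A γ)) (λ γ → allFin (Sch.n (I γ)))
      (λ γ → eEntry (I γ) (Alg.step (I γ) (z γ) (A γ))) at
      (pairᴾ job (recode (λ (γ , J) → sym (if-float (eMaybe (I γ)) (Alg.selectᵇ (I γ) (A γ) (z γ) J)))
        (ifᴾ {b = λ (γ , J) → Alg.selectᵇ (I γ) (A γ) (z γ) J} selectᴾ (wk zt) (sndᴾ innerᴾ))))

  size-∈ : ∀ {A : Set} (eA : A → Val) {x xs} → x ∈ₗ xs → size (eA x) ≤ size (encL eA xs)
  size-∈ eA {xs = x ∷ xs} (here refl) = m≤n⇒m≤1+n (m≤m+n (size (eA x)) (size (encL eA xs)))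
  size-∈ eA {xs = y ∷ xs} (there x∈)  = m≤n⇒m≤1+n (≤-trans (size-∈ eA x∈) (m≤n+m (size (encL eA xs)) (size (eA y))))

  size-zipped : ∀ {A : Set} (eA v : A → Val) {M} → (∀ a → size (v a) ≤ M) → ∀ as →
                size (encL (λ a → pair (eA a) (v a)) as) ≤ size (encL eA as) + length as * suc M
  size-zipped eA v v≤ []       = ≤-refl
  size-zipped eA v {M} v≤ (a ∷ as) = ≤-trans
    (s≤s (+-mono-≤ (s≤s (+-monoʳ-≤ (size (eA a)) (v≤ a))) (size-zipped eA v v≤ as)))
    (≤-reflexive (solve 4 (λ x m l k → con 1 :+ ((con 1 :+ (x :+ m)) :+ (l :+ k)) := (con 1 :+ (x :+ l)) :+ ((con 1 :+ m) :+ k)) refl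
      (size (eA a)) M (size (encL eA as)) (length as * suc M)))
    where open +-*-Solver

  jobsOf typesOf : Inst → Val
  jobsOf  𝓘 = encL (eJ 𝓘) (allFin (Sch.n 𝓘))
  typesOf 𝓘 = encL (eT 𝓘) (allFin (suc (Sch.top 𝓘)))

  -- Each entry of the status is 0 or the code of a type processed so far, so the size of the status
  -- stays polynomial however many steps are made.
  assignᴾ : ∀ {e : Inst → Val} → PT e keptOf → PT e jobsOf → PT e (λ 𝓘 → eStatus 𝓘 (Alg.final 𝓘))
  assignᴾ {e} kt jt = foldrᴾ {e = e} {S = Alg.Status} eT eStatus Alg.step Alg.kept (λ _ _ → nothing) kt
    (mapᴾ {e = e} eJ (λ 𝓘 → allFin (Sch.n 𝓘)) (λ 𝓘 J → eEntry 𝓘 (λ _ → nothing) J) jt (pairᴾ innerᴾ (constᴾ (+ 0))))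
    (stepᴾ proj₁ (wk₂ kt) (proj₁ ∘ proj₂) (sndᴾ outerᴾ) (proj₂ ∘ proj₂) innerᴾ)
    ( (λ m → c * m ^ d + c * m ^ d * suc m)
    , poly-+ (poly-monomial poly-id c d) (poly-* (poly-monomial poly-id c d) (poly-+ (poly-const 1) poly-id))
    , bound )
    where
    c = proj₁ (small jt)
    d = proj₁ (proj₂ (small jt))

    entry≤ : ∀ 𝓘 ys J → size (eMaybe 𝓘 (Alg.assign 𝓘 ys J)) ≤ size (encL (eT 𝓘) ys)
    entry≤ 𝓘 ys J with Alg.assign 𝓘 ys J in eq
    ... | nothing = size≥1 (encL (eT 𝓘) ys)
    ... | just y  = size-∈ (eT 𝓘) (Alg.assign-∈ 𝓘 ys {J} eq)

    bound : ∀ 𝓘 ys → let m = size (e 𝓘) + size (encL (eT 𝓘) ys) in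
            size (eStatus 𝓘 (Alg.assign 𝓘 ys)) ≤ c * m ^ d + c * m ^ d * suc m
    bound 𝓘 ys = ≤-trans (size-zipped (eJ 𝓘) (λ J → eMaybe 𝓘 (Alg.assign 𝓘 ys J)) (entry≤ 𝓘 ys) (allFin (Sch.n 𝓘)))
      (+-mono-≤ jobs≤ (*-mono-≤ (≤-trans (length≤size (eJ 𝓘) (allFin (Sch.n 𝓘))) jobs≤) (s≤s (m≤n+m _ (size (e 𝓘))))))
      where
      jobs≤ : size (jobsOf 𝓘) ≤ c * (size (e 𝓘) + size (encL (eT 𝓘) ys)) ^ d
      jobs≤ = ≤-trans (proj₂ (proj₂ (small jt)) 𝓘) (monomial-mono c d (m≤m+n (size (e 𝓘)) _))

  thinᴾ : ∀ {e : Inst → Val} → PT e typesOf → PT e keptOf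
  thinᴾ {e} tt = foldr⁺ᴾ {e = e} {S = λ 𝓘 → List (Sch.Type 𝓘)} eT (λ 𝓘 → encL (eT 𝓘)) Alg.keep
    (λ 𝓘 → allFin (suc (Sch.top 𝓘))) (λ _ → []) tt (constᴾ (+ 0))
    (recode (λ (𝓘 , z , ks) → sym (if-float (encL (eT 𝓘)) (allᵇ (Alg.twiceBelow 𝓘 z) ks)))
      (ifᴾ {b = λ (𝓘 , z , ks) → allᵇ (Alg.twiceBelow 𝓘 z) ks}
        (allᴾ (λ (𝓘 , z , ks) → eT 𝓘) (λ (𝓘 , z , ks) → ks) (λ (𝓘 , z , ks) → Alg.twiceBelow 𝓘 z) innerᴾ
          (leq~ᴾ {x = λ ((𝓘 , z , ks) , k) → Sch.r 𝓘 z ℚ.+ Sch.r 𝓘 z} {λ ((𝓘 , z , ks) , k) → Sch.r 𝓘 k}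
                 {λ ((𝓘 , z , ks) , k) → toℚᵘ (Sch.r 𝓘 z) ℚᵘ.+ toℚᵘ (Sch.r 𝓘 z)} {λ ((𝓘 , z , ks) , k) → toℚᵘ (Sch.r 𝓘 k)}
            (λ ((𝓘 , z , ks) , k) → ~-+ {Sch.r 𝓘 z} {Sch.r 𝓘 z} ℚᵘ.≃-refl ℚᵘ.≃-refl) (λ _ → ℚᵘ.≃-refl)
            (addᵘᴾ {u = λ ((𝓘 , z , ks) , k) → toℚᵘ (Sch.r 𝓘 z)} {λ ((𝓘 , z , ks) , k) → toℚᵘ (Sch.r 𝓘 z)} rate rate)
            (toᵘᴾ {x = λ ((𝓘 , z , ks) , k) → Sch.r 𝓘 k} (sndᴾ innerᴾ))))
        (pairᴾ (sndᴾ outerᴾ) innerᴾ) innerᴾ))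
    ( suc , poly-+ (poly-const 1) poly-id , adds )
    where
    rate : PT {Σ[ δ ∈ (Σ[ 𝓘 ∈ Inst ] Sch.Type 𝓘 × List (Sch.Type 𝓘)) ] Sch.Type (proj₁ δ)}
              (λ ((𝓘 , z , ks) , k) → pair (pair (pair (e 𝓘) (eT 𝓘 z)) (encL (eT 𝓘) ks)) (eT 𝓘 k))
              (λ ((𝓘 , z , ks) , k) → encᵘ (toℚᵘ (Sch.r 𝓘 z)))
    rate = toᵘᴾ {x = λ ((𝓘 , z , ks) , k) → Sch.r 𝓘 z} (sndᴾ (sndᴾ (outerᴾ ⨾ᴾ outerᴾ)))

    adds : ∀ 𝓘 z ks → size (encL (eT 𝓘) (Alg.keep 𝓘 z ks)) ≤ size (encL (eT 𝓘) ks) + suc (size (e 𝓘) + size (eT 𝓘 z))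
    adds 𝓘 z ks with allᵇ (Alg.twiceBelow 𝓘 z) ks
    ... | false = m≤m+n _ _
    ... | true  = ≤-trans (s≤s (≤-trans (≤-reflexive (+-comm (size (eT 𝓘 z)) (size (encL (eT 𝓘) ks))))
        (+-monoʳ-≤ (size (encL (eT 𝓘) ks)) (m≤n+m (size (eT 𝓘 z)) (size (e 𝓘))))))
      (≤-reflexive (sym (+-suc (size (encL (eT 𝓘) ks)) (size (e 𝓘) + size (eT 𝓘 z)))))

  countBelow : ∀ {m} → Fin m → Fin m → ℕ → ℕ
  countBelow z y k = if does (y Fin.<? z) then suc k else k

  countBelow-zero : ∀ {m} (ys : List (Fin (suc m))) → List.foldr (countBelow zero) 0 ys ≡ 0
  countBelow-zero []       = refl
  countBelow-zero (y ∷ ys) = countBelow-zero ys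

  countBelow-allFin : ∀ {m} (z : Fin m) → List.foldr (countBelow z) 0 (allFin m) ≡ toℕ z
  countBelow-allFin {suc m} zero    = countBelow-zero (allFin (suc m))
  countBelow-allFin {suc m} (suc z) = cong suc (trans
    (cong (List.foldr (countBelow (suc z)) 0) (sym (List.map-tabulate id suc)))
    (trans (List.foldr-map (countBelow (suc z)) suc 0 (allFin m)) (countBelow-allFin z)))

  -- The output needs the number of a type, which its code lacks; counting the smaller types in the
  -- full list recovers it.
  indexᴾ : (I : Γ → Inst) → PT e (typesOf ∘ I) → (z : ∀ γ → Sch.Type (I γ)) → PT e (λ γ → eT (I γ) (z γ)) →
           PT e (λ γ → int (+ toℕ (z γ)))
  indexᴾ {Γ} {e} I tt z zt = recode (λ γ → cong (int ∘ +_) (countBelow-allFin (z γ)))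
    (foldr⁺ᴾ {e = e} {S = λ _ → ℕ} (λ γ → eT (I γ)) (λ _ → int ∘ +_) (λ γ → countBelow (z γ))
      (λ γ → allFin (suc (Sch.top (I γ)))) (λ _ → 0) tt (constᴾ (+ 0))
      (recode (λ (γ , y , k) → sym (if-float (int ∘ +_) (does (y Fin.<? z γ))))
        (ifᴾ {b = λ (γ , y , k) → does (y Fin.<? z γ)}
          (type<ᴾ (I ∘ proj₁) (proj₁ ∘ proj₂) (z ∘ proj₁) (sndᴾ outerᴾ) (wk₂ zt))
          (addᴾ {i = λ _ → + 1} (constᴾ (+ 1)) innerᴾ) innerᴾ))
      ( (λ _ → 3) , poly-const 3 , adds ))
    where
    adds : ∀ γ y k → sizeℤ (+ countBelow (z γ) y k) ≤ sizeℤ (+ k) + 3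
    adds γ y k with does (y Fin.<? z γ)
    ... | false = m≤m+n (sizeℤ (+ k)) 3
    ... | true  = ≤-trans (size-+′ (+ 1) (+ k)) (≤-reflexive (+-comm 3 (sizeℤ (+ k))))

  -- Calling dual colouring and assembling the output.

  module WithDualColouring (dc : BSHMℚ.DualColouring) (dc-poly : PolynomialTimeDualColouring dc) where

    open BSHMℚ.DualColouring dc using (colour)

    dcᴾ : PT encodeDualColouringInput (λ ι → encodeFamily (λ J → encodeℕ (colour ι J)))
    dcᴾ = let p , a , b , run = dc-poly in pt p a b λ ι → let v , k , D , k≤ , v≡ = run ι in
      k , subst (λ v → p ⊢ encodeDualColouringInput ι ⇓ v cost k) v≡ D , k≤

    -- Each stage keeps everything before it, in particular the original encoding, from which the
    -- jobs are later copied unchanged into the dual colouring input.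
    e₁ e₂ e₃ : Inst → Val
    e₁ 𝓘 = pair (encodeInstance 𝓘) (pair (typesOf 𝓘) (jobsOf 𝓘))
    e₂ 𝓘 = pair (e₁ 𝓘) (keptOf 𝓘)
    e₃ 𝓘 = pair (e₂ 𝓘) (eStatus 𝓘 (Alg.final 𝓘))

    prepareᴾ : PT encodeInstance e₃
    prepareᴾ = pairᴾ idᴾ (pairᴾ (recode (λ 𝓘 → cong encodeList (sym (List.map-tabulate id (eT 𝓘)))) (fstᴾ idᴾ))
                                (tagᴾ rawJob (sndᴾ idᴾ)))
      ⨾ᴾ pairᴾ idᴾ (thinᴾ (fstᴾ innerᴾ))
      ⨾ᴾ pairᴾ idᴾ (assignᴾ innerᴾ (sndᴾ (sndᴾ outerᴾ)))

    Job : Set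
    Job = Σ[ 𝓘 ∈ Inst ] Fin (Sch.n 𝓘)

    E : Job → Val
    E (𝓘 , J) = pair (e₃ 𝓘) (eEntry 𝓘 (Alg.final 𝓘) J)

    τ : (δ : Job) → Sch.Type (proj₁ δ)
    τ (𝓘 , J) = Alg.type 𝓘 J

    eMaybe-final : ∀ 𝓘 J → eMaybe 𝓘 (Alg.final 𝓘 J) ≡ eT 𝓘 (Alg.type 𝓘 J)
    eMaybe-final 𝓘 J = cong (eMaybe 𝓘) (proj₂ (Alg.assigned 𝓘 J))

    τᴾ : PT E (λ δ → eT (proj₁ δ) (τ δ))
    τᴾ = recode (λ (𝓘 , J) → eMaybe-final 𝓘 J) (sndᴾ innerᴾ)

    -- Membership in `K` is tested by comparing the capacities of the two assigned types in both
    -- directions.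
    same-type : ∀ 𝓘 J J′ → let g = Sch.g 𝓘 ; z = Alg.type 𝓘 J ; z′ = Alg.type 𝓘 J′ in
                does (g z′ ℚ.≤? g z) ∧ does (g z ℚ.≤? g z′) ≡ does (J′ ∈? Alg.K 𝓘 z)
    same-type 𝓘 J J′ = ≡true-cong
      (λ eq → dec-true (J′ ∈? Alg.K 𝓘 z) (subst (λ y → J′ ∈ Alg.K 𝓘 y)
        (equal (does⁻ (g z′ ℚ.≤? g z) (proj₁ (∧⁻ eq))) (does⁻ (g z ℚ.≤? g z′) (proj₂ (∧⁻ {does (g z′ ℚ.≤? g z)} eq)))) (Alg.J∈K 𝓘 J′)))
      (λ eq → let z′≡z = just-injective (trans (sym (proj₂ (Alg.assigned 𝓘 J′))) (Alg.∈K⁻ 𝓘 (does⁻ (J′ ∈? Alg.K 𝓘 z) eq))) in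
        ∧⁺ (dec-true (g z′ ℚ.≤? g z) (ℚ.≤-reflexive (cong g z′≡z))) (dec-true (g z ℚ.≤? g z′) (ℚ.≤-reflexive (cong g (sym z′≡z)))))
      where
      open import Data.Maybe.Properties using (just-injective)
      open import Relation.Binary.Definitions using (tri<; tri≈; tri>)
      g  = Sch.g 𝓘
      z  = Alg.type 𝓘 J
      z′ = Alg.type 𝓘 J′

      equal : g z′ ℚ.≤ g z → g z ℚ.≤ g z′ → z′ ≡ z
      equal ≤₁ ≤₂ with Fin.<-cmp z′ z
      ... | tri< z′<z _ _ = contradiction ≤₂ (ℚFP.<⇒≱ (Sch.g-mono-< 𝓘 z′<z))
      ... | tri≈ _ eq _   = eq
      ... | tri> _ _ z<z′ = contradiction ≤₁ (ℚFP.<⇒≱ (Sch.g-mono-< 𝓘 z<z′))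

    statusᴾ : PT E (λ δ → eStatus (proj₁ δ) (Alg.final (proj₁ δ)))
    statusᴾ = sndᴾ outerᴾ

    flagsᴾ : PT E (λ δ → encodeFamily (λ J′ → truth (J′ ∈? Alg.K (proj₁ δ) (τ δ))))
    flagsᴾ = recode (λ (𝓘 , J) → cong encodeList (List.map-tabulate id (λ J′ → truth (J′ ∈? Alg.K 𝓘 (Alg.type 𝓘 J)))))
      (mapᴾ {e = E} (λ δ → eEntry (proj₁ δ) (Alg.final (proj₁ δ))) (λ δ → allFin (Sch.n (proj₁ δ)))
        (λ δ J′ → truth (J′ ∈? Alg.K (proj₁ δ) (τ δ))) statusᴾ
        (recode (λ ((𝓘 , J) , J′) → cong boolᵛ (same-type 𝓘 J J′))
          (andᴾ (leqℚᴾ {x = λ ((𝓘 , J) , J′) → Sch.g 𝓘 (Alg.type 𝓘 J′)} {λ ((𝓘 , J) , J′) → Sch.g 𝓘 (Alg.type 𝓘 J)} there′ here′)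
                (leqℚᴾ {x = λ ((𝓘 , J) , J′) → Sch.g 𝓘 (Alg.type 𝓘 J)} {λ ((𝓘 , J) , J′) → Sch.g 𝓘 (Alg.type 𝓘 J′)} here′ there′))))
      where
      E₂ : Σ[ δ ∈ Job ] Fin (Sch.n (proj₁ δ)) → Val
      E₂ ((𝓘 , J) , J′) = pair (E (𝓘 , J)) (eEntry 𝓘 (Alg.final 𝓘) J′)

      here′ : PT E₂ (λ ((𝓘 , J) , J′) → encodeℚ (Sch.g 𝓘 (Alg.type 𝓘 J)))
      here′ = fstᴾ (wk τᴾ)

      there′ : PT E₂ (λ ((𝓘 , J) , J′) → encodeℚ (Sch.g 𝓘 (Alg.type 𝓘 J′)))
      there′ = fstᴾ (recode (λ ((𝓘 , J) , J′) → eMaybe-final 𝓘 J′) (sndᴾ innerᴾ))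

    inputOf : Job → BSHMℚ.DualColouringInput
    inputOf (𝓘 , J) = Alg.input 𝓘 dc (Alg.type 𝓘 J)

    inputᴾ : PT E (encodeDualColouringInput ∘ inputOf)
    inputᴾ = pairᴾ (fstᴾ τᴾ) (pairᴾ (sndᴾ (fstᴾ (outerᴾ ⨾ᴾ outerᴾ ⨾ᴾ outerᴾ))) flagsᴾ)

    entry : (δ : Job) → Val
    entry (𝓘 , J) = pair (encodeℕ (toℕ (Alg.type 𝓘 J))) (encodeℕ (colour (inputOf (𝓘 , J)) J))

    -- Dual colouring is run afresh for every job, on the jobs of its own type, and only the colour
    -- of this job is kept. The number of calls is the number of jobs, so the time remains
    -- polynomial.
    entryᴾ : PT E entry
    entryᴾ = pairᴾ (indexᴾ proj₁ (fstᴾ (sndᴾ (outerᴾ ⨾ᴾ outerᴾ ⨾ᴾ outerᴾ))) τ τᴾ)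
      (pickᴾ (λ (𝓘 , J) → colour (inputOf (𝓘 , J))) proj₂ (inputᴾ ⨾ᴾ reindex inputOf dcᴾ) (fstᴾ (fstᴾ innerᴾ)))

    scheduleᴾ : PT encodeInstance (λ 𝓘 → encodeSchedule 𝓘 (Alg.schedule 𝓘 dc))
    scheduleᴾ = prepareᴾ ⨾ᴾ recode (λ 𝓘 → cong encodeList (List.map-tabulate id (λ J → entry (𝓘 , J))))
      (mapᴾ {e = e₃} (λ 𝓘 → eEntry 𝓘 (Alg.final 𝓘)) (λ 𝓘 → allFin (Sch.n 𝓘)) (λ 𝓘 J → entry (𝓘 , J)) innerᴾ entryᴾ)

mainTheorem1 : ( ∀ (𝔽 : OrderedField) (dc : BSHM.DualColouring 𝔽) (𝓘 : BSHM.Instance 𝔽) →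
    BSHM.PowersOf8 𝔽 𝓘 →
    BSHM.Scheduling._CostsAtMost_×OPT 𝔽 𝓘 (BSHM.Offline.ALG-offline 𝔽 𝓘 dc) 180 )
    ×
    ( ∃ λ (C : ℕ) →
    ∀ (dc : BSHM.DualColouring ℚ-orderedField) → PolynomialTimeDualColouring dc →
    ∃ λ (algorithm : Prog) →
    PolynomialTime algorithm encodeInstance (IsApproximation C) )
mainTheorem1 =
  (λ 𝔽 dc 𝓘 powers → OfflineProperties.ALG-offline-approximates 𝔽 𝓘 powers dc) ,
  136 , λ dc dc-poly → let open PolynomialTimePrograms.PT (PolynomialTimePrograms.WithDualColouring.scheduleᴾ dc dc-poly) in
    program , coeff , deg , λ 𝓘 → let k , halts , k≤ = run 𝓘 ; open Approximation ℚ-orderedField 𝓘 in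
      encodeSchedule 𝓘 (schedule dc) , k , halts , k≤ ,
      schedule dc , refl , schedule-feasible dc , schedule-approximates dc
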